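{- There is an $O(NB)$-time algorithm that, given a rooted tree with $N$ nodes, a probability distribution on its leaves, and a known block size $B$, computes a layout with block size $B$ whose expected block cost is at most $1$ more than the expected block cost of the optimal layout with block size $B$.
   Context: The tree is a finite rooted tree with fixed parent/child structure (arbitrary degrees) and a given probability distribution on its leaves. A layout with block size $B$ is a partition of the nodes into blocks, each containing at most $B$ nodes. The expected block cost of a layout is the expected number of (distinct) blocks containing nodes of the root-to-leaf path, when the leaf is selected at random according to the given distribution. The optimal layout with block size $B$ minimizes the expected block cost over all layouts with block size $B$. Running time is measured on a RAM. -}

module Defs where

open import Level using (Level; suc; _⊔_)
open import Algebra.Bundles using (CommutativeRing)
import Algebra.Definitions.RawMonoid as RawMonoidDefinitions
open import Data.Bool using (if_then_else_)
open import Data.Fin using (Fin; toℕ; fromℕ<)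
open import Data.List using (List; []; _∷_; allFin; deduplicate; drop; filter; head; length; map)
open import Data.Maybe using (Maybe; just; nothing)
open import Data.Nat as ℕ using (ℕ)
import Data.Nat.Properties as ℕ
open import Data.Product using (∃)
open import Relation.Binary using (Rel; IsDecTotalOrder)
open import Relation.Binary.PropositionalEquality using (_≡_; _≢_)
open import Relation.Nullary using (¬_; does; yes; no)

-- Probabilities are taken in an arbitrary ordered field (ℚ, ℝ, …) whose order
-- is decided by the machine's comparison instruction.

record OrderedField (a ℓ₁ ℓ₂ : Level) : Set (suc (a ⊔ ℓ₁ ⊔ ℓ₂)) where
  infix 4 _≤_
  field
    commutativeRing : CommutativeRing a ℓ₁
  open CommutativeRing commutativeRing public
  field
    _≤_             : Rel Carrier ℓ₂
    isDecTotalOrder : IsDecTotalOrder _≈_ _≤_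
    0≉1             : ¬ (0# ≈ 1#)
    inverse         : ∀ x → ¬ (x ≈ 0#) → ∃ λ y → x * y ≈ 1#
    +-monoʳ-≤       : ∀ z {x y} → x ≤ y → z + x ≤ z + y
    *-nonNegative   : ∀ {x y} → 0# ≤ x → 0# ≤ y → 0# ≤ x * y
  open IsDecTotalOrder isDecTotalOrder public
    using (_≤?_; _≟_; total; antisym; ≤-respˡ-≈; ≤-respʳ-≈)
    renaming (refl to ≤-refl; reflexive to ≤-reflexive; trans to ≤-trans)
  open RawMonoidDefinitions +-rawMonoid public
    using (sum) renaming (_×_ to _·_)

data Path {N : ℕ} (parent : Fin N → Maybe (Fin N)) (r : Fin N) : Fin N → Set where
  here : Path parent r r
  step : ∀ {u v} → parent v ≡ just u → Path parent r u → Path parent r v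

pathNodes : ∀ {N} {parent : Fin N → Maybe (Fin N)} {r v} → Path parent r v → List (Fin N)
pathNodes {r = r} here       = r ∷ []
pathNodes {v = v} (step _ π) = v ∷ pathNodes π

-- The numbering of the nodes is arbitrary; in particular a parent need not
-- precede its children.

record RootedTree (N : ℕ) : Set where
  field
    parent      : Fin N → Maybe (Fin N)
    root        : Fin N
    root-parent : parent root ≡ nothing
    rootPath    : ∀ v → Path parent root v

  IsLeaf : Fin N → Set
  IsLeaf v = ∀ w → parent w ≢ just v

blockSize : ∀ {N} → (Fin N → ℕ) → ℕ → ℕ
blockSize {N} block b = length (filter (λ v → block v ℕ.≟ b) (allFin N))

-- A partition of the nodes, given by labelling each node with its block.

record Layout (N B : ℕ) : Set where
  field
    block       : Fin N → ℕ
    blockSize≤B : ∀ b → blockSize block b ℕ.≤ B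

blockCost : ∀ {N B} → RootedTree N → Layout N B → Fin N → ℕ
blockCost T L v =
  length (deduplicate ℕ._≟_ (map (Layout.block L) (pathNodes (RootedTree.rootPath T v))))

module _ {a ℓ₁ ℓ₂} (K : OrderedField a ℓ₁ ℓ₂) where
  open OrderedField K

  -- A distribution on the leaves, extended by zero to the internal nodes.

  record LeafDistribution {N : ℕ} (T : RootedTree N) : Set (a ⊔ ℓ₁ ⊔ ℓ₂) where
    field
      prob        : Fin N → Carrier
      nonNegative : ∀ v → 0# ≤ prob v
      onLeaves    : ∀ v → ¬ RootedTree.IsLeaf T v → prob v ≈ 0#
      total       : sum prob ≈ 1#

  expectedBlockCost : ∀ {N B} (T : RootedTree N) → LeafDistribution T → Layout N B → Carrier
  expectedBlockCost T D L = sum λ v → LeafDistribution.prob D v * (blockCost T L v · 1#)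

  IsOptimal : ∀ {N B} (T : RootedTree N) → LeafDistribution T → Layout N B → Set ℓ₂
  IsOptimal {N} {B} T D L =
    ∀ (L′ : Layout N B) → expectedBlockCost T D L ≤ expectedBlockCost T D L′

-- A unit-cost RAM with two banks of registers and two memories: one of each
-- holds natural numbers, the other holds field elements.  Memory is addressed
-- indirectly, through a natural-number register.  The only arithmetic is
-- addition and subtraction (truncated on ℕ): unit-cost multiplication of
-- unbounded integers would make the model unreasonably strong.

Reg : Set
Reg = ℕ

data Instr : Set where
  set    : (d : Reg) (n : ℕ) → Instr
  add    : (d i j : Reg) → Instr
  sub    : (d i j : Reg) → Instr
  load   : (d i : Reg) → Instr
  store  : (i j : Reg) → Instr
  jump≤  : (i j : Reg) (target : ℕ) → Instr
  set0ᴷ  : (d : Reg) → Instr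
  set1ᴷ  : (d : Reg) → Instr
  addᴷ   : (d i j : Reg) → Instr
  subᴷ   : (d i j : Reg) → Instr
  loadᴷ  : (d i : Reg) → Instr                     -- i is a natural-number register
  storeᴷ : (i j : Reg) → Instr                     -- i is a natural-number register
  jump≤ᴷ : (i j : Reg) (target : ℕ) → Instr
  halt   : Instr

Program : Set
Program = List Instr

infixl 9 _[_≔_]

_[_≔_] : ∀ {a} {A : Set a} → (ℕ → A) → ℕ → A → ℕ → A
(f [ i ≔ x ]) j = if does (i ℕ.≟ j) then x else f j

-- An array stored from address 0, the remaining cells holding a default value.

array : ∀ {a} {A : Set a} {N} → A → (Fin N → A) → ℕ → A
array {N = N} default f i with i ℕ.<? N
... | yes i<N = f (fromℕ< i<N)
... | no  _   = default

encodeParent : ∀ {N} → Maybe (Fin N) → ℕ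
encodeParent nothing  = 0
encodeParent (just u) = ℕ.suc (toℕ u)

module RAM {a ℓ₁ ℓ₂} (K : OrderedField a ℓ₁ ℓ₂) where
  open OrderedField K

  record State : Set a where
    constructor state
    field
      pc   : ℕ
      reg  : ℕ → ℕ
      mem  : ℕ → ℕ
      regᴷ : ℕ → Carrier
      memᴷ : ℕ → Carrier

  execute : Instr → State → Maybe State
  execute i (state pc r m rᴷ mᴷ) = go i
    where
    next : ℕ
    next = ℕ.suc pc

    go : Instr → Maybe State
    go (set d n)      = just (state next (r [ d ≔ n ]) m rᴷ mᴷ)
    go (add d i j)    = just (state next (r [ d ≔ r i ℕ.+ r j ]) m rᴷ mᴷ)
    go (sub d i j)    = just (state next (r [ d ≔ r i ℕ.∸ r j ]) m rᴷ mᴷ)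
    go (load d i)     = just (state next (r [ d ≔ m (r i) ]) m rᴷ mᴷ)
    go (store i j)    = just (state next r (m [ r i ≔ r j ]) rᴷ mᴷ)
    go (jump≤ i j t)  = just (state (if does (r i ℕ.≤? r j) then t else next) r m rᴷ mᴷ)
    go (set0ᴷ d)      = just (state next r m (rᴷ [ d ≔ 0# ]) mᴷ)
    go (set1ᴷ d)      = just (state next r m (rᴷ [ d ≔ 1# ]) mᴷ)
    go (addᴷ d i j)   = just (state next r m (rᴷ [ d ≔ rᴷ i + rᴷ j ]) mᴷ)
    go (subᴷ d i j)   = just (state next r m (rᴷ [ d ≔ rᴷ i - rᴷ j ]) mᴷ)
    go (loadᴷ d i)    = just (state next r m (rᴷ [ d ≔ mᴷ (r i) ]) mᴷ)
    go (storeᴷ i j)   = just (state next r m rᴷ (mᴷ [ r i ≔ rᴷ j ]))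
    go (jump≤ᴷ i j t) = just (state (if does (rᴷ i ≤? rᴷ j) then t else next) r m rᴷ mᴷ)
    go halt           = nothing

  -- The machine also halts when it runs off the program.

  stepOf : Program → State → Maybe State
  stepOf P s with head (drop (State.pc s) P)
  ... | just i  = execute i s
  ... | nothing = nothing

  -- P ⊢ s ⇓[ t ] s′: started in s, P halts in s′ after exactly t steps.

  infix 4 _⊢_⇓[_]_

  data _⊢_⇓[_]_ (P : Program) : State → ℕ → State → Set a where
    halted : ∀ {s} → stepOf P s ≡ nothing → P ⊢ s ⇓[ 0 ] s
    next   : ∀ {s s′ s″ t} → stepOf P s ≡ just s′ → P ⊢ s′ ⇓[ t ] s″ → P ⊢ s ⇓[ ℕ.suc t ] s″

  -- Registers 0 and 1 hold N and B; cell v of the two memories holds the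
  -- encoded parent and the probability of node v.

  input : ∀ {N} (B : ℕ) (T : RootedTree N) → LeafDistribution K T → State
  input {N} B T D = record
    { pc   = 0
    ; reg  = (λ _ → 0) [ 0 ≔ N ] [ 1 ≔ B ]
    ; mem  = array 0 (λ v → encodeParent (RootedTree.parent T v))
    ; regᴷ = λ _ → 0#
    ; memᴷ = array 0# (LeafDistribution.prob D)
    }

  -- Cell v of the number memory holds the label of the block containing v.

  Outputs : ∀ {N B} → State → Layout N B → Set
  Outputs s L = ∀ v → State.mem s (toℕ v) ≡ Layout.block L v

{-# OPTIONS --safe #-}

-- The cost of a layout is the expected number of nodes on a path whose label does
-- not occur above them.  Layouts with connected blocks suffice: let x > 0 nodes
-- below v have a label seen above v, and let v itself open a new block.  Then x
-- nodes at the top of the subtree can share the seen labels instead; the at most B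
-- nodes this displaces cost every path at most one further block, which is what v
-- saves.  Connected layouts are optimised exactly by a knapsack table A_v (k), the
-- least cost below v if the block at v has k nodes, to which the children c of v
-- contribute one by one: either A_v (i) + A_c (j) for i + j nodes, or A_v (i) plus
-- the cost min A_c + weight c of a new block at c.  With table ranges bounded by the
-- sizes x and y of the two trees this takes O(B + min(x,B) min(y,B)) steps, which add
-- up to O(NB).  The layout found is optimal, so it also serves as Opt.

module Submission where

open import Defs
open import Data.Nat as ℕ using (ℕ; NonZero; zero; suc; _∸_; _⊓_; z≤n; s≤s)
open import Data.Product using (_×_; Σ-syntax; ∃; ∃₂; _,_; proj₁; proj₂)
open import Algebra.Bundles using (CommutativeMonoid; CommutativeRing)
import Algebra.Definitions.RawMonoid as RawMonoidDefinitions
import Algebra.Properties.CommutativeMonoid.Mult as Multiplication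
import Algebra.Properties.Ring as RingProperties
import Algebra.Solver.CommutativeMonoid as MonoidSolver
open import Data.Bool using (Bool; true; false; if_then_else_; not; _∨_; _∧_; T)
open import Data.Fin as Fin using (Fin; toℕ; fromℕ<)
import Data.Fin.Properties as Fin
open import Data.List using (List; []; _∷_; _++_; _ʳ++_; length; foldr; map; tabulate;
                             allFin; deduplicate; filter; drop; lookup)
open import Data.List.Membership.Propositional using (_∈_; _∉_)
open import Data.List.Membership.Propositional.Properties using (∈-allFin; ∈-lookup; ∈-++⁻; ∈-++⁺ˡ; ∈-++⁺ʳ)
open import Data.List.Membership.Propositional.Properties.WithK using (unique∧set⇒bag)
import Data.List.Properties as List
open import Data.List.Relation.Binary.BagAndSetEquality using (∼bag⇒↭)
open import Data.List.Relation.Binary.Permutation.Propositional using (_↭_; ↭⇒↭ₛ′)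
open import Data.List.Relation.Binary.Permutation.Propositional.Properties using (map⁺)
import Data.List.Relation.Binary.Permutation.Setoid.Properties as Permutation
open import Data.List.Relation.Unary.All as All using (All; []; _∷_)
open import Data.List.Relation.Unary.All.Properties using (¬Any⇒All¬)
open import Data.List.Relation.Unary.AllPairs using ([]; _∷_)
open import Data.List.Relation.Unary.Any using (here; there)
import Data.Nat.Properties as ℕ
open import Data.List.Relation.Unary.Unique.DecPropositional.Properties ℕ._≟_ using (deduplicate-!)
open import Data.List.Relation.Unary.Unique.Propositional using (Unique)
open import Data.List.Relation.Unary.Unique.Propositional.Properties using (allFin⁺)
open import Data.Maybe using (Maybe; just; nothing)
import Data.Maybe.Properties as Maybe
open import Data.Unit using (tt)
open import Data.Sum using (_⊎_; inj₁; inj₂)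
open import Function using (_∘_; id; _$_; case_of_; mk⇔)
import Level
import Relation.Binary.Reasoning.PartialOrder as PosetReasoning
open import Relation.Binary using (Poset)
open import Relation.Nullary using (Dec; ¬_; does; yes; no; contradiction; ¬?)
open import Relation.Nullary.Decidable using (dec-true; dec-false)
open import Relation.Binary.PropositionalEquality as ≡ using (_≡_; _≢_; cong; cong₂)

-- The two bounds use different objects. A `Cut` has an exact number of nodes in the block at the
-- root, and every layout yields one of no greater cost. A `Plan` only has room for that many,
-- because blank memory serves as the initial table and reads as cost 0 for every room. An entry is
-- at most the cost of every `Cut` of its size and at least the cost of some `Plan`, namely one that
-- the stored choices determine; so the labels can be read back from memory. As the numbering of the
-- nodes says nothing about the tree, they are first listed with children before parents. Merging
-- follows this list and links the finished nodes in reverse, so that labelling undoes the merges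
-- one at a time, the last one first. The trees that the proof inducts on are the ones this list
-- builds up (`stage`). The products `min(x,B) min(y,B)` are summed by a potential `Φ` of tree sizes
-- that grows by at least the product when two trees are joined. Since `Φ n` is at most `2 B n`, the
-- total is linear in `N B` whatever the shape of the tree.

module OrderedFieldProperties {a ℓ₁ ℓ₂} (K : OrderedField a ℓ₁ ℓ₂) where
  open OrderedField K
  open RingProperties (CommutativeRing.ring commutativeRing) using (-‿distribˡ-*; -1*x≈-x; -‿involutive)

  poset : Poset a ℓ₁ ℓ₂
  poset = record { isPartialOrder = IsDecTotalOrder.isPartialOrder isDecTotalOrder }
    where open import Relation.Binary using (module IsDecTotalOrder)

  open PosetReasoning poset

  +-monoˡ-≤ : ∀ z {x y} → x ≤ y → x + z ≤ y + z
  +-monoˡ-≤ z {x} {y} x≤y = begin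
    x + z ≈⟨ +-comm x z ⟩
    z + x ≤⟨ +-monoʳ-≤ z x≤y ⟩
    z + y ≈⟨ +-comm z y ⟩
    y + z ∎

  +-mono-≤ : ∀ {x y u v} → x ≤ y → u ≤ v → x + u ≤ y + v
  +-mono-≤ {y = y} {u} x≤y u≤v = ≤-trans (+-monoˡ-≤ u x≤y) (+-monoʳ-≤ y u≤v)

  x≤x+y : ∀ x {y} → 0# ≤ y → x ≤ x + y
  x≤x+y x {y} 0≤y = begin
    x      ≈⟨ +-identityʳ x ⟨
    x + 0# ≤⟨ +-monoʳ-≤ x 0≤y ⟩
    x + y  ∎

  x≤y+x : ∀ x {y} → 0# ≤ y → x ≤ y + x
  x≤y+x x {y} 0≤y = ≤-trans (x≤x+y x 0≤y) (≤-reflexive (+-comm x y))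

  +-nonNegative : ∀ {x y} → 0# ≤ x → 0# ≤ y → 0# ≤ x + y
  +-nonNegative {x} 0≤x 0≤y = ≤-trans 0≤x (x≤x+y x 0≤y)

  -- Otherwise `- 1#` would be nonnegative, and so would its square, which is 1.
  0≤1 : 0# ≤ 1#
  0≤1 with total 0# 1#
  ... | inj₁ 0≤1 = 0≤1
  ... | inj₂ 1≤0 = begin
    0#            ≤⟨ *-nonNegative 0≤-1 0≤-1 ⟩
    - 1# * - 1#   ≈⟨ -1*x≈-x (- 1#) ⟩
    - - 1#        ≈⟨ -‿involutive 1# ⟩
    1#            ∎
    where
    0≤-1 : 0# ≤ - 1#
    0≤-1 = begin
      0#          ≈⟨ -‿inverseˡ 1# ⟨
      - 1# + 1#   ≤⟨ +-monoʳ-≤ (- 1#) 1≤0 ⟩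
      - 1# + 0#   ≈⟨ +-identityʳ (- 1#) ⟩
      - 1#        ∎

-- Trees, and labels that are new on a path

infixl 6 _◂_

-- t ◂ c attaches c as a further child of the root of t.
data Tree (N : ℕ) : Set where
  node : Fin N → Tree N
  _◂_  : Tree N → Tree N → Tree N

rootOf : ∀ {N} → Tree N → Fin N
rootOf (node v) = v
rootOf (t ◂ c)  = rootOf t

treeSize : ∀ {N} → Tree N → ℕ
treeSize (node v) = 1
treeSize (t ◂ c)  = treeSize t ℕ.+ treeSize c

δ : ℕ → ℕ → ℕ
δ b b′ = if does (b ℕ.≟ b′) then 1 else 0

-- A number rather than a decision, since it serves as the coefficient of a weight.
new : List ℕ → ℕ → ℕ
new []      b = 1
new (x ∷ X) b = if does (x ℕ.≟ b) then 0 else new X b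

new-here : ∀ b X → new (b ∷ X) b ≡ 0
new-here b X rewrite dec-true (b ℕ.≟ b) ≡.refl = ≡.refl

new-cong : ∀ X Y x → (∀ b → new X b ≡ new Y b) → ∀ b → new (x ∷ X) b ≡ new (x ∷ Y) b
new-cong X Y x h b with does (x ℕ.≟ b)
... | true  = ≡.refl
... | false = h b

new-absorb : ∀ X x → new X x ≡ 0 → ∀ b → new (x ∷ X) b ≡ new X b
new-absorb X x h b with x ℕ.≟ b
... | yes ≡.refl rewrite dec-true (b ℕ.≟ b) ≡.refl   = ≡.sym h
... | no  x≢b    rewrite dec-false (x ℕ.≟ b) x≢b = ≡.refl

new-0⊎1 : ∀ X b → new X b ≡ 0 ⊎ new X b ≡ 1
new-0⊎1 []      b = inj₂ ≡.refl
new-0⊎1 (x ∷ X) b with does (x ℕ.≟ b)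
... | true  = inj₁ ≡.refl
... | false = new-0⊎1 X b

distinct : List ℕ → ℕ
distinct X = length (deduplicate ℕ._≟_ X)

new-≡1⇒All : ∀ {b} X → new X b ≡ 1 → All (b ≢_) X
new-≡1⇒All []      h = []
new-≡1⇒All {b} (x ∷ X) h with x ℕ.≟ b
... | yes ≡.refl rewrite dec-true (b ℕ.≟ b) ≡.refl with () ← h
... | no  x≢b    rewrite dec-false (x ℕ.≟ b) x≢b = x≢b ∘ ≡.sym ∷ new-≡1⇒All X h

new-filter : ∀ {b x} X → x ≢ b → new (filter (¬? ∘ (x ℕ.≟_)) X) b ≡ new X b
new-filter         []      x≢b = ≡.refl
new-filter {b} {x} (y ∷ X) x≢b with x ℕ.≟ y
... | yes ≡.refl rewrite dec-true (x ℕ.≟ x) ≡.refl | dec-false (x ℕ.≟ b) x≢b = new-filter X x≢b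
... | no  x≢y    rewrite dec-false (x ℕ.≟ y) x≢y with does (y ℕ.≟ b)
...   | true  = ≡.refl
...   | false = new-filter X x≢b

new-deduplicate : ∀ {b} X → new (deduplicate ℕ._≟_ X) b ≡ new X b
new-deduplicate         []      = ≡.refl
new-deduplicate {b} (x ∷ X) with x ℕ.≟ b
... | yes ≡.refl rewrite dec-true (b ℕ.≟ b) ≡.refl = ≡.refl
... | no  x≢b    rewrite dec-false (x ℕ.≟ b) x≢b =
  ≡.trans (new-filter (deduplicate ℕ._≟_ X) x≢b) (new-deduplicate X)

length-remove : ∀ {b X} → Unique X → new X b ≡ 0 → suc (length (filter (¬? ∘ (b ℕ.≟_)) X)) ≡ length X
length-remove {b} {x ∷ X} (x∉X ∷ uX) h with x ℕ.≟ b
... | yes ≡.refl rewrite dec-true (x ℕ.≟ x) ≡.refl =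
  cong (suc ∘ length) (List.filter-all (¬? ∘ (x ℕ.≟_)) x∉X)
... | no  x≢b    rewrite dec-false (x ℕ.≟ b) x≢b | dec-false (b ℕ.≟ x) (x≢b ∘ ≡.sym) =
  cong suc (length-remove uX h)

-- `deduplicate` puts `b` in front and filters it out of the rest. The rest has no repetitions, so
-- the filter removes exactly one element or none. This turns the number of distinct labels into a
-- sum over the nodes of a path.
distinct-∷ : ∀ b X → distinct (b ∷ X) ≡ new X b ℕ.+ distinct X
distinct-∷ b X with new-0⊎1 X b
... | inj₁ old   rewrite old =
  length-remove (deduplicate-! X) (≡.trans (new-deduplicate X) old)
... | inj₂ fresh rewrite fresh =
  cong (suc ∘ length) (List.filter-all (¬? ∘ (b ℕ.≟_))
    (new-≡1⇒All (deduplicate ℕ._≟_ X) (≡.trans (new-deduplicate X) fresh)))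

module _ {N : ℕ} (ℓ : Fin N → ℕ) where

  count : ℕ → Tree N → ℕ
  count b (node v) = δ (ℓ v) b
  count b (t ◂ c)  = count b t ℕ.+ count b c

  -- This is the size allowed to a connected block at the root that takes over the labels already
  -- met above.
  seenCount : List ℕ → Tree N → ℕ
  seenCount X (node v) = 1 ∸ new X (ℓ v)
  seenCount X (t ◂ c)  = seenCount X t ℕ.+ seenCount X c

  seenCount-∷ : ∀ b X t → seenCount (b ∷ X) t ℕ.≤ seenCount X t ℕ.+ count b t
  seenCount-∷ b X (node v) with b ℕ.≟ ℓ v
  ... | yes ≡.refl rewrite dec-true (b ℕ.≟ b) ≡.refl = ℕ.m≤n+m 1 _
  ... | no  b≢     rewrite dec-false (b ℕ.≟ ℓ v) b≢ = ℕ.m≤m+n _ _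
  seenCount-∷ b X (t ◂ c)  = ℕ.≤-trans
    (ℕ.+-mono-≤ (seenCount-∷ b X t) (seenCount-∷ b X c))
    (ℕ.≤-reflexive (interchange (seenCount X t) (count b t) (seenCount X c) (count b c)))
    where open import Algebra.Properties.CommutativeSemigroup ℕ.+-commutativeSemigroup using (interchange)

occurrences : ∀ {N} → ℕ → Tree N → ℕ
occurrences b = count toℕ b

module _ where
  open import Data.Nat using (_+_; _*_; _≤_)
  open ℕ.≤-Reasoning
  open import Data.Nat.Solver using (module +-*-Solver)
  open +-*-Solver using (solve; _:+_; _:*_; _:=_)

  -- Induction step of `count-labels` at a kept child: `x` and `y` count the nodes with a given
  -- label in the two trees, `d` tells whether it is the label of the shared block, and `r` is the
  -- allowance that the root has not spent.
  charge-keep : ∀ x y r d i j B o o′ → x + r ≤ d * i + B * o → y ≤ d * j + B * o′ →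
                (x + y) + r ≤ d * (i + j) + B * (o + o′)
  charge-keep x y r d i j B o o′ h h′ = begin
    (x + y) + r                         ≡⟨ solve 3 (λ x y r → (x :+ y) :+ r := (x :+ r) :+ y) ≡.refl x y r ⟩
    (x + r) + y                         ≤⟨ ℕ.+-mono-≤ h h′ ⟩
    (d * i + B * o) + (d * j + B * o′)
      ≡⟨ solve 6 (λ d i j B o o′ → (d :* i :+ B :* o) :+ (d :* j :+ B :* o′) :=
                                   d :* (i :+ j) :+ B :* (o :+ o′)) ≡.refl d i j B o o′ ⟩
    d * (i + j) + B * (o + o′)          ∎

  -- The root of a severed child names its block, so its unspent allowance `B * r′` covers the
  -- `r′ * j` nodes of that block, as `j ≤ B`. Cancelling leaves `y ≤ B * o′`.
  charge-sever : ∀ x y r {j} d r′ k B o o′ → j ≤ B → x + r ≤ d * k + B * o →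
                 y + B * r′ ≤ r′ * j + B * o′ → (x + y) + r ≤ d * k + B * (o + o′)
  charge-sever x y r {j} d r′ k B o o′ j≤B h h′ = begin
    (x + y) + r                 ≡⟨ solve 3 (λ x y r → (x :+ y) :+ r := (x :+ r) :+ y) ≡.refl x y r ⟩
    (x + r) + y                 ≤⟨ ℕ.+-mono-≤ h y≤ ⟩
    (d * k + B * o) + B * o′
      ≡⟨ solve 5 (λ d k B o o′ → (d :* k :+ B :* o) :+ B :* o′ := d :* k :+ B :* (o :+ o′))
           ≡.refl d k B o o′ ⟩
    d * k + B * (o + o′)        ∎
    where
    y≤ : y ≤ B * o′
    y≤ = ℕ.+-cancelˡ-≤ (B * r′) _ _ (begin
      B * r′ + y         ≡⟨ ℕ.+-comm (B * r′) y ⟩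
      y + B * r′         ≤⟨ h′ ⟩
      r′ * j + B * o′    ≤⟨ ℕ.+-monoˡ-≤ _ (ℕ.*-monoʳ-≤ r′ j≤B) ⟩
      r′ * B + B * o′    ≡⟨ cong (_+ B * o′) (ℕ.*-comm r′ B) ⟩
      B * r′ + B * o′    ∎)

-- Connected divisions of a tree, compared with arbitrary labellings

module Partitions {a ℓ₁ ℓ₂} (K : OrderedField a ℓ₁ ℓ₂) {N : ℕ} (B : ℕ)
                  (p : Fin N → OrderedField.Carrier K)
                  (0≤p : ∀ v → OrderedField._≤_ K (OrderedField.0# K) (p v)) where
  open OrderedField K
  open OrderedFieldProperties K
  open MonoidSolver +-commutativeMonoid using (solve; _⊕_; _⊜_) renaming (id to ε)
  open Multiplication +-commutativeMonoid using (×-homo-+; ×-congˡ; ×-distrib-+)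
  open PosetReasoning poset

  weight : Tree N → Carrier
  weight (node v) = p v
  weight (t ◂ c)  = weight t + weight c

  weight-nonNegative : ∀ t → 0# ≤ weight t
  weight-nonNegative (node v) = 0≤p v
  weight-nonNegative (t ◂ c)  = +-nonNegative (weight-nonNegative t) (weight-nonNegative c)

  -- Cut t k: a division of t into connected blocks, the one at the root having
  -- k nodes and the others at most B.
  data Cut : Tree N → ℕ → Set where
    whole : ∀ {v} → Cut (node v) 1
    keep  : ∀ {t c i j} → Cut t i → Cut c j → Cut (t ◂ c) (i ℕ.+ j)
    sever : ∀ {t c i j} → Cut t i → Cut c j → j ℕ.≤ B → Cut (t ◂ c) i

  -- The block at the root is not charged.
  cutCost : ∀ {t k} → Cut t k → Carrier
  cutCost whole                 = 0#
  cutCost (keep κ κ′)           = cutCost κ + cutCost κ′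
  cutCost (sever {c = c} κ κ′ _) = cutCost κ + (cutCost κ′ + weight c)

  cut≥1 : ∀ {t k} → Cut t k → 1 ℕ.≤ k
  cut≥1 whole         = ℕ.≤-refl
  cut≥1 (keep κ _)    = ℕ.≤-trans (cut≥1 κ) (ℕ.m≤m+n _ _)
  cut≥1 (sever κ _ _) = cut≥1 κ

  cut≤size : ∀ {t k} → Cut t k → k ℕ.≤ treeSize t
  cut≤size whole         = ℕ.≤-refl
  cut≤size (keep κ κ′)   = ℕ.+-mono-≤ (cut≤size κ) (cut≤size κ′)
  cut≤size (sever κ _ _) = ℕ.≤-trans (cut≤size κ) (ℕ.m≤m+n _ _)

  -- The added cuts lie above disjoint subtrees, so each path pays for at most one more block, at
  -- most `weight t` in all. The bound `k ≤ x + B` keeps every part that is cut off within `B`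
  -- nodes.
  shrink : ∀ {t k} (κ : Cut t k) x → 1 ℕ.≤ x → x ℕ.≤ k → k ℕ.≤ x ℕ.+ B →
           Σ[ κ′ ∈ Cut t x ] cutCost κ′ ≤ cutCost κ + weight t
  shrink (whole {v}) 1 _ _ _ = whole , x≤x+y 0# (0≤p v)
  shrink (whole {v}) (suc (suc _)) _ (s≤s ()) _
  shrink (keep {t} {c} {i} {j} κ κ′) x 1≤x x≤ ≤x+B with x ℕ.≤? i
  ... | yes x≤i
    with λ′ , h ← shrink κ x 1≤x x≤i (ℕ.≤-trans (ℕ.m≤m+n i j) ≤x+B) =
    -- `i + j ≤ x + B` and `x ≤ i` give `j ≤ B`, so the share of `c` in the root block can become a
    -- block of its own.
    sever λ′ κ′ (ℕ.+-cancelˡ-≤ i _ _ (ℕ.≤-trans ≤x+B (ℕ.+-monoˡ-≤ B x≤i))) , (begin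
      cutCost λ′ + (cutCost κ′ + weight c)               ≤⟨ +-monoˡ-≤ _ h ⟩
      (cutCost κ + weight t) + (cutCost κ′ + weight c)
        ≈⟨ solve 4 (λ q r s u → (q ⊕ r) ⊕ (s ⊕ u) ⊜ (q ⊕ s) ⊕ (r ⊕ u)) refl _ _ _ _ ⟩
      (cutCost κ + cutCost κ′) + (weight t + weight c)   ∎)
  ... | no x≰i
    with i<x ← ℕ.≰⇒> x≰i
    with λ′ , h ← shrink κ′ (x ∸ i) (ℕ.m<n⇒0<n∸m i<x)
           (ℕ.≤-trans (ℕ.∸-monoˡ-≤ i x≤) (ℕ.≤-reflexive (ℕ.m+n∸m≡n i j)))
           (ℕ.+-cancelˡ-≤ i _ _ (ℕ.≤-trans ≤x+B (ℕ.≤-reflexive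
             (≡.trans (cong (ℕ._+ B) (≡.sym (ℕ.m+[n∸m]≡n (ℕ.<⇒≤ i<x)))) (ℕ.+-assoc i (x ∸ i) B))))) =
    ≡.subst (λ y → Σ[ μ ∈ Cut (t ◂ c) y ] cutCost μ ≤ _) (ℕ.m+[n∸m]≡n (ℕ.<⇒≤ i<x))
      (keep κ λ′ , (begin
        cutCost κ + cutCost λ′                             ≤⟨ +-monoʳ-≤ _ h ⟩
        cutCost κ + (cutCost κ′ + weight c)
          ≤⟨ +-monoʳ-≤ _ (+-monoʳ-≤ _ (x≤y+x (weight c) (weight-nonNegative t))) ⟩
        cutCost κ + (cutCost κ′ + (weight t + weight c))   ≈⟨ +-assoc _ _ _ ⟨
        (cutCost κ + cutCost κ′) + (weight t + weight c)   ∎))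
  shrink (sever {t} {c} κ κ′ j≤B) x 1≤x x≤ ≤x+B
    with λ′ , h ← shrink κ x 1≤x x≤ ≤x+B =
    sever λ′ κ′ j≤B , (begin
      cutCost λ′ + (cutCost κ′ + weight c)               ≤⟨ +-monoˡ-≤ _ h ⟩
      (cutCost κ + weight t) + (cutCost κ′ + weight c)
        ≤⟨ x≤x+y _ (weight-nonNegative c) ⟩
      ((cutCost κ + weight t) + (cutCost κ′ + weight c)) + weight c
        ≈⟨ solve 4 (λ q r s u → ((q ⊕ r) ⊕ (s ⊕ u)) ⊕ u ⊜ (q ⊕ (s ⊕ u)) ⊕ (r ⊕ u)) refl _ _ _ _ ⟩
      (cutCost κ + (cutCost κ′ + weight c)) + (weight t + weight c)   ∎)

  module Labelling (ℓ : Fin N → ℕ) where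

    -- The expected number of distinct labels outside X on a path down t.
    visible : List ℕ → Tree N → Carrier
    visible X (node v) = new X (ℓ v) · p v
    visible X (t ◂ c)  =
      visible X t + (new X (ℓ (rootOf t)) · weight c + visible (ℓ (rootOf t) ∷ X) c)

    visible-cong : ∀ {X Y} t → (∀ b → new X b ≡ new Y b) → visible X t ≡ visible Y t
    visible-cong (node v) h = cong (_· p v) (h (ℓ v))
    visible-cong {X} {Y} (t ◂ c)  h = cong₂ _+_ (visible-cong t h)
      (cong₂ _+_ (cong (_· weight c) (h _)) (visible-cong c (new-cong X Y (ℓ (rootOf t)) h)))

    private
      enter-fresh : ∀ {X} t → new X (ℓ (rootOf t)) ≡ 1 →
                    visible X t ≈ weight t + visible (ℓ (rootOf t) ∷ X) t
      enter-fresh {X} (node v) fresh = begin-equality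
        new X (ℓ v) · p v                    ≡⟨ cong (_· p v) fresh ⟩
        p v + 0 · p v                        ≡⟨ cong (λ n → p v + n · p v) (new-here (ℓ v) X) ⟨
        p v + new (ℓ v ∷ X) (ℓ v) · p v      ∎
      enter-fresh {X} (t ◂ c) fresh = begin-equality
        visible X t + (new X b · weight c + visible (b ∷ X) c)
          ≈⟨ +-cong (enter-fresh t fresh)
               (+-cong (reflexive (cong (_· weight c) fresh))
                       (reflexive (≡.sym (visible-cong c (new-absorb (b ∷ X) b (new-here b X)))))) ⟩
        (weight t + visible (b ∷ X) t) + ((weight c + 0#) + visible (b ∷ b ∷ X) c)
          ≈⟨ solve 4 (λ q r s u → (q ⊕ r) ⊕ ((s ⊕ ε) ⊕ u) ⊜ (q ⊕ s) ⊕ (r ⊕ (ε ⊕ u))) refl _ _ _ _ ⟩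
        (weight t + weight c) + (visible (b ∷ X) t + (0# + visible (b ∷ b ∷ X) c))
          ≡⟨ cong (λ n → (weight t + weight c) + (visible (b ∷ X) t + (n · weight c + visible (b ∷ b ∷ X) c)))
                  (new-here b X) ⟨
        (weight t + weight c) +
          (visible (b ∷ X) t + (new (b ∷ X) b · weight c + visible (b ∷ b ∷ X) c)) ∎
        where
        b : ℕ
        b = ℓ (rootOf t)

    -- Holds whether or not the root label is fresh, so the cost of a new block is bounded without
    -- comparing its name with the names above.
    visible-enter : ∀ X t → visible X t ≤ weight t + visible (ℓ (rootOf t) ∷ X) t
    visible-enter X t with new-0⊎1 X (ℓ (rootOf t))
    ... | inj₁ old   = ≤-trans (≤-reflexive (reflexive (≡.sym (visible-cong t (new-absorb X _ old)))))
                               (x≤y+x _ (weight-nonNegative t))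
    ... | inj₂ fresh = ≤-reflexive (enter-fresh t fresh)

    visible-pass : ∀ {X} t c → new X (ℓ (rootOf t)) ≡ 0 →
                   visible X (t ◂ c) ≈ visible X t + visible X c
    visible-pass {X} t c old = +-congˡ (begin-equality
      new X (ℓ (rootOf t)) · weight c + visible (ℓ (rootOf t) ∷ X) c
        ≡⟨ cong₂ (λ n y → n · weight c + y) old (visible-cong c (new-absorb X _ old)) ⟩
      0# + visible X c  ≈⟨ +-identityˡ _ ⟩
      visible X c       ∎)

    -- Nodes with a label seen above t might as well form a connected block at the
    -- root of t.  If the root has a fresh label b, shrink gives up the at most B
    -- nodes labelled b, paying for them with the block that b no longer opens.
    connect : ∀ t X → new X (ℓ (rootOf t)) ≡ 0 → (∀ b → count ℓ b t ℕ.≤ B) →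
              ∃ λ k → Σ[ κ ∈ Cut t k ] k ℕ.≤ seenCount ℓ X t × cutCost κ ≤ visible X t
    connectOrCut : ∀ t X → (∀ b → count ℓ b t ℕ.≤ B) →
      (∃ λ k → Σ[ κ ∈ Cut t k ] k ℕ.≤ seenCount ℓ X t × cutCost κ ≤ visible X t) ⊎
      (∃ λ k → Σ[ κ ∈ Cut t k ] k ℕ.≤ B × cutCost κ + weight t ≤ visible X t)

    connect (node v) X old _ rewrite old = 1 , whole , ℕ.≤-refl , ≤-refl
    connect (t ◂ c) X old count≤B
      with k , κ , k≤ , cost≤ ← connect t X old (λ b → ℕ.≤-trans (ℕ.m≤m+n _ _) (count≤B b))
      with connectOrCut c X (λ b → ℕ.≤-trans (ℕ.m≤n+m _ _) (count≤B b))
    ... | inj₁ (j , κ′ , j≤ , cost′≤) = k ℕ.+ j , keep κ κ′ , ℕ.+-mono-≤ k≤ j≤ ,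
      ≤-trans (+-mono-≤ cost≤ cost′≤) (≤-reflexive (sym (visible-pass t c old)))
    ... | inj₂ (j , κ′ , j≤ , cost′≤) = k , sever κ κ′ j≤ , ℕ.≤-trans k≤ (ℕ.m≤m+n _ _) ,
      ≤-trans (+-mono-≤ cost≤ cost′≤) (≤-reflexive (sym (visible-pass t c old)))

    connectOrCut t X count≤B with new-0⊎1 X (ℓ (rootOf t))
    ... | inj₁ old   = inj₁ (connect t X old count≤B)
    ... | inj₂ fresh
      with k , κ , k≤ , cost≤ ← connect t (ℓ (rootOf t) ∷ X) (new-here _ X) count≤B
      = go (seenCount ℓ X t) (ℕ.≤-trans k≤
          (ℕ.≤-trans (seenCount-∷ ℓ (ℓ (rootOf t)) X t) (ℕ.+-monoʳ-≤ _ (count≤B (ℓ (rootOf t))))))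
      where
      charged : cutCost κ + weight t ≤ visible X t
      charged = begin
        cutCost κ + weight t                        ≤⟨ +-monoˡ-≤ _ cost≤ ⟩
        visible (ℓ (rootOf t) ∷ X) t + weight t     ≈⟨ +-comm _ _ ⟩
        weight t + visible (ℓ (rootOf t) ∷ X) t     ≈⟨ enter-fresh t fresh ⟨
        visible X t                                 ∎
      go : ∀ x → k ℕ.≤ x ℕ.+ B →
           (∃ λ k → Σ[ κ ∈ Cut t k ] k ℕ.≤ x × cutCost κ ≤ visible X t) ⊎
           (∃ λ k → Σ[ κ ∈ Cut t k ] k ℕ.≤ B × cutCost κ + weight t ≤ visible X t)
      -- No room for a block with a seen label: the block labelled `b` stays and is charged.
      go zero    k≤B = inj₂ (k , κ , k≤B , charged)
      go (suc x) k≤x+B with k ℕ.≤? suc x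
      ... | yes k≤x = inj₁ (k , κ , k≤x , ≤-trans (x≤x+y _ (weight-nonNegative t)) charged)
      ... | no  k≰x with κ′ , h ← shrink κ (suc x) (s≤s z≤n) (ℕ.<⇒≤ (ℕ.≰⇒> k≰x)) k≤x+B =
        inj₁ (suc x , κ′ , ℕ.≤-refl , ≤-trans h charged)

    -- With nothing above, no label has been seen, whereas a block at the root has at least one
    -- node. This rules out the first outcome of `connectOrCut`.
    cut-below : ∀ t → (∀ b → count ℓ b t ℕ.≤ B) →
                ∃ λ k → Σ[ κ ∈ Cut t k ] k ℕ.≤ B × cutCost κ + weight t ≤ visible [] t
    cut-below t count≤B with connectOrCut t [] count≤B
    ... | inj₂ x = x
    ... | inj₁ (k , κ , k≤ , _) = contradiction (ℕ.≤-trans (cut≥1 κ) k≤) (ℕ.<⇒≱ (s≤s (ℕ.≤-reflexive (unseen t))))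
      where
      unseen : ∀ t → seenCount ℓ [] t ≡ 0
      unseen (node v) = ≡.refl
      unseen (t ◂ c)  = cong₂ ℕ._+_ (unseen t) (unseen c)

    -- The same cost with the labels X already met above t charged as well.
    pathCost : List ℕ → Tree N → Carrier
    pathCost X (node v) = p v * (distinct (ℓ v ∷ X) · 1#)
    pathCost X (t ◂ c)  = pathCost X t + pathCost (ℓ (rootOf t) ∷ X) c

    -- The labels `X` are common to all paths and contribute the constant `distinct X`; each further
    -- node contributes `new`.
    pathCost-visible : ∀ X t → pathCost X t ≈ distinct X · weight t + visible X t
    pathCost-visible X (node v) = begin-equality
      p v * (distinct (ℓ v ∷ X) · 1#)                  ≈⟨ scale (distinct (ℓ v ∷ X)) ⟩
      distinct (ℓ v ∷ X) · p v                         ≡⟨ cong (_· p v) (distinct-∷ (ℓ v) X) ⟩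
      (new X (ℓ v) ℕ.+ distinct X) · p v               ≈⟨ ×-homo-+ (p v) (new X (ℓ v)) (distinct X) ⟩
      new X (ℓ v) · p v + distinct X · p v             ≈⟨ +-comm _ _ ⟩
      distinct X · p v + new X (ℓ v) · p v             ∎
      where
      scale : ∀ n → p v * (n · 1#) ≈ n · p v
      scale zero    = zeroʳ (p v)
      scale (suc n) = trans (distribˡ _ _ _) (+-cong (*-identityʳ _) (scale n))
    pathCost-visible X (t ◂ c) = begin-equality
      pathCost X t + pathCost (b ∷ X) c
        ≈⟨ +-cong (pathCost-visible X t) (pathCost-visible (b ∷ X) c) ⟩
      (d · weight t + visible X t) + (distinct (b ∷ X) · weight c + visible (b ∷ X) c)
        ≈⟨ +-congˡ (+-congʳ (trans (reflexive (cong (_· weight c) (distinct-∷ b X)))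
                                   (×-homo-+ (weight c) (new X b) d))) ⟩
      (d · weight t + visible X t) + ((new X b · weight c + d · weight c) + visible (b ∷ X) c)
        ≈⟨ solve 5 (λ q r s u v → (q ⊕ r) ⊕ ((s ⊕ u) ⊕ v) ⊜ (q ⊕ u) ⊕ (r ⊕ (s ⊕ v))) refl _ _ _ _ _ ⟩
      (d · weight t + d · weight c) + (visible X t + (new X b · weight c + visible (b ∷ X) c))
        ≈⟨ +-congʳ (×-distrib-+ (weight t) (weight c) d) ⟨
      d · (weight t + weight c) + (visible X t + (new X b · weight c + visible (b ∷ X) c)) ∎
      where
      b d : ℕ
      b = ℓ (rootOf t)
      d = distinct X

    pathCost-[] : ∀ t → pathCost [] t ≈ visible [] t
    pathCost-[] t = trans (pathCost-visible [] t) (+-identityˡ _)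

  -- A cut as the tables record it: Choice c k j says that with room for k nodes
  -- in the block of its parent, j of them go to c (a new block if j = 0), and
  -- Best c j that a new block at c has room for j nodes.
  module Recorded (Choice : Fin N → ℕ → ℕ → Set) (Best : Fin N → ℕ → Set) where

    data Plan : Tree N → ℕ → Set where
      -- A single node fits any positive room, in accordance with the initial tables, which are
      -- constantly 0.
      whole : ∀ {v k} → 1 ℕ.≤ k → Plan (node v) k
      keep  : ∀ {t c i j} → Choice (rootOf c) (i ℕ.+ j) j → 1 ℕ.≤ j → Plan t i → Plan c j →
              Plan (t ◂ c) (i ℕ.+ j)
      sever : ∀ {t c k j} → Choice (rootOf c) k 0 → Best (rootOf c) j → j ℕ.≤ B →
              Plan t k → Plan c j → Plan (t ◂ c) k

    planCost : ∀ {t k} → Plan t k → Carrier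
    planCost (whole _)                 = 0#
    planCost (keep _ _ π π′)           = planCost π + planCost π′
    planCost (sever {c = c} _ _ _ π π′) = planCost π + (planCost π′ + weight c)

    module _ (ℓ : Fin N → ℕ) where
      open Labelling ℓ

      -- The block of a severed child bears the number of its topmost node, a name available without
      -- a counter.
      Labels : ∀ {t k} → Plan t k → ℕ → Set
      Labels (whole {v} _)                b = ℓ v ≡ b
      Labels (keep _ _ π π′)              b = Labels π b × Labels π′ b
      Labels (sever {c = c} _ _ _ π π′)   b = Labels π b × Labels π′ (toℕ (rootOf c))

      labels-root : ∀ {t k b} (π : Plan t k) → Labels π b → ℓ (rootOf t) ≡ b
      labels-root (whole _)         l       = l
      labels-root (keep _ _ π _)    (l , _) = labels-root π l
      labels-root (sever _ _ _ π _) (l , _) = labels-root π l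

      -- Nodes of the root block cost nothing once its label is in `X`. A severed child costs at
      -- most its weight beyond its own plan, by `visible-enter`, whatever its name.
      visible≤planCost : ∀ {t k b X} (π : Plan t k) → Labels π b → new X b ≡ 0 → visible X t ≤ planCost π
      visible≤planCost (whole _) ≡.refl old rewrite old = ≤-refl
      visible≤planCost {t ◂ c} {X = X} (keep _ _ π π′) (l , l′) old = begin
        visible X (t ◂ c)           ≈⟨ visible-pass t c (≡.trans (cong (new X) (labels-root π l)) old) ⟩
        visible X t + visible X c   ≤⟨ +-mono-≤ (visible≤planCost π l old) (visible≤planCost π′ l′ old) ⟩
        planCost π + planCost π′    ∎
      visible≤planCost {t ◂ c} {X = X} (sever _ _ _ π π′) (l , l′) old = begin
        visible X (t ◂ c)           ≈⟨ visible-pass t c (≡.trans (cong (new X) (labels-root π l)) old) ⟩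
        visible X t + visible X c   ≤⟨ +-mono-≤ (visible≤planCost π l old) (visible-enter X c) ⟩
        planCost π + (weight c + visible (ℓ (rootOf c) ∷ X) c)
          ≤⟨ +-monoʳ-≤ _ (+-monoʳ-≤ _ (visible≤planCost π′ l′
               (≡.trans (cong (new (ℓ (rootOf c) ∷ X)) (≡.sym (labels-root π′ l′))) (new-here _ X)))) ⟩
        planCost π + (weight c + planCost π′)   ≈⟨ +-congˡ (+-comm _ _) ⟩
        planCost π + (planCost π′ + weight c)   ∎

      -- Charging B to every node that could have named a block avoids
      -- having to show that the names of the blocks differ.
      count-labels : ∀ {t k b} (π : Plan t k) → Labels π b → ∀ b′ →
        count ℓ b′ t ℕ.+ B ℕ.* δ (toℕ (rootOf t)) b′ ℕ.≤ δ b b′ ℕ.* k ℕ.+ B ℕ.* occurrences b′ t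
      count-labels (whole {v} 1≤k) ≡.refl b′ = ℕ.+-monoˡ-≤ _
        (ℕ.≤-trans (ℕ.≤-reflexive (≡.sym (ℕ.*-identityʳ (δ (ℓ v) b′)))) (ℕ.*-monoʳ-≤ (δ (ℓ v) b′) 1≤k))
      count-labels {t ◂ c} {b = b} (keep {i = i} {j} _ _ π π′) (l , l′) b′ =
        charge-keep (count ℓ b′ t) (count ℓ b′ c) (B ℕ.* δ (toℕ (rootOf t)) b′) (δ b b′) i j B _ _ (count-labels π l b′)
          (ℕ.≤-trans (ℕ.m≤m+n _ _) (count-labels π′ l′ b′))
      count-labels {t ◂ c} {k} {b} (sever _ _ j≤B π π′) (l , l′) b′ =
        charge-sever (count ℓ b′ t) (count ℓ b′ c) (B ℕ.* δ (toℕ (rootOf t)) b′) (δ b b′) (δ (toℕ (rootOf c)) b′) k B _ _ j≤B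
          (count-labels π l b′) (count-labels π′ l′ b′)

-- Merging a table into another in place

module Merging {a ℓ₁ ℓ₂} (K : OrderedField a ℓ₁ ℓ₂) (N B : ℕ)
               (α β : ℕ → OrderedField.Carrier K) (m n : ℕ) (g : OrderedField.Carrier K) where
  open OrderedField K

  -- Choices are stored multiplied by N, the distance between consecutive rows of
  -- the memory, because the machine cannot multiply.
  Recorded : (ℕ → Carrier) → (ℕ → ℕ) → ℕ → Set a
  Recorded α′ γ k =
    (γ k ≡ 0 × α′ k ≡ α k + g) ⊎
    ∃₂ λ i j → 1 ℕ.≤ i × 1 ℕ.≤ j × i ℕ.+ j ≡ k × γ k ≡ j ℕ.* N × α′ k ≡ α i + β j

  -- Invariant of an update in place that takes the rows `i` in decreasing order. Row `i` writes
  -- only at index `i` and above, so an entry still has its value from `α` when its own row begins.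
  -- `Done` tells which pairs have been compared. As the last row is 1, entry 0, which holds the
  -- weight, stays pristine.
  record Partial (lo : ℕ) (Done : ℕ → ℕ → Set) (α′ : ℕ → Carrier) (γ : ℕ → ℕ) : Set (a Level.⊔ ℓ₂) where
    field
      pristine : ∀ k → k ℕ.< lo → α′ k ≡ α k
      recorded : ∀ k → lo ℕ.≤ k → k ℕ.≤ B → Recorded α′ γ k
      sever≤   : ∀ k → lo ℕ.≤ k → k ℕ.≤ B → α′ k ≤ α k + g
      keep≤    : ∀ i j → i ℕ.≤ m → 1 ℕ.≤ j → j ℕ.≤ n → i ℕ.+ j ℕ.≤ B → Done i j →
                 α′ (i ℕ.+ j) ≤ α i + β j
  open Partial public

  Rows≥ : ℕ → ℕ → ℕ → Set
  Rows≥ lo i j = lo ℕ.≤ i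

  RowUpTo : ℕ → ℕ → ℕ → ℕ → Set
  RowUpTo i j i′ j′ = i ℕ.< i′ ⊎ (i′ ≡ i × j′ ℕ.< j)

  private variable
    α′ α″ : ℕ → Carrier
    γ γ′ : ℕ → ℕ
    lo i j : ℕ
    D D′ : ℕ → ℕ → Set

  redone : (∀ i j → i ℕ.≤ m → 1 ℕ.≤ j → j ℕ.≤ n → i ℕ.+ j ℕ.≤ B → D′ i j → D i j) →
           Partial lo D α′ γ → Partial lo D′ α′ γ
  redone f P .pristine = pristine P
  redone f P .recorded = recorded P
  redone f P .sever≤   = sever≤ P
  redone f P .keep≤ i j i≤m 1≤j j≤n ≤B d = keep≤ P i j i≤m 1≤j j≤n ≤B (f i j i≤m 1≤j j≤n ≤B d)

  partial-start : (∀ k → α′ k ≡ α k) → Partial (suc B) (Rows≥ (suc B)) α′ γ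
  partial-start h .pristine k _       = h k
  partial-start h .recorded k lo≤k k≤B = contradiction k≤B (ℕ.<⇒≱ lo≤k)
  partial-start h .sever≤   k lo≤k k≤B = contradiction k≤B (ℕ.<⇒≱ lo≤k)
  partial-start h .keep≤ i j _ _ _ ≤B lo≤i =
    contradiction (ℕ.≤-trans (ℕ.m≤m+n i j) ≤B) (ℕ.<⇒≱ lo≤i)

  -- A row opens with the choice to sever. Entry `i` is not a sum `i′ + j` with `i < i′`, so
  -- overwriting it leaves the finished comparisons alone.
  partial-lower : Partial (suc i) D α′ γ → (∀ i′ j → D i′ j → i ℕ.< i′) →
                  α″ i ≡ α i + g → (∀ k → k ≢ i → α″ k ≡ α′ k) →
                  γ′ i ≡ 0 → (∀ k → k ≢ i → γ′ k ≡ γ k) →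
                  Partial i D α″ γ′
  partial-lower P _ hi hα ci hγ .pristine k k<i =
    ≡.trans (hα k (ℕ.<⇒≢ k<i)) (pristine P k (ℕ.m≤n⇒m≤1+n k<i))
  partial-lower {i = i} P _ hi hα ci hγ .recorded k i≤k k≤B with k ℕ.≟ i
  ... | yes ≡.refl = inj₁ (ci , hi)
  ... | no  k≢i with recorded P k (ℕ.≤∧≢⇒< i≤k (k≢i ∘ ≡.sym)) k≤B
  ...   | inj₁ (c , v)                     = inj₁ (≡.trans (hγ k k≢i) c , ≡.trans (hα k k≢i) v)
  ...   | inj₂ (i , j , p , q , r , c , v) =
    inj₂ (i , j , p , q , r , ≡.trans (hγ k k≢i) c , ≡.trans (hα k k≢i) v)
  partial-lower {i = i} P _ hi hα ci hγ .sever≤ k i≤k k≤B with k ℕ.≟ i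
  ... | yes ≡.refl = ≤-reflexive (reflexive hi)
  ... | no  k≢i = ≡.subst (_≤ _) (≡.sym (hα k k≢i)) (sever≤ P k (ℕ.≤∧≢⇒< i≤k (k≢i ∘ ≡.sym)) k≤B)
  partial-lower P above hi hα ci hγ .keep≤ i′ j i′≤m 1≤j j≤n ≤B d =
    ≡.subst (_≤ _) (≡.sym (hα _ λ eq → ℕ.<⇒≢ (ℕ.<-≤-trans (above i′ j d) (ℕ.m≤m+n i′ j)) (≡.sym eq)))
      (keep≤ P i′ j i′≤m 1≤j j≤n ≤B d)

  -- Entries only decrease, so the upper bounds obtained before survive; value and choice are
  -- replaced together, so the record stays exact.
  partial-relax : Partial i (RowUpTo i j) α′ γ → 1 ℕ.≤ i → 1 ℕ.≤ j →
                  α i + β j ≤ α′ (i ℕ.+ j) →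
                  α″ (i ℕ.+ j) ≡ α i + β j → (∀ k → k ≢ i ℕ.+ j → α″ k ≡ α′ k) →
                  γ′ (i ℕ.+ j) ≡ j ℕ.* N → (∀ k → k ≢ i ℕ.+ j → γ′ k ≡ γ k) →
                  Partial i (RowUpTo i (suc j)) α″ γ′
  partial-relax {i} {j} {α′} {γ} {α″} {γ′} P 1≤i 1≤j better hk hα ck hγ = λ where
      .pristine k k<i → ≡.trans (hα k (ℕ.<⇒≢ (ℕ.<-≤-trans k<i (ℕ.m≤m+n i j)))) (pristine P k k<i)
      .recorded k i≤k k≤B → record′ k i≤k k≤B
      .sever≤ k i≤k k≤B → ≤-trans (lower k) (sever≤ P k i≤k k≤B)
      .keep≤ i′ j′ i′≤m 1≤j′ j′≤n ≤B d → keep′ i′ j′ i′≤m 1≤j′ j′≤n ≤B d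
    where
    lower : ∀ k → α″ k ≤ α′ k
    lower k with k ℕ.≟ i ℕ.+ j
    ... | yes ≡.refl = ≡.subst (_≤ α′ k) (≡.sym hk) better
    ... | no  k≢     = ≤-reflexive (reflexive (hα k k≢))
    record′ : ∀ k → i ℕ.≤ k → k ℕ.≤ B → Recorded α″ γ′ k
    record′ k i≤k k≤B with k ℕ.≟ i ℕ.+ j
    ... | yes ≡.refl = inj₂ (i , j , 1≤i , 1≤j , ≡.refl , ck , hk)
    ... | no  k≢ with recorded P k i≤k k≤B
    ...   | inj₁ (c , v)                     = inj₁ (≡.trans (hγ k k≢) c , ≡.trans (hα k k≢) v)
    ...   | inj₂ (i , j , p , q , r , c , v) =
      inj₂ (i , j , p , q , r , ≡.trans (hγ k k≢) c , ≡.trans (hα k k≢) v)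
    keep′ : ∀ i′ j′ → i′ ℕ.≤ m → 1 ℕ.≤ j′ → j′ ℕ.≤ n → i′ ℕ.+ j′ ℕ.≤ B → RowUpTo i (suc j) i′ j′ →
            α″ (i′ ℕ.+ j′) ≤ α i′ + β j′
    keep′ i′ j′ i′≤m 1≤j′ j′≤n ≤B (inj₁ i<i′) = ≤-trans (lower _) (keep≤ P i′ j′ i′≤m 1≤j′ j′≤n ≤B (inj₁ i<i′))
    keep′ i′ j′ i′≤m 1≤j′ j′≤n ≤B (inj₂ (≡.refl , s≤s j′≤j)) with ℕ.m≤n⇒m<n∨m≡n j′≤j
    ... | inj₁ j′<j   = ≤-trans (lower _) (keep≤ P i′ j′ i′≤m 1≤j′ j′≤n ≤B (inj₂ (≡.refl , j′<j)))
    ... | inj₂ ≡.refl = ≤-reflexive (reflexive hk)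

  partial-hold : Partial i (RowUpTo i j) α′ γ → α′ (i ℕ.+ j) ≤ α i + β j →
                 Partial i (RowUpTo i (suc j)) α′ γ
  partial-hold P h .pristine = pristine P
  partial-hold P h .recorded = recorded P
  partial-hold P h .sever≤   = sever≤ P
  partial-hold P h .keep≤ i′ j′ i′≤m 1≤j′ j′≤n ≤B (inj₁ i<i′) = keep≤ P i′ j′ i′≤m 1≤j′ j′≤n ≤B (inj₁ i<i′)
  partial-hold P h .keep≤ i′ j′ i′≤m 1≤j′ j′≤n ≤B (inj₂ (≡.refl , s≤s j′≤j)) with ℕ.m≤n⇒m<n∨m≡n j′≤j
  ... | inj₁ j′<j   = keep≤ P i′ j′ i′≤m 1≤j′ j′≤n ≤B (inj₂ (≡.refl , j′<j))
  ... | inj₂ ≡.refl = h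

  Merged : (ℕ → Carrier) → (ℕ → ℕ) → Set _
  Merged = Partial 1 (Rows≥ 1)

-- Tables as lower bounds for cuts and upper bounds for recorded plans

module Tables {a ℓ₁ ℓ₂} (K : OrderedField a ℓ₁ ℓ₂) {N : ℕ} (B : ℕ)
              (p : Fin N → OrderedField.Carrier K)
              (0≤p : ∀ v → OrderedField._≤_ K (OrderedField.0# K) (p v)) where
  open OrderedField K
  open OrderedFieldProperties K
  open Partitions K B p 0≤p
  open PosetReasoning poset

  Complete : Tree N → (ℕ → Carrier) → Set _
  Complete t α = ∀ {k} (κ : Cut t k) → k ℕ.≤ B → α k ≤ cutCost κ

  -- With `Complete` this places the entry below all cuts and above a plan that memory records.
  Sound : (Fin N → ℕ → ℕ → Set) → (Fin N → ℕ → Set) → Tree N → (ℕ → Carrier) → Set _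
  Sound Choice Best t α = ∀ k → 1 ℕ.≤ k → k ℕ.≤ B → Σ[ π ∈ Plan t k ] planCost π ≤ α k
    where open Recorded Choice Best

  -- Index 0 is exempt, since row 0 of a column holds a weight and no cut has an empty root block.
  complete-cong : ∀ {t α α′} → (∀ k → 1 ℕ.≤ k → α′ k ≡ α k) → Complete t α → Complete t α′
  complete-cong h C κ k≤B = ≡.subst (_≤ cutCost κ) (≡.sym (h _ (cut≥1 κ))) (C κ k≤B)

  sound-cong : ∀ {Choice Best t α α′} → (∀ k → 1 ℕ.≤ k → α′ k ≡ α k) →
               Sound Choice Best t α → Sound Choice Best t α′
  sound-cong h S k 1≤k k≤B with π , e ← S k 1≤k k≤B = π , ≡.subst (_ ≤_) (≡.sym (h k 1≤k)) e

  -- `Choice` and `Best` speak of a memory that later steps modify, so plans must be carried from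
  -- one state to the next.
  plan-map : ∀ {Choice Choice′ : Fin N → ℕ → ℕ → Set} {Best Best′ : Fin N → ℕ → Set} →
             (∀ c k j → Choice c k j → Choice′ c k j) → (∀ c j → Best c j → Best′ c j) →
             ∀ {t k} (π : Recorded.Plan Choice Best t k) →
             Σ[ π′ ∈ Recorded.Plan Choice′ Best′ t k ] Recorded.planCost Choice′ Best′ π′ ≡ Recorded.planCost Choice Best π
  plan-map f h (Recorded.whole 1≤k) = Recorded.whole 1≤k , ≡.refl
  plan-map f h (Recorded.keep c 1≤j π ρ) with π′ , e ← plan-map f h π | ρ′ , e′ ← plan-map f h ρ =
    Recorded.keep (f _ _ _ c) 1≤j π′ ρ′ , cong₂ _+_ e e′
  plan-map f h (Recorded.sever {c = t} c b j≤B π ρ) with π′ , e ← plan-map f h π | ρ′ , e′ ← plan-map f h ρ =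
    Recorded.sever (f _ _ _ c) (h _ _ b) j≤B π′ ρ′ , cong₂ (λ x y → x + (y + weight t)) e e′

  sound-map : ∀ {Choice Choice′ : Fin N → ℕ → ℕ → Set} {Best Best′ : Fin N → ℕ → Set} →
              (∀ c k j → Choice c k j → Choice′ c k j) → (∀ c j → Best c j → Best′ c j) →
              ∀ {t α} → Sound Choice Best t α → Sound Choice′ Best′ t α
  sound-map f h S k 1≤k k≤B with π , e ← S k 1≤k k≤B with π′ , e′ ← plan-map f h π =
    π′ , ≡.subst (_≤ _) (≡.sym e′) e

  module _ {t c : Tree N} {α β α′ : ℕ → Carrier} {γ : ℕ → ℕ} {kb : ℕ} {g : Carrier}
           (1≤kb : 1 ℕ.≤ kb) (kb≤B : kb ℕ.≤ B) (g≡ : g ≡ β kb + weight c) where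
    open Merging K N B α β (treeSize t) (treeSize c) g

    -- Limiting the comparisons to the sizes of the two trees loses no cut, because `cut≤size`
    -- bounds both shares. A severed child is compared with the least entry `β kb`.
    complete-merge : Complete t α → Complete c β → (∀ j → 1 ℕ.≤ j → j ℕ.≤ B → β kb ≤ β j) →
                     Merged α′ γ → Complete (t ◂ c) α′
    complete-merge C C′ best M (keep {i = i} {j} κ κ′) k≤B = ≤-trans
      (keep≤ M i j (cut≤size κ) (cut≥1 κ′) (cut≤size κ′) k≤B (cut≥1 κ))
      (+-mono-≤ (C κ (ℕ.≤-trans (ℕ.m≤m+n i j) k≤B)) (C′ κ′ (ℕ.≤-trans (ℕ.m≤n+m j i) k≤B)))
    complete-merge C C′ best M (sever {j = j} κ κ′ j≤B) k≤B = ≤-trans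
      (≡.subst (λ x → _ ≤ α _ + x) g≡ (sever≤ M _ (cut≥1 κ) k≤B))
      (+-mono-≤ (C κ k≤B) (+-monoˡ-≤ _ (≤-trans (best j (cut≥1 κ′) j≤B) (C′ κ′ j≤B))))

    sound-merge : ∀ {Choice : Fin N → ℕ → ℕ → Set} {Best : Fin N → ℕ → Set} →
                  Sound Choice Best t α → Sound Choice Best c β → Best (rootOf c) kb →
                  (∀ k j → 1 ℕ.≤ k → k ℕ.≤ B → γ k ≡ j ℕ.* N → Choice (rootOf c) k j) →
                  Merged α′ γ → Sound Choice Best (t ◂ c) α′
    sound-merge S S′ b h M k 1≤k k≤B with recorded M k 1≤k k≤B
    ... | inj₁ (ch , v) with π , e ← S k 1≤k k≤B | π′ , e′ ← S′ kb 1≤kb kb≤B =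
      Recorded.sever (h k 0 1≤k k≤B ch) b kb≤B π π′ ,
      ≡.subst (_ ≤_) (≡.sym (≡.trans v (cong (α k +_) g≡))) (+-mono-≤ e (+-monoˡ-≤ _ e′))
    ... | inj₂ (i , j , 1≤i , 1≤j , ≡.refl , ch , v)
      with π , e ← S i 1≤i (ℕ.≤-trans (ℕ.m≤m+n i j) k≤B) | π′ , e′ ← S′ j 1≤j (ℕ.≤-trans (ℕ.m≤n+m j i) k≤B) =
      Recorded.keep (h k j 1≤k k≤B ch) 1≤j π π′ , ≡.subst (_ ≤_) (≡.sym v) (+-mono-≤ e e′)

  complete-node : ∀ {v α} → (∀ k → 1 ℕ.≤ k → α k ≡ 0#) → Complete (node v) α
  complete-node h whole _ = ≤-reflexive (reflexive (h 1 ℕ.≤-refl))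

  sound-node : ∀ {Choice : Fin N → ℕ → ℕ → Set} {Best : Fin N → ℕ → Set} {v α} →
               (∀ k → 1 ℕ.≤ k → α k ≡ 0#) → Sound Choice Best (node v) α
  sound-node h k 1≤k _ = Recorded.whole 1≤k , ≤-reflexive (reflexive (≡.sym (h k 1≤k)))

-- Sums over lists of nodes

module ListSum {a ℓ} (M : CommutativeMonoid a ℓ) where
  open CommutativeMonoid M
  open RawMonoidDefinitions rawMonoid using (sum)
  open import Relation.Binary.Reasoning.Setoid setoid
  open import Algebra.Properties.CommutativeSemigroup commutativeSemigroup using (x∙yz≈y∙xz)

  total : ∀ {b} {A : Set b} → (A → Carrier) → List A → Carrier
  total f xs = foldr _∙_ ε (map f xs)

  module _ {b} {A : Set b} where

    total-↭ : ∀ (f : A → Carrier) {xs ys} → xs ↭ ys → total f xs ≈ total f ys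
    total-↭ f p = Permutation.foldr-commMonoid setoid isCommutativeMonoid (↭⇒↭ₛ′ isEquivalence (map⁺ f p))

    total-congᴬ : ∀ {f h : A → Carrier} {xs} → All (λ x → f x ≈ h x) xs → total f xs ≈ total h xs
    total-congᴬ []       = refl
    total-congᴬ (e ∷ es) = ∙-cong e (total-congᴬ es)

    total-update : ∀ {f h : A → Carrier} {x xs} y → Unique xs → x ∈ xs → h x ≈ f x ∙ y →
                   (∀ z → z ≢ x → h z ≈ f z) → total h xs ≈ y ∙ total f xs
    total-update {f} {h} {x} {z ∷ xs} y (x∉ ∷ u) (here ≡.refl) hx hz = begin
      h x ∙ total h xs        ≈⟨ ∙-cong (trans hx (comm _ _)) (total-congᴬ (All.map (λ x≢ → hz _ (x≢ ∘ ≡.sym)) x∉)) ⟩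
      (y ∙ f x) ∙ total f xs  ≈⟨ assoc _ _ _ ⟩
      y ∙ (f x ∙ total f xs)  ∎
    total-update {f} {h} {x} {z ∷ xs} y (z∉ ∷ u) (there x∈) hx hz = begin
      h z ∙ total h xs        ≈⟨ ∙-cong (hz z (All.lookup z∉ x∈)) (total-update y u x∈ hx hz) ⟩
      f z ∙ (y ∙ total f xs)  ≈⟨ x∙yz≈y∙xz _ _ _ ⟩
      y ∙ (f z ∙ total f xs)  ∎

  total-tabulate : ∀ {b} {A : Set b} {n} (f : A → Carrier) (h : Fin n → A) → total f (tabulate h) ≡ sum (f ∘ h)
  total-tabulate {n = zero}  f h = ≡.refl
  total-tabulate {n = suc n} f h = cong (f (h Fin.zero) ∙_) (total-tabulate f (h ∘ Fin.suc))

  sum-cong : ∀ {n} {f h : Fin n → Carrier} → (∀ v → f v ≈ h v) → sum f ≈ sum h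
  sum-cong {zero}  e = refl
  sum-cong {suc n} e = ∙-cong (e Fin.zero) (sum-cong (e ∘ Fin.suc))

-- Orders with children before parents, and the trees they build

module Order {N : ℕ} (T : RootedTree N) where
  open RootedTree T

  -- `parent` is a function and the root has no parent, so each step is forced. The path stored for
  -- a child can thus be replaced by the one extending the path stored for its parent.
  pathNodes-unique : ∀ {v} (π ρ : Path parent root v) → pathNodes π ≡ pathNodes ρ
  pathNodes-unique here       here       = ≡.refl
  pathNodes-unique here       (step e _) with () ← ≡.trans (≡.sym root-parent) e
  pathNodes-unique (step e _) here       with () ← ≡.trans (≡.sym root-parent) e
  pathNodes-unique {v} (step e π) (step e′ ρ) with ≡.refl ← Maybe.just-injective (≡.trans (≡.sym e) e′) =
    cong (v ∷_) (pathNodes-unique π ρ)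

  ancestors : Fin N → List (Fin N)
  ancestors v = drop 1 (pathNodes (rootPath v))

  pathNodes-∷ : ∀ v → pathNodes (rootPath v) ≡ v ∷ ancestors v
  pathNodes-∷ v with rootPath v
  ... | here     = ≡.refl
  ... | step _ _ = ≡.refl

  ancestors-child : ∀ {c p} → parent c ≡ just p → ancestors c ≡ p ∷ ancestors p
  ancestors-child {c} {p} e = ≡.trans
    (cong (drop 1) (pathNodes-unique (rootPath c) (step e (rootPath p)))) (pathNodes-∷ p)

  orphan⇒root : ∀ {v} → parent v ≡ nothing → v ≡ root
  orphan⇒root {v} e with rootPath v
  ... | here      = ≡.refl
  ... | step e′ _ with () ← ≡.trans (≡.sym e) e′

  ancestors-root : ancestors root ≡ []
  ancestors-root = cong (drop 1) (pathNodes-unique (rootPath root) here)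

  depth : Fin N → ℕ
  depth v = length (ancestors v)

  depth-child : ∀ {c p} → parent c ≡ just p → depth c ≡ suc (depth p)
  depth-child e = cong length (ancestors-child e)

  -- Every suffix is closed under parents, and every nonempty one ends in the root.
  data Topo : List (Fin N) → Set where
    []     : Topo []
    single : ∀ {v} → parent v ≡ nothing → Topo (v ∷ [])
    cons   : ∀ {c p xs} → parent c ≡ just p → p ∈ xs → c ∉ xs → Topo xs → Topo (c ∷ xs)

  topo-tail : ∀ {c xs} → Topo (c ∷ xs) → Topo xs
  topo-tail (single _)     = []
  topo-tail (cons _ _ _ t) = t

  topo-unique : ∀ {xs} → Topo xs → Unique xs
  topo-unique []             = []
  topo-unique (single _)     = [] ∷ []
  topo-unique (cons _ _ c∉ t) = ¬Any⇒All¬ _ c∉ ∷ topo-unique t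

  topo-suffix : ∀ rs {xs} → Topo (rs ʳ++ xs) → Topo xs
  topo-suffix []       t = t
  topo-suffix (c ∷ rs) t = topo-tail (topo-suffix rs t)

  topo-parent : ∀ {xs v p} → Topo xs → v ∈ xs → parent v ≡ just p → p ∈ xs
  topo-parent (single e)      (here ≡.refl) e′ with () ← ≡.trans (≡.sym e) e′
  topo-parent (cons e p∈ _ _) (here ≡.refl) e′ with ≡.refl ← Maybe.just-injective (≡.trans (≡.sym e) e′) = there p∈
  topo-parent (cons _ _ _ t)  (there v∈)    e  = there (topo-parent t v∈ e)

  topo-root : ∀ {xs v} → Topo xs → v ∈ xs → root ∈ xs
  topo-root {xs} {v} t = go (rootPath v)
    where
    go : ∀ {v} → Path parent root v → v ∈ xs → root ∈ xs
    go here       v∈ = v∈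
    go (step e π) v∈ = go π (topo-parent t v∈ e)

  -- The trees hanging from the unfinished nodes once the nodes rs, most recent
  -- first, have been merged into their parents.
  stage : List (Fin N) → Fin N → Tree N
  stage []       v = node v
  stage (c ∷ rs) v =
    if does (Maybe.≡-dec Fin._≟_ (parent c) (just v)) then stage rs v ◂ stage rs c else stage rs v

  stage-parent : ∀ {c p} rs → parent c ≡ just p → stage (c ∷ rs) p ≡ stage rs p ◂ stage rs c
  stage-parent {c} {p} rs e rewrite dec-true (Maybe.≡-dec Fin._≟_ (parent c) (just p)) e = ≡.refl

  stage-other : ∀ {c v} rs → parent c ≢ just v → stage (c ∷ rs) v ≡ stage rs v
  stage-other {c} {v} rs e rewrite dec-false (Maybe.≡-dec Fin._≟_ (parent c) (just v)) e = ≡.refl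

  rootOf-stage : ∀ rs v → rootOf (stage rs v) ≡ v
  rootOf-stage []       v = ≡.refl
  rootOf-stage (c ∷ rs) v with does (Maybe.≡-dec Fin._≟_ (parent c) (just v))
  ... | true  = rootOf-stage rs v
  ... | false = rootOf-stage rs v

  module Additive {a ℓ} (M : CommutativeMonoid a ℓ) where
    open CommutativeMonoid M
    open ListSum M
    open RawMonoidDefinitions rawMonoid using (sum)
    open import Relation.Binary.Reasoning.Setoid setoid

    -- Asked only where `c` hangs from its true parent: the path cost of a tree involves the
    -- ancestors of its root.
    IsAdditive : (Tree N → Carrier) → Set ℓ
    IsAdditive F = ∀ t c → parent (rootOf c) ≡ just (rootOf t) → F (t ◂ c) ≈ F t ∙ F c

    module _ {F : Tree N → Carrier} (additive : IsAdditive F) where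

      total-step : ∀ rs {c p xs} → Unique xs → p ∈ xs → parent c ≡ just p →
                   total (F ∘ stage (c ∷ rs)) xs ≈ total (F ∘ stage rs) (c ∷ xs)
      total-step rs {c} {p} u p∈ e = total-update (F (stage rs c)) u p∈
        (trans (reflexive (cong F (stage-parent rs e)))
               (additive _ _ (≡.trans (cong parent (rootOf-stage rs c))
                                      (≡.trans e (cong just (≡.sym (rootOf-stage rs p)))))))
        (λ z z≢p → reflexive (cong F (stage-other rs λ e′ → z≢p (Maybe.just-injective (≡.trans (≡.sym e′) e)))))

      total-stage : ∀ rs {x xs} → Topo (rs ʳ++ (x ∷ xs)) →
                    total (F ∘ stage rs) (x ∷ xs) ≈ total (F ∘ node) (rs ʳ++ (x ∷ xs))
      total-stage []       _ = refl
      total-stage (c ∷ rs) t with topo-suffix rs t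
      ... | cons e p∈ _ t′ = trans (total-step rs (topo-unique t′) p∈ e) (total-stage rs t)

      -- A merge moves the value of `c` into its parent and preserves the total over the unfinished
      -- nodes, so the last tree carries the sum over all single nodes. Block sizes and expected
      -- costs are obtained in this way.
      whole-tree : ∀ rs {r} → Topo (rs ʳ++ (r ∷ [])) → (∀ v → v ∈ rs ʳ++ (r ∷ [])) →
                   F (stage rs r) ≈ sum (F ∘ node)
      whole-tree rs {r} t all = begin
        F (stage rs r)                           ≈⟨ identityʳ _ ⟨
        total (F ∘ stage rs) (r ∷ [])            ≈⟨ total-stage rs t ⟩
        total (F ∘ node) (rs ʳ++ (r ∷ []))       ≈⟨ total-↭ (F ∘ node) (∼bag⇒↭ (unique∧set⇒bag (topo-unique t) (allFin⁺ N)
                                                     (λ {v} → mk⇔ (λ _ → ∈-allFin v) (λ _ → all v)))) ⟩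
        total (F ∘ node) (allFin N)              ≡⟨ total-tabulate (F ∘ node) id ⟩
        sum (F ∘ node)                           ∎

  open Additive ℕ.+-0-commutativeMonoid using () renaming (IsAdditive to IsAdditiveℕ; whole-tree to whole-treeℕ)
  open ListSum ℕ.+-0-commutativeMonoid using () renaming (total to totalℕ; total-tabulate to totalℕ-tabulate)

  module _ (rs : List (Fin N)) {r} (topo : Topo (rs ʳ++ (r ∷ []))) (all : ∀ v → v ∈ rs ʳ++ (r ∷ [])) where

    count-whole : ∀ (ℓ : Fin N → ℕ) b → count ℓ b (stage rs r) ≡ blockSize ℓ b
    count-whole ℓ b = ≡.trans (whole-treeℕ {F = count ℓ b} (λ _ _ _ → ≡.refl) rs topo all)
      (≡.trans (≡.sym (totalℕ-tabulate (λ v → δ (ℓ v) b) id)) (go (allFin N)))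
      where
      go : ∀ vs → totalℕ (λ v → δ (ℓ v) b) vs ≡ length (filter (λ v → ℓ v ℕ.≟ b) vs)
      go []       = ≡.refl
      go (v ∷ vs) with ℓ v ℕ.≟ b
      ... | yes e rewrite dec-true (ℓ v ℕ.≟ b) e  = cong suc (go vs)
      ... | no  e rewrite dec-false (ℓ v ℕ.≟ b) e = go vs

    occurrences≤1 : ∀ b → occurrences b (stage rs r) ℕ.≤ 1
    occurrences≤1 b = ℕ.≤-trans (ℕ.≤-reflexive (count-whole toℕ b)) (go (allFin⁺ N))
      where
      none : ∀ {v vs} → toℕ v ≡ b → All (v ≢_) vs → length (filter (λ v → toℕ v ℕ.≟ b) vs) ≡ 0
      none e v∉ = cong length (List.filter-none (λ v → toℕ v ℕ.≟ b)
        (All.map (λ v≢w e′ → v≢w (Fin.toℕ-injective (≡.trans e (≡.sym e′)))) v∉))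
      go : ∀ {vs} → Unique vs → length (filter (λ v → toℕ v ℕ.≟ b) vs) ℕ.≤ 1
      go []             = z≤n
      go {v ∷ _} (v∉ ∷ u) with toℕ v ℕ.≟ b
      ... | yes e rewrite dec-true (toℕ v ℕ.≟ b) e  = s≤s (ℕ.≤-reflexive (none e v∉))
      ... | no  e rewrite dec-false (toℕ v ℕ.≟ b) e = go u

  module Optimality {a ℓ₁ ℓ₂} (K : OrderedField a ℓ₁ ℓ₂) (B : ℕ) (D : LeafDistribution K T) where
    open OrderedField K
    open OrderedFieldProperties K
    open LeafDistribution D using (prob; nonNegative)
    open Partitions K B prob nonNegative
    open Additive +-commutativeMonoid
    open ListSum +-commutativeMonoid using (sum-cong)

    module _ (rs : List (Fin N)) {r} (topo : Topo (rs ʳ++ (r ∷ []))) (all : ∀ v → v ∈ rs ʳ++ (r ∷ [])) where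

      r≡root : r ≡ root
      r≡root with topo-suffix rs topo
      ... | single e = orphan⇒root e

      -- `F` supplies the labels of the ancestors to `pathCost`. On single nodes it is the summand
      -- of the expected cost, it is additive because a child sees one more label than its parent,
      -- and at the root there are no ancestors.
      expectedBlockCost-visible : ∀ (L : Layout N B) →
        expectedBlockCost K T D L ≈ Labelling.visible (Layout.block L) [] (stage rs r)
      expectedBlockCost-visible L = begin-equality
        sum (λ v → prob v * (blockCost T L v · 1#))
          ≈⟨ sum-cong (λ v → reflexive (cong (λ vs → prob v * (distinct (map ℓ vs) · 1#)) (pathNodes-∷ v))) ⟩
        sum (F ∘ node)                                 ≈⟨ whole-tree {F = F} additive rs topo all ⟨
        F (stage rs r)
          ≡⟨ cong (λ vs → pathCost (map ℓ vs) (stage rs r))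
               (≡.trans (cong ancestors (≡.trans (rootOf-stage rs r) r≡root)) ancestors-root) ⟩
        pathCost [] (stage rs r)                       ≈⟨ pathCost-[] (stage rs r) ⟩
        visible [] (stage rs r)                        ∎
        where
        open PosetReasoning poset
        ℓ : Fin N → ℕ
        ℓ = Layout.block L
        open Labelling ℓ
        F : Tree N → Carrier
        F t = pathCost (map ℓ (ancestors (rootOf t))) t
        additive : IsAdditive F
        additive t c e = +-congˡ (reflexive (cong (λ vs → pathCost (map ℓ vs) c) (≡.sym (ancestors-child e))))

      cut-below-layout : ∀ (L : Layout N B) →
        ∃ λ k → Σ[ κ ∈ Cut (stage rs r) k ] k ℕ.≤ B × cutCost κ + weight (stage rs r) ≤ expectedBlockCost K T D L
      cut-below-layout L
        with k , κ , k≤B , h ← Labelling.cut-below (Layout.block L) (stage rs r)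
               (λ b → ℕ.≤-trans (ℕ.≤-reflexive (count-whole rs topo all (Layout.block L) b)) (Layout.blockSize≤B L b)) =
        k , κ , k≤B , ≤-trans h (≤-reflexive (sym (expectedBlockCost-visible L)))

      module _ {Choice : Fin N → ℕ → ℕ → Set} {Best : Fin N → ℕ → Set} where
        open Recorded Choice Best

        -- The root block is named after the root, so its `k ≤ B` nodes cancel against the unspent
        -- allowance of the root in `count-labels`. What remains is `B` for each node numbered `b`,
        -- of which there is at most one.
        layout : ∀ {k} (π : Plan (stage rs r) k) → k ℕ.≤ B → (ℓ : Fin N → ℕ) → Labels ℓ π (toℕ r) → Layout N B
        layout {k} π k≤B ℓ labels = record { block = ℓ ; blockSize≤B = λ b → begin
          blockSize ℓ b                      ≡⟨ count-whole rs topo all ℓ b ⟨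
          count ℓ b t                        ≤⟨ ℕ.+-cancelʳ-≤ (B ℕ.* δ (toℕ (rootOf t)) b) _ _ (bound b) ⟩
          B ℕ.* occurrences b t              ≤⟨ ℕ.*-monoʳ-≤ B (occurrences≤1 rs topo all b) ⟩
          B ℕ.* 1                            ≡⟨ ℕ.*-identityʳ B ⟩
          B                                  ∎ }
          where
          open ℕ.≤-Reasoning
          t : Tree N
          t = stage rs r
          bound : ∀ b → count ℓ b t ℕ.+ B ℕ.* δ (toℕ (rootOf t)) b ℕ.≤
                        B ℕ.* occurrences b t ℕ.+ B ℕ.* δ (toℕ (rootOf t)) b
          bound b = begin
            count ℓ b t ℕ.+ B ℕ.* δ (toℕ (rootOf t)) b     ≤⟨ count-labels ℓ π labels b ⟩
            δ (toℕ r) b ℕ.* k ℕ.+ B ℕ.* occurrences b t    ≤⟨ ℕ.+-monoˡ-≤ _ (ℕ.*-monoʳ-≤ (δ (toℕ r) b) k≤B) ⟩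
            δ (toℕ r) b ℕ.* B ℕ.+ B ℕ.* occurrences b t    ≡⟨ cong (λ v → δ (toℕ v) b ℕ.* B ℕ.+ B ℕ.* occurrences b t) (rootOf-stage rs r) ⟨
            δ (toℕ (rootOf t)) b ℕ.* B ℕ.+ B ℕ.* occurrences b t  ≡⟨ ℕ.+-comm _ (B ℕ.* occurrences b t) ⟩
            B ℕ.* occurrences b t ℕ.+ δ (toℕ (rootOf t)) b ℕ.* B  ≡⟨ cong (B ℕ.* occurrences b t ℕ.+_) (ℕ.*-comm (δ (toℕ (rootOf t)) b) B) ⟩
            B ℕ.* occurrences b t ℕ.+ B ℕ.* δ (toℕ (rootOf t)) b  ∎

        layout-cost : ∀ {k} (π : Plan (stage rs r) k) (k≤B : k ℕ.≤ B) ℓ (labels : Labels ℓ π (toℕ r)) →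
                      expectedBlockCost K T D (layout π k≤B ℓ labels) ≤ planCost π + weight (stage rs r)
        layout-cost π k≤B ℓ labels = begin
          expectedBlockCost K T D (layout π k≤B ℓ labels)   ≈⟨ expectedBlockCost-visible (layout π k≤B ℓ labels) ⟩
          visible [] t                                     ≤⟨ visible-enter [] t ⟩
          weight t + visible (ℓ (rootOf t) ∷ []) t         ≤⟨ +-monoʳ-≤ _ (visible≤planCost ℓ π labels
              (≡.trans (cong (new (ℓ (rootOf t) ∷ [])) (≡.sym (labels-root ℓ π labels))) (new-here (ℓ (rootOf t)) []))) ⟩
          weight t + planCost π                            ≈⟨ +-comm _ _ ⟩
          planCost π + weight t                            ∎
          where
          open PosetReasoning poset
          open Labelling ℓ
          t : Tree N
          t = stage rs r

-- Structured programs, their compilation, and the algorithm as such a program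

module Algorithm where
  open import Data.Nat using (_+_; _*_; _≤_; _<_)
  open import Data.Nat.Solver using (module +-*-Solver)
  open +-*-Solver using (solve; _:+_; _:*_; _:=_; con)
  open ≡

  infix  6 _≤ℕ_ _≤ᴷ_
  infixr 5 _⨾_

  data Test : Set where
    _≤ℕ_ _≤ᴷ_ : Reg → Reg → Test

  data Cmd : Set where
    block        : List Instr → Cmd
    _⨾_          : Cmd → Cmd → Cmd
    unless until : Test → Cmd → Cmd

  codeSize : Cmd → ℕ
  codeSize (block is)   = length is
  codeSize (c ⨾ d)      = codeSize c + codeSize d
  codeSize (unless τ c) = suc (codeSize c)
  codeSize (until τ c)  = suc (codeSize c + 1)

  jumpIf : Test → ℕ → Instr
  jumpIf (i ≤ℕ j) = jump≤ i j
  jumpIf (i ≤ᴷ j) = jump≤ᴷ i j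

  -- Jump targets are absolute, so the address of the code is a parameter. Comparing register 0 with
  -- itself gives the unconditional jump that closes a loop.
  compile : ℕ → Cmd → Program
  compile o (block is)   = is
  compile o (c ⨾ d)      = compile o c ++ compile (o + codeSize c) d
  compile o (unless τ c) = jumpIf τ (suc o + codeSize c) ∷ compile (suc o) c
  compile o (until τ c)  =
    jumpIf τ (suc o + codeSize c + 1) ∷ (compile (suc o) c ++ jump≤ 0 0 o ∷ [])

  length-compile : ∀ o c → length (compile o c) ≡ codeSize c
  length-compile o (block is)   = refl
  length-compile o (c ⨾ d)      =
    trans (List.length-++ (compile o c)) (cong₂ _+_ (length-compile o c) (length-compile _ d))
  length-compile o (unless τ c) = cong suc (length-compile _ c)
  length-compile o (until τ c)  = cong suc
    (trans (List.length-++ (compile (suc o) c)) (cong (_+ 1) (length-compile _ c)))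

  straight : Instr → Bool
  straight (jump≤ i j target)  = false
  straight (jump≤ᴷ i j target) = false
  straight halt                = false
  straight _                   = true

  wellFormed : Cmd → Bool
  wellFormed (block [])       = true
  wellFormed (block (i ∷ is)) = straight i ∧ wellFormed (block is)
  wellFormed (c ⨾ d)          = wellFormed c ∧ wellFormed d
  wellFormed (unless τ c)     = wellFormed c
  wellFormed (until τ c)      = wellFormed c

  ∧-split : ∀ {x y} → T (x ∧ y) → T x × T y
  ∧-split {true} {true} _ = tt , tt

  ∨-split : ∀ {x y} → T (not (x ∨ y)) → T (not x) × T (not y)
  ∨-split {false} {false} _ = tt , tt

  anyInstr : (Instr → Bool) → Cmd → Bool
  anyInstr p (block [])       = false
  anyInstr p (block (i ∷ is)) = p i ∨ anyInstr p (block is)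
  anyInstr p (c ⨾ d)          = anyInstr p c ∨ anyInstr p d
  anyInstr p (unless τ c)     = anyInstr p c
  anyInstr p (until τ c)      = anyInstr p c

  writes writesᴷ : Reg → Instr → Bool
  writes r (set d n)   = does (d ℕ.≟ r)
  writes r (add d i j) = does (d ℕ.≟ r)
  writes r (sub d i j) = does (d ℕ.≟ r)
  writes r (load d i)  = does (d ℕ.≟ r)
  writes r _           = false
  writesᴷ r (set0ᴷ d)    = does (d ℕ.≟ r)
  writesᴷ r (set1ᴷ d)    = does (d ℕ.≟ r)
  writesᴷ r (addᴷ d i j) = does (d ℕ.≟ r)
  writesᴷ r (subᴷ d i j) = does (d ℕ.≟ r)
  writesᴷ r (loadᴷ d i)  = does (d ℕ.≟ r)
  writesᴷ r _            = false

  stores storesᴷ : Instr → Bool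
  stores (store i j)   = true
  stores _             = false
  storesᴷ (storeᴷ i j) = true
  storesᴷ _            = false

  ≔-same : ∀ {a} {A : Set a} (f : ℕ → A) i x → (f [ i ≔ x ]) i ≡ x
  ≔-same f i x rewrite dec-true (i ℕ.≟ i) refl = refl

  ≔-other : ∀ {a} {A : Set a} (f : ℕ → A) {i j} x → i ≢ j → (f [ i ≔ x ]) j ≡ f j
  ≔-other f {i} {j} x i≢j rewrite dec-false (i ℕ.≟ j) i≢j = refl

  record Located (P : Program) (o : ℕ) (code : Program) : Set where
    constructor located
    field
      rest : Program
      isHere : drop o P ≡ code ++ rest

  drop-length-++ : ∀ (xs ys : Program) → drop (length xs) (xs ++ ys) ≡ ys
  drop-length-++ []       ys = refl
  drop-length-++ (x ∷ xs) ys = drop-length-++ xs ys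

  located-++ˡ : ∀ {P o} xs {ys} → Located P o (xs ++ ys) → Located P o xs
  located-++ˡ xs {ys} (located rest eq) = located (ys ++ rest) $ trans eq (List.++-assoc xs ys rest)

  located-++ʳ : ∀ {P o} xs {ys} → Located P o (xs ++ ys) → Located P (o + length xs) ys
  located-++ʳ {P} {o} xs {ys} (located rest eq) = located rest (begin
    drop (o + length xs) P                ≡⟨ List.drop-drop o (length xs) P ⟨
    drop (length xs) (drop o P)           ≡⟨ cong (drop (length xs)) eq ⟩
    drop (length xs) ((xs ++ ys) ++ rest) ≡⟨ cong (drop (length xs)) (List.++-assoc xs ys rest) ⟩
    drop (length xs) (xs ++ (ys ++ rest)) ≡⟨ drop-length-++ xs (ys ++ rest) ⟩
    ys ++ rest                            ∎)
    where open ≡-Reasoning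

  located-∷ : ∀ {P o i is} → Located P o (i ∷ is) → Located P (suc o) is
  located-∷ {P} {o} {i} {is} l =
    subst (λ n → Located P n is) (ℕ.+-comm o 1) (located-++ʳ {P} {o} (i ∷ []) l)

  module Structured {a ℓ₁ ℓ₂} (K : OrderedField a ℓ₁ ℓ₂) where
    open OrderedField K using (Carrier; 0#; 1#)
    private module K = OrderedField K
    open RAM K

    record Store : Set a where
      constructor ⟪_,_,_,_⟫
      field
        reg  : ℕ → ℕ
        mem  : ℕ → ℕ
        regᴷ : ℕ → Carrier
        memᴷ : ℕ → Carrier
    open Store public

    infix 6 _at_
    _at_ : Store → ℕ → State
    s at o = state o (reg s) (mem s) (regᴷ s) (memᴷ s)

    effect : Instr → Store → Store
    effect (set d n)    s = ⟪ reg s [ d ≔ n ] , mem s , regᴷ s , memᴷ s ⟫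
    effect (add d i j)  s = ⟪ reg s [ d ≔ reg s i + reg s j ] , mem s , regᴷ s , memᴷ s ⟫
    effect (sub d i j)  s = ⟪ reg s [ d ≔ reg s i ∸ reg s j ] , mem s , regᴷ s , memᴷ s ⟫
    effect (load d i)   s = ⟪ reg s [ d ≔ mem s (reg s i) ] , mem s , regᴷ s , memᴷ s ⟫
    effect (store i j)  s = ⟪ reg s , mem s [ reg s i ≔ reg s j ] , regᴷ s , memᴷ s ⟫
    effect (set0ᴷ d)    s = ⟪ reg s , mem s , regᴷ s [ d ≔ 0# ] , memᴷ s ⟫
    effect (set1ᴷ d)    s = ⟪ reg s , mem s , regᴷ s [ d ≔ 1# ] , memᴷ s ⟫
    effect (addᴷ d i j) s = ⟪ reg s , mem s , regᴷ s [ d ≔ regᴷ s i K.+ regᴷ s j ] , memᴷ s ⟫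
    effect (subᴷ d i j) s = ⟪ reg s , mem s , regᴷ s [ d ≔ regᴷ s i K.- regᴷ s j ] , memᴷ s ⟫
    effect (loadᴷ d i)  s = ⟪ reg s , mem s , regᴷ s [ d ≔ memᴷ s (reg s i) ] , memᴷ s ⟫
    effect (storeᴷ i j) s = ⟪ reg s , mem s , regᴷ s , memᴷ s [ reg s i ≔ regᴷ s j ] ⟫
    effect _            s = s

    effects : List Instr → Store → Store
    effects []       s = s
    effects (i ∷ is) s = effects is (effect i s)

    holds : Test → Store → Bool
    holds (i ≤ℕ j) s = does (reg s i ℕ.≤? reg s j)
    holds (i ≤ᴷ j) s = does (regᴷ s i K.≤? regᴷ s j)

    infix 4 ⟨_,_⟩⇓[_]_

    data ⟨_,_⟩⇓[_]_ : Cmd → Store → ℕ → Store → Set a where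
      block       : ∀ {is s} → ⟨ block is , s ⟩⇓[ length is ] effects is s
      _⨾_         : ∀ {c d s s′ s″ t t′} → ⟨ c , s ⟩⇓[ t ] s′ → ⟨ d , s′ ⟩⇓[ t′ ] s″ →
                    ⟨ c ⨾ d , s ⟩⇓[ t + t′ ] s″
      unless-skip : ∀ {τ c s} → holds τ s ≡ true → ⟨ unless τ c , s ⟩⇓[ 1 ] s
      unless-run  : ∀ {τ c s s′ t} → holds τ s ≡ false → ⟨ c , s ⟩⇓[ t ] s′ →
                    ⟨ unless τ c , s ⟩⇓[ suc t ] s′
      until-stop  : ∀ {τ c s} → holds τ s ≡ true → ⟨ until τ c , s ⟩⇓[ 1 ] s
      until-step  : ∀ {τ c s s′ s″ t t′} → holds τ s ≡ false → ⟨ c , s ⟩⇓[ t ] s′ →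
                    ⟨ until τ c , s′ ⟩⇓[ t′ ] s″ → ⟨ until τ c , s ⟩⇓[ suc (t + suc t′) ] s″

    private
      stepOf-located : ∀ {P o i is} s → Located P o (i ∷ is) → stepOf P (s at o) ≡ execute i (s at o)
      stepOf-located {P} {o} s (located rest eq) with drop o P | eq
      ... | _ | refl = refl

      execute-straight : ∀ i s o → T (straight i) → execute i (s at o) ≡ just (effect i s at suc o)
      execute-straight (set d n)    s o _ = refl
      execute-straight (add d i j)  s o _ = refl
      execute-straight (sub d i j)  s o _ = refl
      execute-straight (load d i)   s o _ = refl
      execute-straight (store i j)  s o _ = refl
      execute-straight (set0ᴷ d)    s o _ = refl
      execute-straight (set1ᴷ d)    s o _ = refl
      execute-straight (addᴷ d i j) s o _ = refl
      execute-straight (subᴷ d i j) s o _ = refl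
      execute-straight (loadᴷ d i)  s o _ = refl
      execute-straight (storeᴷ i j) s o _ = refl

      execute-jumpIf : ∀ τ s o l → execute (jumpIf τ l) (s at o) ≡
                                   just (s at (if holds τ s then l else suc o))
      execute-jumpIf (i ≤ℕ j) s o l = refl
      execute-jumpIf (i ≤ᴷ j) s o l = refl

      jump-taken : ∀ {P o τ l is s t f} → Located P o (jumpIf τ l ∷ is) → holds τ s ≡ true →
                   P ⊢ s at l ⇓[ t ] f → P ⊢ s at o ⇓[ suc t ] f
      jump-taken {o = o} {τ} {l} {s = s} loc h r = next
        (trans (stepOf-located s loc) (trans (execute-jumpIf τ s o l)
          (cong (λ b → just (s at (if b then l else suc o))) h))) r

      jump-not-taken : ∀ {P o τ l is s t f} → Located P o (jumpIf τ l ∷ is) → holds τ s ≡ false →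
                       P ⊢ s at suc o ⇓[ t ] f → P ⊢ s at o ⇓[ suc t ] f
      jump-not-taken {o = o} {τ} {l} {s = s} loc h r = next
        (trans (stepOf-located s loc) (trans (execute-jumpIf τ s o l)
          (cong (λ b → just (s at (if b then l else suc o))) h))) r

      always : ∀ s → holds (0 ≤ℕ 0) s ≡ true
      always s = dec-true (reg s 0 ℕ.≤? reg s 0) ℕ.≤-refl

      move : ∀ {P s t f o o′} → o ≡ o′ → P ⊢ s at o ⇓[ t ] f → P ⊢ s at o′ ⇓[ t ] f
      move refl r = r

      block-correct : ∀ {P t f} is o s → Located P o is → T (wellFormed (block is)) →
                      P ⊢ effects is s at (o + length is) ⇓[ t ] f → P ⊢ s at o ⇓[ length is + t ] f
      block-correct []       o s loc wf r rewrite ℕ.+-identityʳ o = r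
      block-correct (i ∷ is) o s loc wf r with wfᵢ , wfᵢₛ ← ∧-split {straight i} wf =
        next (trans (stepOf-located s loc) (execute-straight i s o wfᵢ))
          (block-correct is (suc o) (effect i s) (located-∷ loc) wfᵢₛ
            (move (ℕ.+-suc o (length is)) r))

      recount : ∀ {P s t t′ f} → t ≡ t′ → P ⊢ s ⇓[ t ] f → P ⊢ s ⇓[ t′ ] f
      recount refl r = r

    -- Stated for any continuation, since the machine relation describes only runs up to halting; a
    -- run is assembled from its end.
    compile-correct : ∀ {P c s s′ t t′ f} o → T (wellFormed c) → Located P o (compile o c) →
                      ⟨ c , s ⟩⇓[ t ] s′ → P ⊢ s′ at (o + codeSize c) ⇓[ t′ ] f →
                      P ⊢ s at o ⇓[ t + t′ ] f
    compile-correct {c = block is} o wf loc block r = block-correct is o _ loc wf r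
    compile-correct {P = P} {c = c ⨾ d} {t′ = t′} o wf loc (_⨾_ {t = t₁} {t₂} x y) r
      with wfᶜ , wfᵈ ← ∧-split {wellFormed c} wf =
      recount (sym (ℕ.+-assoc t₁ t₂ t′))
        (compile-correct o wfᶜ (located-++ˡ (compile o c) loc) x
          (compile-correct (o + codeSize c) wfᵈ
            (subst (λ n → Located P n (compile (o + codeSize c) d))
                   (cong (o +_) (length-compile o c)) (located-++ʳ (compile o c) loc)) y
            (move (sym (ℕ.+-assoc o (codeSize c) (codeSize d))) r)))
    compile-correct {c = unless τ c} o wf loc (unless-skip h) r =
      jump-taken {τ = τ} loc h (move (ℕ.+-suc o (codeSize c)) r)
    compile-correct {c = unless τ c} o wf loc (unless-run h x) r =
      jump-not-taken {τ = τ} loc h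
        (compile-correct (suc o) wf (located-∷ loc) x (move (ℕ.+-suc o (codeSize c)) r))
    compile-correct {c = until τ c} o wf loc (until-stop h) r =
      jump-taken {τ = τ} loc h
        (move (trans (ℕ.+-suc o _) (cong suc (sym (ℕ.+-assoc o (codeSize c) 1)))) r)
    compile-correct {P = P} {c = until τ c} {t′ = t′} o wf loc
                    (until-step {s′ = s′} {t = t₁} {t₂} h x y) r =
      jump-not-taken {τ = τ} loc h
        (recount (sym (ℕ.+-assoc t₁ (suc t₂) t′))
          (compile-correct (suc o) wf (located-++ˡ (compile (suc o) c) (located-∷ loc)) x
            (jump-taken {τ = 0 ≤ℕ 0} {s = s′}
              (subst (λ n → Located P n (jump≤ 0 0 o ∷ [])) (cong (suc o +_) (length-compile _ c))
                (located-++ʳ (compile (suc o) c) (located-∷ loc)))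
              (always s′)
              (compile-correct o wf loc y r))))

    compile-halts : ∀ {c s s′ t} → T (wellFormed c) → ⟨ c , s ⟩⇓[ t ] s′ →
                    compile 0 c ⊢ s at 0 ⇓[ t ] (s′ at codeSize c)
    compile-halts {c} {t = t} wf x = recount (ℕ.+-identityʳ t)
      (compile-correct 0 wf (located [] (sym (List.++-identityʳ (compile 0 c)))) x (halted stops))
      where
      stops : ∀ {s′} → stepOf (compile 0 c) (s′ at codeSize c) ≡ nothing
      stops rewrite sym (length-compile 0 c)
                  | List.drop-all (length (compile 0 c)) (compile 0 c) ℕ.≤-refl = refl

    -- The implicit arguments compute to the unit type on concrete programs and are then filled in
    -- automatically, so preserved registers and memories need no proof.
    record Frame (c : Cmd) (s s′ : Store) : Set a where
      field
        reg-kept  : ∀ r {_ : T (not (anyInstr (writes r) c))} → reg s′ r ≡ reg s r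
        regᴷ-kept : ∀ r {_ : T (not (anyInstr (writesᴷ r) c))} → regᴷ s′ r ≡ regᴷ s r
        mem-kept  : {_ : T (not (anyInstr stores c))} → mem s′ ≡ mem s
        memᴷ-kept : {_ : T (not (anyInstr storesᴷ c))} → memᴷ s′ ≡ memᴷ s
    open Frame public

    private
      untouched : ∀ {b} {B : Set b} d {r} (f : ℕ → B) x → T (not (does (d ℕ.≟ r))) → (f [ d ≔ x ]) r ≡ f r
      untouched d {r} f x h with does (d ℕ.≟ r)
      ... | false = refl

      Kept : ∀ {b} {B : Set b} → (Instr → Bool) → (Store → B) → Set _
      Kept p view = ∀ i s → T (not (p i)) → view (effect i s) ≡ view s

      kept : ∀ {b} {B : Set b} {p : Instr → Bool} {view : Store → B} → Kept p view →
             ∀ {c s s′ t} → T (not (anyInstr p c)) → ⟨ c , s ⟩⇓[ t ] s′ → view s′ ≡ view s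
      kept {p = p} {view} k {block is} h block = go is _ h
        where
        go : ∀ is s → T (not (anyInstr p (block is))) → view (effects is s) ≡ view s
        go []       s h = refl
        go (i ∷ is) s h with h₁ , h₂ ← ∨-split {p i} h = trans (go is (effect i s) h₂) (k i s h₁)
      kept {p = p} k {c ⨾ d} h (x ⨾ y) with h₁ , h₂ ← ∨-split {anyInstr p c} h =
        trans (kept k h₂ y) (kept k h₁ x)
      kept k h (unless-skip _)    = refl
      kept k h (unless-run _ x)   = kept k h x
      kept k h (until-stop _)     = refl
      kept k h (until-step _ x y) = trans (kept k h y) (kept k h x)

      effect-kept : ∀ i r s →
        (T (not (writes r i)) → reg (effect i s) r ≡ reg s r) ×
        (T (not (writesᴷ r i)) → regᴷ (effect i s) r ≡ regᴷ s r) ×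
        (T (not (stores i)) → mem (effect i s) ≡ mem s) ×
        (T (not (storesᴷ i)) → memᴷ (effect i s) ≡ memᴷ s)
      effect-kept (set d n) r s = untouched d (reg s) _ , (λ _ → refl) , (λ _ → refl) , (λ _ → refl)
      effect-kept (add d i j) r s = untouched d (reg s) _ , (λ _ → refl) , (λ _ → refl) , (λ _ → refl)
      effect-kept (sub d i j) r s = untouched d (reg s) _ , (λ _ → refl) , (λ _ → refl) , (λ _ → refl)
      effect-kept (load d i) r s = untouched d (reg s) _ , (λ _ → refl) , (λ _ → refl) , (λ _ → refl)
      effect-kept (store i j) r s = (λ _ → refl) , (λ _ → refl) , (λ ()) , (λ _ → refl)
      effect-kept (jump≤ i j _) r s = (λ _ → refl) , (λ _ → refl) , (λ _ → refl) , (λ _ → refl)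
      effect-kept (set0ᴷ d) r s = (λ _ → refl) , untouched d (regᴷ s) _ , (λ _ → refl) , (λ _ → refl)
      effect-kept (set1ᴷ d) r s = (λ _ → refl) , untouched d (regᴷ s) _ , (λ _ → refl) , (λ _ → refl)
      effect-kept (addᴷ d i j) r s = (λ _ → refl) , untouched d (regᴷ s) _ , (λ _ → refl) , (λ _ → refl)
      effect-kept (subᴷ d i j) r s = (λ _ → refl) , untouched d (regᴷ s) _ , (λ _ → refl) , (λ _ → refl)
      effect-kept (loadᴷ d i) r s = (λ _ → refl) , untouched d (regᴷ s) _ , (λ _ → refl) , (λ _ → refl)
      effect-kept (storeᴷ i j) r s = (λ _ → refl) , (λ _ → refl) , (λ _ → refl) , (λ ())
      effect-kept (jump≤ᴷ i j _) r s = (λ _ → refl) , (λ _ → refl) , (λ _ → refl) , (λ _ → refl)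
      effect-kept halt r s = (λ _ → refl) , (λ _ → refl) , (λ _ → refl) , (λ _ → refl)

    frame : ∀ {c s s′ t} → ⟨ c , s ⟩⇓[ t ] s′ → Frame c s s′
    frame x .reg-kept  r {h} = kept (λ i s → proj₁ (effect-kept i r s)) h x
    frame x .regᴷ-kept r {h} = kept (λ i s → proj₁ (proj₂ (effect-kept i r s))) h x
    frame x .mem-kept    {h} = kept (λ i s → proj₁ (proj₂ (proj₂ (effect-kept i 0 s)))) h x
    frame x .memᴷ-kept   {h} = kept (λ i s → proj₂ (proj₂ (proj₂ (effect-kept i 0 s)))) h x

    -- A Hoare triple for a fixed initial store, with an upper bound on the time.
    Runs : ∀ {q} → Cmd → Store → ℕ → (Store → Set q) → Set _
    Runs c s b Q = ∃₂ λ t s′ → ⟨ c , s ⟩⇓[ t ] s′ × t ≤ b × Q s′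

    module _ {q} {Q : Store → Set q} where

      run-block : ∀ {is s} → Q (effects is s) → Runs (block is) s (length is) Q
      run-block x = _ , _ , block , ℕ.≤-refl , x

      infixl 1 _then_
      _then_ : ∀ {r} {R : Store → Set r} {c d s b b′} → Runs c s b Q →
               (∀ {s′} → Frame c s s′ → Q s′ → Runs d s′ b′ R) → Runs (c ⨾ d) s (b + b′) R
      (t , s′ , x , t≤b , q) then k with t′ , s″ , y , t′≤b′ , r ← k (frame x) q =
        t + t′ , s″ , (x ⨾ y) , ℕ.+-mono-≤ t≤b t′≤b′ , r

      within : ∀ {c s b b′} → b ≤ b′ → Runs c s b Q → Runs c s b′ Q
      within b≤b′ (t , s′ , x , t≤b , q) = t , s′ , x , ℕ.≤-trans t≤b b≤b′ , q

      yielding : ∀ {r} {R : Store → Set r} {c s b} → (∀ {s′} → Frame c s s′ → Q s′ → R s′) →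
                 Runs c s b Q → Runs c s b R
      yielding f (t , s′ , x , t≤b , q) = t , s′ , x , t≤b , f (frame x) q

      skip : ∀ {τ c s b} → holds τ s ≡ true → Q s → Runs (unless τ c) s (suc b) Q
      skip h q = _ , _ , unless-skip h , s≤s z≤n , q

      enter : ∀ {τ c s b} → holds τ s ≡ false → Runs c s b Q → Runs (unless τ c) s (suc b) Q
      enter h (t , s′ , x , t≤b , q) = suc t , s′ , unless-run h x , s≤s t≤b , q

      stop : ∀ {τ c s} → holds τ s ≡ true → Q s → Runs (until τ c) s 1 Q
      stop h q = _ , _ , until-stop h , ℕ.≤-refl , q

      iterate : ∀ {r} {R : Store → Set r} {τ c s b b′} → holds τ s ≡ false → Runs c s b Q →
                (∀ {s′} → Frame c s s′ → Q s′ → Runs (until τ c) s′ b′ R) →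
                Runs (until τ c) s (suc (suc (b + b′))) R
      iterate {b = b} {b′} h (t , s′ , x , t≤b , q) k with t′ , s″ , y , t′≤b′ , r ← k (frame x) q =
        suc (t + suc t′) , s″ , until-step h x y ,
        ℕ.≤-trans (s≤s (ℕ.+-mono-≤ t≤b (s≤s t′≤b′))) (ℕ.≤-reflexive (cong suc (ℕ.+-suc b b′))) , r

    holds-≤ : ∀ {s i j} → reg s i ≤ reg s j → holds (i ≤ℕ j) s ≡ true
    holds-≤ {s} {i} {j} = dec-true (reg s i ℕ.≤? reg s j)

    holds-> : ∀ {s i j} → reg s j < reg s i → holds (i ≤ℕ j) s ≡ false
    holds-> {s} {i} {j} h = dec-false (reg s i ℕ.≤? reg s j) (ℕ.<⇒≱ h)

  -- Registers: 0 holds N, 1 holds B, 2 holds 1, 3 holds 0, 4 holds 2N, 5 holds 3N.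
  -- Both memories are read as arrays with N columns.  The rows of column v of the
  -- number memory hold: 0 the parent, finally the label; 1 the next node in a list
  -- of nodes; 2 one less than the size of the tree hanging from v so far; 3 the room
  -- in the block at v; 3 + k the choice for v if k nodes are to fit in the block of
  -- its parent.  In the field memory row 0 holds the weight of that tree and row k
  -- the least cost with k nodes in the block at v.

  setup walk insert scan order : Cmd
  setup  = block (set 2 1 ∷ add 4 0 0 ∷ add 5 4 0 ∷ set 11 1 ∷ [])
  -- The link field doubles as the mark of a visited node: climbing stores the reference to the
  -- parent there and stops at a parent whose link is nonzero. Setting register 13 to 1 stops the
  -- climb at the root.
  walk   = block (load 14 12 ∷ add 16 12 0 ∷ store 16 14 ∷ set 13 1 ∷ sub 12 14 2 ∷ []) ⨾
           unless (14 ≤ℕ 3) (block (add 15 12 0 ∷ load 13 15 ∷ []))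
  -- The last node climbed is linked to the old head, which puts the whole climb in front of the
  -- list.
  insert = until (2 ≤ℕ 13) walk ⨾ block (store 16 11 ∷ add 11 10 2 ∷ [])
  scan   = block (add 12 10 3 ∷ add 15 12 0 ∷ load 13 15 ∷ []) ⨾
           unless (2 ≤ℕ 13) insert ⨾
           block (add 10 10 2 ∷ [])
  order  = until (0 ≤ℕ 10) scan

  selectStep select : Cmd
  selectStep = block (add 23 23 2 ∷ add 24 24 0 ∷ loadᴷ 0 24 ∷ []) ⨾
               unless (1 ≤ᴷ 0) (block (loadᴷ 1 24 ∷ sub 25 24 21 ∷ []))
  select     = block (add 24 21 0 ∷ loadᴷ 1 24 ∷ add 25 0 3 ∷ set 23 1 ∷ []) ⨾
               until (1 ≤ℕ 23) selectStep ⨾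
               block (add 26 21 5 ∷ store 26 25 ∷ loadᴷ 0 21 ∷ addᴷ 2 1 0 ∷ [])

  relax scatter row merge advance : Cmd
  relax   = block (add 38 38 2 ∷ add 39 39 0 ∷ add 40 40 0 ∷ add 41 41 0 ∷
                   loadᴷ 5 39 ∷ addᴷ 5 3 5 ∷ loadᴷ 6 40 ∷ []) ⨾
            unless (6 ≤ᴷ 5) (block (storeᴷ 40 5 ∷ sub 42 39 21 ∷ store 41 42 ∷ []))
  -- `x ∸ (x ∸ y)` is the minimum of `x` and `y`, here of `B ∸ i` and the size of the child.
  scatter = block (sub 36 1 29 ∷ sub 37 36 33 ∷ sub 36 36 37 ∷
                   set 38 0 ∷ add 39 21 3 ∷ add 40 27 3 ∷ add 41 28 3 ∷ []) ⨾
            until (36 ≤ℕ 38) relax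
  row     = block (loadᴷ 3 27 ∷ addᴷ 4 3 2 ∷ storeᴷ 27 4 ∷ store 28 3 ∷ []) ⨾
            unless (34 ≤ℕ 29) scatter ⨾
            block (sub 29 29 2 ∷ sub 27 27 0 ∷ sub 28 28 0 ∷ [])
  merge   = block (sub 26 22 2 ∷ loadᴷ 0 26 ∷ loadᴷ 1 21 ∷ addᴷ 0 0 1 ∷ storeᴷ 26 0 ∷
                   add 28 24 5 ∷ sub 27 24 21 ∷ add 27 26 27 ∷ []) ⨾
            block (add 30 26 4 ∷ load 31 30 ∷ add 32 21 4 ∷ load 33 32 ∷ add 33 33 2 ∷
                   add 34 31 2 ∷ add 34 34 2 ∷ add 35 31 33 ∷ store 30 35 ∷ sub 29 1 3 ∷ []) ⨾
            until (29 ≤ℕ 3) row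
  -- Finished nodes go to the front of a second list, which therefore has parents before children.
  advance = block (add 42 21 0 ∷ load 43 42 ∷ store 42 20 ∷ add 20 21 2 ∷ sub 21 43 2 ∷ [])

  tabulation : Cmd
  tabulation = block (sub 21 11 2 ∷ []) ⨾ select ⨾ block (load 22 21 ∷ []) ⨾
               until (22 ≤ℕ 3) (merge ⨾ advance ⨾ select ⨾ block (load 22 21 ∷ []))

  assign labelling : Cmd
  -- Row 0 can hold both parents and labels: the parent of `c` has its label by now, and the parent
  -- field of `c` is read before its label is stored.
  assign    = block (sub 50 20 2 ∷ load 51 50 ∷ sub 51 51 2 ∷ add 52 51 5 ∷ load 53 52 ∷ []) ⨾
              block (add 54 50 5 ∷ add 55 54 53 ∷ load 55 55 ∷ add 56 50 0 ∷ load 20 56 ∷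
                     store 50 50 ∷ []) ⨾
              unless (55 ≤ℕ 3)
                (block (load 57 51 ∷ store 50 57 ∷ store 54 55 ∷ sub 53 53 55 ∷ store 52 53 ∷ []))
  labelling = block (store 21 21 ∷ []) ⨾ until (20 ≤ℕ 3) assign

  layoutProgram : Cmd
  layoutProgram = setup ⨾ order ⨾ tabulation ⨾ labelling

  -- Memory as an array with one column per node

  module Cells {N : ℕ} where

    -- Moving to the next row is an addition of `N`, and row 0 is where the input lies.
    cell : Fin N → ℕ → ℕ
    cell v k = toℕ v + k * N

    cell-suc : ∀ v k → cell v k + N ≡ cell v (suc k)
    cell-suc v k = trans (ℕ.+-assoc (toℕ v) (k * N) N) (cong (toℕ v +_) (ℕ.+-comm (k * N) N))

    cell-injective : ∀ {v w} k l → cell v k ≡ cell w l → v ≡ w × k ≡ l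
    cell-injective {v} {w} zero zero e =
      Fin.toℕ-injective (ℕ.+-cancelʳ-≡ 0 (toℕ v) (toℕ w) e) , refl
    cell-injective {v} {w} zero (suc l) e =
      contradiction (ℕ.≤-trans (ℕ.m≤m+n N _) (ℕ.m≤n+m (suc l * N) (toℕ w)))
        (ℕ.<⇒≱ (subst (_< N) (trans (sym (ℕ.+-identityʳ (toℕ v))) e) (Fin.toℕ<n v)))
    cell-injective {v} {w} (suc k) zero e =
      contradiction (ℕ.≤-trans (ℕ.m≤m+n N _) (ℕ.m≤n+m (suc k * N) (toℕ v)))
        (ℕ.<⇒≱ (subst (_< N) (trans (sym (ℕ.+-identityʳ (toℕ w))) (sym e)) (Fin.toℕ<n w)))
    cell-injective {v} {w} (suc k) (suc l) e
      with v≡w , k≡l ← cell-injective {v} {w} k l (ℕ.+-cancelʳ-≡ N _ _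
             (trans (cell-suc v k) (trans e (sym (cell-suc w l))))) = v≡w , cong suc k≡l

    cell-0 : ∀ v → cell v 0 ≡ toℕ v
    cell-0 v = ℕ.+-identityʳ (toℕ v)

    cell-1 : ∀ v → toℕ v + N ≡ cell v 1
    cell-1 v = cong (toℕ v +_) (sym (ℕ.*-identityˡ N))

    cell-+ : ∀ v k l → cell v k + l * N ≡ cell v (k + l)
    cell-+ v k l = trans (ℕ.+-assoc (toℕ v) (k * N) (l * N)) (cong (toℕ v +_) (sym (ℕ.*-distribʳ-+ N k l)))

    cell-pred : ∀ v k → cell v (suc k) ∸ N ≡ cell v k
    cell-pred v k = trans (cong (_∸ N) (sym (cell-suc v k))) (ℕ.m+n∸n≡m (cell v k) N)

    cell-offset : ∀ v k → cell v k ∸ toℕ v ≡ k * N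
    cell-offset v k = ℕ.m+n∸m≡n (toℕ v) (k * N)

    module _ {a} {A : Set a} (m : ℕ → A) (v : Fin N) (k : ℕ) {x : A} where

      write-same : ∀ {i} → i ≡ cell v k → (m [ i ≔ x ]) (cell v k) ≡ x
      write-same refl = ≔-same m (cell v k) x

      write-other : ∀ {i} w l → i ≡ cell v k → ¬ (w ≡ v × l ≡ k) → (m [ i ≔ x ]) (cell w l) ≡ m (cell w l)
      write-other w l refl ne = ≔-other m x λ e →
        let v≡w , k≡l = cell-injective {v} {w} k l e in ne (sym v≡w , sym k≡l)

  module Tests {a ℓ₁ ℓ₂} (K : OrderedField a ℓ₁ ℓ₂) where
    open Structured K
    private module K = OrderedField K

    data Outcome (τ : Test) (s : Store) {b c} (Yes : Set b) (No : Set c) : Set (b Level.⊔ c) where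
      pass : holds τ s ≡ true → Yes → Outcome τ s Yes No
      fail : holds τ s ≡ false → No → Outcome τ s Yes No

    compareℕ : ∀ i j s → Outcome (i ≤ℕ j) s (reg s i ≤ reg s j) (reg s j < reg s i)
    compareℕ i j s with reg s i ℕ.≤? reg s j
    ... | yes h = pass (dec-true (reg s i ℕ.≤? reg s j) h) h
    ... | no  h = fail (dec-false (reg s i ℕ.≤? reg s j) h) (ℕ.≰⇒> h)

    compareᴷ : ∀ i j s → Outcome (i ≤ᴷ j) s (regᴷ s i K.≤ regᴷ s j) (regᴷ s j K.≤ regᴷ s i)
    compareᴷ i j s with regᴷ s i K.≤? regᴷ s j
    ... | yes h = pass (dec-true (regᴷ s i K.≤? regᴷ s j) h) h
    ... | no  h with K.total (regᴷ s i) (regᴷ s j)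
    ...   | inj₁ h′ = contradiction h′ h
    ...   | inj₂ h′ = fail (dec-false (regᴷ s i K.≤? regᴷ s j) h) h′

    module _ (N B : ℕ) where

      record Constants (s : Store) : Set where
        field
          r0≡N  : reg s 0 ≡ N
          r1≡B  : reg s 1 ≡ B
          r2≡1  : reg s 2 ≡ 1
          r3≡0  : reg s 3 ≡ 0
          r4≡2N : reg s 4 ≡ 2 * N
          r5≡3N : reg s 5 ≡ 3 * N
      open Constants public

      constants-kept :
        ∀ {c s s′} {h₀ : T (not (anyInstr (writes 0) c))} {h₁ : T (not (anyInstr (writes 1) c))}
        {h₂ : T (not (anyInstr (writes 2) c))} {h₃ : T (not (anyInstr (writes 3) c))}
        {h₄ : T (not (anyInstr (writes 4) c))} {h₅ : T (not (anyInstr (writes 5) c))} →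
        Frame c s s′ → Constants s → Constants s′
      constants-kept {h₀ = h₀} {h₁} {h₂} {h₃} {h₄} {h₅} f C = record
        { r0≡N  = trans (reg-kept f 0 {h₀}) (r0≡N C)
        ; r1≡B  = trans (reg-kept f 1 {h₁}) (r1≡B C)
        ; r2≡1  = trans (reg-kept f 2 {h₂}) (r2≡1 C)
        ; r3≡0  = trans (reg-kept f 3 {h₃}) (r3≡0 C)
        ; r4≡2N = trans (reg-kept f 4 {h₄}) (r4≡2N C)
        ; r5≡3N = trans (reg-kept f 5 {h₅}) (r5≡3N C)
        }

  -- The nodes xs are linked by their next fields f; q is the reference to the
  -- first of them and e the one left by the last.  A reference to v is 1 + v.
  Linked : ∀ {N} → (Fin N → ℕ) → ℕ → List (Fin N) → ℕ → Set
  Linked f q []       e = q ≡ e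
  Linked f q (x ∷ xs) e = q ≡ suc (toℕ x) × Linked f (f x) xs e

  linked-cong : ∀ {N} {f g : Fin N → ℕ} {q e} xs → (∀ {x} → x ∈ xs → f x ≡ g x) → Linked f q xs e → Linked g q xs e
  linked-cong []       h l       = l
  linked-cong {e = e} (x ∷ xs) h (l , ls) =
    l , linked-cong xs (h ∘ there) (subst (λ q → Linked _ q xs e) (h (here refl)) ls)

  lookup-injective : ∀ {a} {A : Set a} {xs : List A} → Unique xs → ∀ i j → lookup xs i ≡ lookup xs j → i ≡ j
  lookup-injective (_ ∷ _)  Fin.zero    Fin.zero    _ = refl
  lookup-injective (x∉ ∷ _) Fin.zero    (Fin.suc j) e = contradiction e (All.lookup x∉ (∈-lookup j))
  lookup-injective (x∉ ∷ _) (Fin.suc i) Fin.zero    e = contradiction (sym e) (All.lookup x∉ (∈-lookup i))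
  lookup-injective (_ ∷ u)  (Fin.suc i) (Fin.suc j) e = cong Fin.suc (lookup-injective u i j e)

  length≤N : ∀ {N} {xs : List (Fin N)} → Unique xs → length xs ≤ N
  length≤N u = Fin.injective⇒≤ (λ {i} {j} → lookup-injective u i j)

  linked-++ : ∀ {N} {f : Fin N → ℕ} {q q′ e} xs {ys} → Linked f q xs q′ → Linked f q′ ys e → Linked f q (xs ++ ys) e
  linked-++ []       refl     m = m
  linked-++ (x ∷ xs) (e , l)  m = e , linked-++ xs l m

  linked-nonzero : ∀ {N} {f : Fin N → ℕ} {q} xs → Linked f q xs 1 → 1 ≤ q
  linked-nonzero []       refl       = ℕ.≤-refl
  linked-nonzero (x ∷ xs) (refl , _) = s≤s z≤n

  -- Listing children before parents in linear time

  module Ordering {a ℓ₁ ℓ₂} (K : OrderedField a ℓ₁ ℓ₂) {N : ℕ} (B : ℕ) (T : RootedTree N) where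
    open RootedTree T
    open Structured K
    open Tests K
    open Order T
    open Cells {N}
    open import Data.List.Membership.DecPropositional (Fin._≟_ {N}) using (_∈?_)

    next : Store → Fin N → ℕ
    next s v = mem s (cell v 1)

    Parents : Store → Set
    Parents s = ∀ v → mem s (cell v 0) ≡ encodeParent (parent v)

    -- During a walk nodes below u are marked without being in the list yet.
    MarkedUpTo : Fin N → List (Fin N) → Store → Set
    MarkedUpTo u xs s = ∀ w → depth w ≤ depth u → (w ∈ xs → 1 ≤ next s w) × (w ∉ xs → next s w ≡ 0)

    record Walking (u : Fin N) (xs : List (Fin N)) (s : Store) : Set where
      field
        constants : Constants N B s
        current   : reg s 12 ≡ toℕ u
        continue  : reg s 13 ≡ 0
        parents   : Parents s
        marks     : MarkedUpTo u xs s
    open Walking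

    -- `z` is the last node climbed. Its link is about to be overwritten, hence `relink` allows any
    -- links `f` that agree elsewhere.
    record Walked (u : Fin N) (xs : List (Fin N)) (s s′ : Store) (zs : List (Fin N)) : Set where
      field
        {z}      : Fin N
        topo     : Topo (zs ++ xs)
        u∈       : u ∈ zs
        upwards  : ∀ {w} → w ∈ zs → depth w ≤ depth u
        fresh    : ∀ {w} → w ∈ zs → w ∉ xs
        z∈       : z ∈ zs
        lastCell : reg s′ 16 ≡ cell z 1
        relink   : ∀ f → (∀ w → w ≢ z → f w ≡ next s′ w) → Linked f (suc (toℕ u)) zs (f z)
        marked   : ∀ {w} → w ∈ zs → w ≢ z → 1 ≤ next s′ w
        others   : ∀ w k → ¬ (w ∈ zs × k ≡ 1) → mem s′ (cell w k) ≡ mem s (cell w k)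
    open Walked

    private
      walkBlock : List Instr
      walkBlock = load 14 12 ∷ add 16 12 0 ∷ store 16 14 ∷ set 13 1 ∷ sub 12 14 2 ∷ []

      module AfterBlock {u xs s} (W : Walking u xs s) where
        s₁ : Store
        s₁ = effects walkBlock s

        r14 : reg s₁ 14 ≡ encodeParent (parent u)
        r14 = trans (cong (mem s) (trans (current W) (sym (cell-0 u)))) (parents W u)

        r16 : reg s₁ 16 ≡ cell u 1
        r16 = trans (cong₂ _+_ (current W) (r0≡N (constants W))) (cell-1 u)

        next-u : next s₁ u ≡ encodeParent (parent u)
        next-u = trans (write-same (mem s) u 1 r16) r14

        other : ∀ w k → ¬ (w ≡ u × k ≡ 1) → mem s₁ (cell w k) ≡ mem s (cell w k)
        other w k ne = write-other (mem s) u 1 w k r16 ne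

      depth-< : ∀ {c p} → parent c ≡ just p → depth p < depth c
      depth-< e = ℕ.≤-reflexive (sym (depth-child e))

      encode-just : ∀ {c p} → parent c ≡ just p → encodeParent (parent c) ≡ suc (toℕ p)
      encode-just e = cong encodeParent e

      halting : ∀ {s} → Constants N B s → 1 ≤ reg s 13 → holds (2 ≤ℕ 13) s ≡ true
      halting {s} C h = holds-≤ {s} {2} {13} (subst (_≤ reg s 13) (sym (r2≡1 C)) h)

    WalkRun : Fin N → List (Fin N) → Store → Set _
    WalkRun u xs s = ∃₂ λ t s′ → ⟨ until (2 ≤ℕ 13) walk , s ⟩⇓[ t ] s′ ×
                                 Σ[ zs ∈ List (Fin N) ] (t ≤ 1 + 10 * length zs × Walked u xs s s′ zs)

    -- The path to the root bounds the climb. A round takes one test, at most eight instructions and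
    -- one jump back, hence 10 per node listed.
    walk-correct : ∀ {u xs} → Path parent root u → Topo xs → u ∉ xs → ∀ s → Walking u xs s →
      WalkRun u xs s
    walk-correct {u} {xs} π topo-xs u∉ s W = go π refl
      where
      open AfterBlock W
      continues : holds (2 ≤ℕ 13) s ≡ false
      continues = holds-> {s} {2} {13}
        (subst₂ _<_ (sym (continue W)) (sym (r2≡1 (constants W))) (s≤s z≤n))
      C₁ : Constants N B s₁
      C₁ = constants-kept N B {c = block walkBlock} (frame block) (constants W)

      top : ∀ {s′} → reg s′ 16 ≡ cell u 1 → mem s′ ≡ mem s₁ → Topo (u ∷ xs) → Walked u xs s s′ (u ∷ [])
      top r16′ m t .z        = u
      top r16′ m t .topo     = t
      top r16′ m t .u∈       = here refl
      top r16′ m t .upwards  (here refl) = ℕ.≤-refl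
      top r16′ m t .fresh    (here refl) = u∉
      top r16′ m t .z∈       = here refl
      top r16′ m t .lastCell = r16′
      top r16′ m t .relink f h = refl , refl
      top r16′ m t .marked (here refl) u≢u = contradiction refl u≢u
      top r16′ m t .others w k ne = trans (cong (_$ cell w k) m)
        (other w k λ (w≡u , k≡1) → ne (here w≡u , k≡1))

      go : ∀ {v} → Path parent root v → v ≡ u →
           WalkRun u xs s
      go here refl = _ , s₁ ,
        until-step continues (block ⨾ unless-skip r14≤r3) (until-stop (halting C₁ ℕ.≤-refl)) ,
        u ∷ [] , ℕ.m≤m+n 9 2 , top r16 refl (lonely xs topo-xs u∉)
        where
        r14≤r3 : holds (14 ≤ℕ 3) s₁ ≡ true
        r14≤r3 = holds-≤ {s₁} {14} {3} (ℕ.≤-trans (ℕ.≤-reflexive (trans r14 (cong encodeParent root-parent))) z≤n)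
        lonely : ∀ xs → Topo xs → u ∉ xs → Topo (u ∷ xs)
        lonely []       _ _  = single root-parent
        lonely (x ∷ xs) t u∉ = contradiction (topo-root t (here refl)) u∉
      go (step {p} e π′) refl = enter-parent (p ∈? xs)
        where
        e₂ : List Instr
        e₂ = add 15 12 0 ∷ load 13 15 ∷ []
        s₂ : Store
        s₂ = effects e₂ s₁
        C₂ : Constants N B s₂
        C₂ = constants-kept N B {c = block e₂} (frame block) C₁
        r14>r3 : holds (14 ≤ℕ 3) s₁ ≡ false
        r14>r3 = holds-> {s₁} {14} {3}
          (subst₂ _<_ (sym (r3≡0 C₁)) (sym (trans r14 (encode-just e))) (s≤s z≤n))
        body : ⟨ walk , s ⟩⇓[ 8 ] s₂
        body = block ⨾ unless-run r14>r3 block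
        r12 : reg s₂ 12 ≡ toℕ p
        r12 = trans (cong₂ _∸_ (trans r14 (encode-just e)) (r2≡1 (constants W))) refl
        p≢u : p ≢ u
        p≢u refl = ℕ.<-irrefl refl (depth-< e)
        r13 : reg s₂ 13 ≡ next s p
        r13 = trans (cong (mem s₁) (trans (cong₂ _+_ r12 (r0≡N (constants W))) (cell-1 p)))
                (other p 1 (p≢u ∘ proj₁))
        next-u≡p : next s₁ u ≡ suc (toℕ p)
        next-u≡p = trans next-u (encode-just e)
        marks-p : (p ∈ xs → 1 ≤ next s p) × (p ∉ xs → next s p ≡ 0)
        marks-p = marks W p (ℕ.<⇒≤ (depth-< e))

        enter-parent : Dec (p ∈ xs) → WalkRun u xs s
        enter-parent (yes p∈) = _ , s₂ ,
          until-step continues body (until-stop (halting C₂ (subst (1 ≤_) (sym r13) (proj₁ marks-p p∈)))) ,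
          u ∷ [] , ℕ.≤-refl , top r16 refl (cons e p∈ u∉ topo-xs)
        enter-parent (no p∉)
          with t , s′ , run , zs , t≤ , D ← walk-correct π′ topo-xs p∉ s₂ record
                 { constants = C₂
                 ; current   = r12
                 ; continue  = trans r13 (proj₂ marks-p p∉)
                 ; parents   = λ v → trans (other v 0 λ ()) (parents W v)
                 -- The only link changed so far is that of `u`, which is deeper than every `w`
                 -- considered here.
                 ; marks     = λ w w≤p → let w<u = ℕ.≤-<-trans w≤p (depth-< e)
                                             same = other w 1 λ { (refl , _) → ℕ.<-irrefl refl w<u }
                                             m , m′ = marks W w (ℕ.<⇒≤ w<u)
                                         in (λ w∈ → subst (1 ≤_) (sym same) (m w∈)) , (λ w∉ → trans same (m′ w∉))
                 } = _ , s′ , until-step continues body run , u ∷ zs , bound , extended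
          where
          bound : 1 + (8 + (1 + t)) ≤ 1 + 10 * suc (length zs)
          bound = ℕ.≤-trans (ℕ.+-monoʳ-≤ 10 t≤) (ℕ.≤-reflexive (trans (ℕ.+-suc 10 (10 * length zs))
            (cong suc (sym (ℕ.*-suc 10 (length zs))))))
          u∉zs : u ∉ zs
          u∉zs u∈zs = ℕ.<⇒≱ (depth-< e) (upwards D u∈zs)
          u≢z : u ≢ z D
          u≢z u≡z = u∉zs (subst (_∈ zs) (sym u≡z) (z∈ D))
          next-u′ : next s′ u ≡ suc (toℕ p)
          next-u′ = trans (others D u 1 (u∉zs ∘ proj₁)) next-u≡p
          extended : Walked u xs s s′ (u ∷ zs)
          extended .z    = z D
          extended .topo = cons e (∈-++⁺ˡ (u∈ D))
            (λ u∈ → case ∈-++⁻ zs u∈ of λ { (inj₁ i) → u∉zs i ; (inj₂ i) → u∉ i }) (topo D)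
          extended .u∈   = here refl
          extended .upwards (here refl) = ℕ.≤-refl
          extended .upwards (there w∈)  = ℕ.<⇒≤ (ℕ.≤-<-trans (upwards D w∈) (depth-< e))
          extended .fresh (here refl) = u∉
          extended .fresh (there w∈)  = fresh D w∈
          extended .z∈       = there (z∈ D)
          extended .lastCell = lastCell D
          extended .relink f h = refl , subst (λ q → Linked f q zs (f (z D)))
            (sym (trans (h u u≢z) next-u′)) (relink D f h)
          extended .marked (here refl) _ = subst (1 ≤_) (sym next-u′) (s≤s z≤n)
          extended .marked (there w∈) w≢z = marked D w∈ w≢z
          extended .others w k ne = trans (others D w k λ (w∈ , k≡1) → ne (there w∈ , k≡1))
            (other w k λ (w≡u , k≡1) → ne (here w≡u , k≡1))

    -- The list ends in the reference 1 because a link of 0 would mean an unlisted node; the root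
    -- comes last and its link is never followed.
    record Scanned (v : ℕ) (xs : List (Fin N)) (s : Store) : Set where
      field
        constants : Constants N B s
        position  : reg s 10 ≡ v
        linked    : Linked (next s) (reg s 11) xs 1
        topo      : Topo xs
        parents   : Parents s
        marked    : ∀ {w} → w ∈ xs → 1 ≤ next s w
        unmarked  : ∀ {w} → w ∉ xs → next s w ≡ 0
        scanned   : ∀ {w} → toℕ w < v → w ∈ xs
        blank     : ∀ w → mem s (cell w 2) ≡ 0
    open Scanned

    private
      -- Ten steps are set aside for each unlisted node. A climb is paid for by the nodes it lists,
      -- so all climbs together take linear time.
      potential : List (Fin N) → ℕ
      potential xs = 10 * (N ∸ length xs)

      potential-++ : ∀ zs {xs} → Unique (zs ++ xs) → 10 * length zs + potential (zs ++ xs) ≡ potential xs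
      potential-++ zs {xs} u = begin
        10 * length zs + 10 * (N ∸ length (zs ++ xs))          ≡⟨ ℕ.*-distribˡ-+ 10 (length zs) _ ⟨
        10 * (length zs + (N ∸ length (zs ++ xs)))             ≡⟨ cong (λ n → 10 * (length zs + (N ∸ n))) eq ⟩
        10 * (length zs + (N ∸ (length xs + length zs)))       ≡⟨ cong (λ n → 10 * (length zs + n)) (ℕ.∸-+-assoc N (length xs) (length zs)) ⟨
        10 * (length zs + ((N ∸ length xs) ∸ length zs))
          ≡⟨ cong (10 *_) (ℕ.m+[n∸m]≡n (ℕ.m+n≤o⇒m≤o∸n (length zs)
               (ℕ.≤-trans (ℕ.≤-reflexive (sym (List.length-++ zs))) (length≤N u)))) ⟩
        10 * (N ∸ length xs)                                   ∎
        where
        open ≡-Reasoning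
        eq : length (zs ++ xs) ≡ length xs + length zs
        eq = trans (List.length-++ zs) (ℕ.+-comm (length zs) _)

    ScanRun : ℕ → List (Fin N) → Store → Set _
    ScanRun v xs s = ∃₂ λ t s′ → ⟨ scan , s ⟩⇓[ t ] s′ ×
      Σ[ ys ∈ List (Fin N) ] (t + potential ys ≤ 8 + potential xs × Scanned (suc v) ys s′)

    scan-correct : ∀ {v xs} → v < N → ∀ s → Scanned v xs s →
      ScanRun v xs s
    scan-correct {v} {xs} v<N s S = go (u ∈? xs)
      where
      u : Fin N
      u = fromℕ< v<N
      toℕ-u : toℕ u ≡ v
      toℕ-u = Fin.toℕ-fromℕ< v<N
      b₁ : List Instr
      b₁ = add 12 10 3 ∷ add 15 12 0 ∷ load 13 15 ∷ []
      s₁ : Store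
      s₁ = effects b₁ s
      C₁ : Constants N B s₁
      C₁ = constants-kept N B {c = block b₁} (frame block) (constants S)
      r12 : reg s₁ 12 ≡ toℕ u
      r12 = trans (cong₂ _+_ (trans (position S) (sym toℕ-u)) (r3≡0 (constants S))) (ℕ.+-identityʳ (toℕ u))
      r13 : reg s₁ 13 ≡ next s u
      r13 = cong (mem s) (trans (cong₂ _+_ r12 (r0≡N (constants S))) (cell-1 u))
      b₃ : List Instr
      b₃ = add 10 10 2 ∷ []
      step-position : ∀ {s′} → Constants N B s′ → reg s′ 10 ≡ v → reg s′ 10 + reg s′ 2 ≡ suc v
      step-position C e = trans (cong₂ _+_ e (r2≡1 C)) (ℕ.+-comm v 1)
      extend-scanned : ∀ {ys} → u ∈ ys → (∀ {w} → w ∈ xs → w ∈ ys) → ∀ {w} → toℕ w < suc v → w ∈ ys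
      extend-scanned {ys} u∈ xs⊆ {w} (s≤s w≤v) with ℕ.m≤n⇒m<n∨m≡n w≤v
      ... | inj₁ w<v = xs⊆ (scanned S w<v)
      ... | inj₂ w≡v = subst (_∈ ys) (Fin.toℕ-injective (trans toℕ-u (sym w≡v))) u∈

      go : Dec (u ∈ xs) → ScanRun v xs s
      go (yes u∈) = _ , effects b₃ s₁ ,
        block ⨾ unless-skip (halting C₁ (subst (1 ≤_) (sym r13) (marked S u∈))) ⨾ block ,
        xs , ℕ.+-monoˡ-≤ (potential xs) (ℕ.m≤m+n 5 3) , record
          { constants = constants-kept N B {c = block b₃} (frame block) C₁
          ; position  = step-position {s₁} C₁ (position S)
          ; linked    = linked S
          ; topo      = topo S
          ; parents   = parents S
          ; marked    = marked S
          ; unmarked  = unmarked S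
          ; scanned   = extend-scanned u∈ id
          ; blank     = blank S
          }
      go (no u∉)
        with t , s₂ , run , zs , t≤ , D ← walk-correct (rootPath u) (topo S) u∉ s₁ record
               { constants = C₁
               ; current   = r12
               ; continue  = trans r13 (unmarked S u∉)
               ; parents   = parents S
               ; marks     = λ w _ → marked S , unmarked S
               } = _ , s₄ ,
        block ⨾ unless-run (holds-> {s₁} {2} {13} (subst₂ _<_ (sym (trans r13 (unmarked S u∉))) (sym (r2≡1 C₁)) (s≤s z≤n)))
                  (run ⨾ block) ⨾ block ,
        zs ++ xs , bound , record
          { constants = constants-kept N B {c = block b₃} (frame block) C₃
          ; position  = step-position {s₃} C₃ r10
          ; linked    = linked-++ zs (subst (λ q → Linked (next s₄) q zs (next s₄ (z D))) (sym r11)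
                                       (relink D (next s₄) λ w w≢z → other w 1 (w≢z ∘ proj₁)))
                          (subst (λ q → Linked (next s₄) q xs 1) (sym next-z)
                            (linked-cong xs (λ x∈ → sym (listed x∈)) (linked S)))
          ; topo      = topo D
          ; parents   = λ w → trans (other w 0 λ ()) (trans (others D w 0 λ ()) (parents S w))
          ; marked    = λ w∈ → marked′ (∈-++⁻ zs w∈)
          ; unmarked  = λ {w} w∉ → trans (other w 1 λ { (refl , _) → w∉ (∈-++⁺ˡ (z∈ D)) })
                          (trans (others D w 1 (w∉ ∘ ∈-++⁺ˡ ∘ proj₁)) (unmarked S (w∉ ∘ ∈-++⁺ʳ zs)))
          ; scanned   = extend-scanned (∈-++⁺ˡ (u∈ D)) (∈-++⁺ʳ zs)
          ; blank     = λ w → trans (other w 2 λ ()) (trans (others D w 2 λ ()) (blank S w))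
          }
        where
        C₂ : Constants N B s₂
        C₂ = constants-kept N B {c = until (2 ≤ℕ 13) walk} (frame run) C₁
        b₂ : List Instr
        b₂ = store 16 11 ∷ add 11 10 2 ∷ []
        s₃ s₄ : Store
        s₃ = effects b₂ s₂
        s₄ = effects b₃ s₃
        C₃ : Constants N B s₃
        C₃ = constants-kept N B {c = block b₂} (frame block) C₂
        r10 : reg s₂ 10 ≡ v
        r10 = trans (reg-kept (frame run) 10) (position S)
        r11 : reg s₂ 10 + reg s₂ 2 ≡ suc (toℕ u)
        r11 = trans (step-position {s₂} C₂ r10) (cong suc (sym toℕ-u))
        next-z : next s₄ (z D) ≡ reg s 11
        next-z = trans (write-same (mem s₂) (z D) 1 (lastCell D)) (reg-kept (frame run) 11)
        other : ∀ w k → ¬ (w ≡ z D × k ≡ 1) → mem s₄ (cell w k) ≡ mem s₂ (cell w k)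
        other w k ne = write-other (mem s₂) (z D) 1 w k (lastCell D) ne
        listed : ∀ {w} → w ∈ xs → next s₄ w ≡ next s w
        listed {w} w∈ = trans (other w 1 λ { (refl , _) → fresh D (z∈ D) w∈ })
          (others D w 1 λ (w∈zs , _) → fresh D w∈zs w∈)
        marked′ : ∀ {w} → w ∈ zs ⊎ w ∈ xs → 1 ≤ next s₄ w
        marked′ (inj₂ w∈) = subst (1 ≤_) (sym (listed w∈)) (marked S w∈)
        marked′ {w} (inj₁ w∈) with w Fin.≟ z D
        ... | yes refl = subst (1 ≤_) (sym next-z) (linked-nonzero xs (linked S))
        ... | no  w≢z  = subst (1 ≤_) (sym (other w 1 (w≢z ∘ proj₁))) (marked D w∈ w≢z)
        bound : 3 + (1 + (t + 2) + 1) + potential (zs ++ xs) ≤ 8 + potential xs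
        bound = begin
          3 + (1 + (t + 2) + 1) + potential (zs ++ xs)      ≡⟨ cong (λ n → 4 + n + potential (zs ++ xs)) (ℕ.+-assoc t 2 1) ⟩
          4 + (t + 3) + potential (zs ++ xs)                ≤⟨ ℕ.+-monoˡ-≤ (potential (zs ++ xs)) (ℕ.+-monoʳ-≤ 4 (ℕ.+-monoˡ-≤ 3 t≤)) ⟩
          4 + (1 + 10 * length zs + 3) + potential (zs ++ xs)
            ≡⟨ cong (λ n → 5 + n + potential (zs ++ xs)) (ℕ.+-comm (10 * length zs) 3) ⟩
          8 + 10 * length zs + potential (zs ++ xs)         ≡⟨ ℕ.+-assoc 8 (10 * length zs) _ ⟩
          8 + (10 * length zs + potential (zs ++ xs))       ≡⟨ cong (8 +_) (potential-++ zs (topo-unique (topo D))) ⟩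
          8 + potential xs                                  ∎
          where open ℕ.≤-Reasoning

    private
      position<N : ∀ {v n} → v + suc n ≡ N → v < N
      position<N {v} {n} eq = ℕ.≤-trans (ℕ.m≤m+n (suc v) n) (ℕ.≤-reflexive (trans (sym (ℕ.+-suc v n)) eq))

    order-correct : ∀ n {v xs} → v + n ≡ N → ∀ s → Scanned v xs s →
                    Runs order s (1 + (10 * n + potential xs)) (λ s′ → Σ[ ys ∈ List (Fin N) ] Scanned N ys s′)
    order-correct zero {v} {xs} eq s S with refl ← trans (sym (ℕ.+-identityʳ v)) eq =
      within (ℕ.m≤m+n 1 _) (stop (holds-≤ {s} {0} {10} (ℕ.≤-reflexive (trans (r0≡N (constants S)) (sym (position S))))) (xs , S))
    order-correct (suc n) {v} {xs} eq s S
      with t , s₁ , run , ys , t≤ , S₁ ← scan-correct (position<N eq) s S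
      with t′ , s₂ , run′ , t′≤ , post ← order-correct n (trans (sym (ℕ.+-suc v n)) eq) s₁ S₁ =
      _ , s₂ , until-step (holds-> {s} {0} {10} (subst₂ _<_ (sym (position S)) (sym (r0≡N (constants S))) (position<N eq))) run run′ ,
      bound , post
      where
      bound : suc (t + suc t′) ≤ 1 + (10 * suc n + potential xs)
      bound = begin
        suc (t + suc t′)                             ≤⟨ s≤s (ℕ.+-monoʳ-≤ t (s≤s t′≤)) ⟩
        suc (t + suc (1 + (10 * n + potential ys)))
          ≡⟨ solve 3 (λ t n p → con 1 :+ (t :+ (con 1 :+ (con 1 :+ (con 10 :* n :+ p)))) :=
                                con 3 :+ con 10 :* n :+ (t :+ p)) refl t n (potential ys) ⟩
        3 + 10 * n + (t + potential ys)              ≤⟨ ℕ.+-monoʳ-≤ (3 + 10 * n) t≤ ⟩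
        3 + 10 * n + (8 + potential xs)
          ≡⟨ solve 2 (λ n p → con 3 :+ con 10 :* n :+ (con 8 :+ p) :=
                              con 1 :+ (con 10 :* (con 1 :+ n) :+ p)) refl n (potential xs) ⟩
        1 + (10 * suc n + potential xs)              ∎
        where open ℕ.≤-Reasoning

  m∸[m∸n]≡n⊓m : ∀ m n → m ∸ (m ∸ n) ≡ n ⊓ m
  m∸[m∸n]≡n⊓m m n = trans (cong (_∸ (m ∸ n)) (sym (ℕ.m⊓n+n∸m≡n n m))) (ℕ.m+n∸n≡m (n ⊓ m) (m ∸ n))

  -- Selecting a least entry and merging tables on the machine

  module TableSteps {a ℓ₁ ℓ₂} (K : OrderedField a ℓ₁ ℓ₂) {N : ℕ} (B : ℕ) (1≤B : 1 ≤ B) where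
    open Structured K
    open Tests K
    open Cells {N}
    private module K = OrderedField K
    open K using (Carrier)

    column : Store → Fin N → ℕ → ℕ
    column s v k = mem s (cell v k)

    columnᴷ : Store → Fin N → ℕ → Carrier
    columnᴷ s v k = memᴷ s (cell v k)

    record Selecting (u : Fin N) (β : ℕ → Carrier) (k kb : ℕ) (s : Store) : Set (a Level.⊔ ℓ₂) where
      field
        constants : Constants N B s
        atNode      : reg s 21 ≡ toℕ u
        table     : ∀ j → columnᴷ s u j ≡ β j
        counter   : reg s 23 ≡ k
        address   : reg s 24 ≡ cell u k
        offset    : reg s 25 ≡ kb * N
        value     : regᴷ s 1 ≡ β kb
        1≤kb      : 1 ≤ kb
        kb≤k      : kb ≤ k
        least     : ∀ j → 1 ≤ j → j ≤ k → β kb K.≤ β j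

    private
      least-suc : ∀ {β : ℕ → Carrier} {k x} → (∀ j → 1 ≤ j → j ≤ k → x K.≤ β j) → x K.≤ β (suc k) →
                  ∀ j → 1 ≤ j → j ≤ suc k → x K.≤ β j
      least-suc {k = k} l h j 1≤j j≤ with ℕ.m≤n⇒m<n∨m≡n j≤
      ... | inj₁ (s≤s j≤k) = l j 1≤j j≤k
      ... | inj₂ refl      = h

    selectStep-correct : ∀ {u β k kb} s → Selecting u β k kb s →
                         Runs selectStep s 6 (λ s′ → ∃ λ kb′ → Selecting u β (suc k) kb′ s′)
    selectStep-correct {u} {β} {k} {kb} s S =
      run-block {Q = s₁ ≡_} refl then λ { f refl → case compareᴷ 1 0 s₁ of λ where
        (pass h le) → skip h (kb , record
          { constants = C₁ ; atNode = atNode ; table = table ; counter = r23 ; address = r24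
          ; offset = offset ; value = value ; 1≤kb = 1≤kb ; kb≤k = ℕ.m≤n⇒m≤1+n kb≤k
          ; least = least-suc least (subst₂ K._≤_ value k0 le) })
        (fail h le) → enter h (run-block {is = b₂} (suc k , record
          { constants = constants-kept N B {c = block b₂} (frame block) C₁
          ; atNode = atNode ; table = table ; counter = r23 ; address = r24
          ; offset = trans (cong₂ _∸_ r24 atNode) (cell-offset u (suc k))
          ; value  = k0
          ; 1≤kb   = s≤s z≤n
          ; kb≤k   = ℕ.≤-refl
          ; least  = least-suc (λ j 1≤j j≤k → K.≤-trans (subst₂ K._≤_ k0 value le) (least j 1≤j j≤k)) K.≤-refl })) }
      where
      open Selecting S
      b₁ b₂ : List Instr
      b₁ = add 23 23 2 ∷ add 24 24 0 ∷ loadᴷ 0 24 ∷ []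
      b₂ = loadᴷ 1 24 ∷ sub 25 24 21 ∷ []
      s₁ : Store
      s₁ = effects b₁ s
      C₁ : Constants N B s₁
      C₁ = constants-kept N B {c = block b₁} (frame block) constants
      r23 : reg s₁ 23 ≡ suc k
      r23 = trans (cong₂ _+_ counter (r2≡1 constants)) (ℕ.+-comm k 1)
      r24 : reg s₁ 24 ≡ cell u (suc k)
      r24 = trans (cong₂ _+_ address (r0≡N constants)) (cell-suc u k)
      k0 : memᴷ s (reg s₁ 24) ≡ β (suc k)
      k0 = trans (cong (memᴷ s) r24) (table (suc k))

    selectLoop-correct : ∀ n {u β k kb} → k + n ≡ B → ∀ s → Selecting u β k kb s →
      Runs (until (1 ≤ℕ 23) selectStep) s (1 + 8 * n) (λ s′ → ∃ λ kb′ → Selecting u β B kb′ s′)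
    selectLoop-correct zero {k = k} eq s S with refl ← trans (sym (ℕ.+-identityʳ k)) eq =
      stop (holds-≤ {s} {1} {23} (ℕ.≤-reflexive (trans (r1≡B constants) (sym counter)))) (_ , S)
      where open Selecting S
    selectLoop-correct (suc n) {k = k} eq s S = within
      (ℕ.≤-reflexive (solve 1 (λ n → con 8 :+ (con 1 :+ con 8 :* n) := con 1 :+ con 8 :* (con 1 :+ n)) refl n))
      (iterate (holds-> {s} {1} {23} (subst₂ _<_ (sym counter) (sym (r1≡B constants))
          (ℕ.≤-trans (ℕ.m≤m+n (suc k) n) (ℕ.≤-reflexive (trans (sym (ℕ.+-suc k n)) eq)))))
        (selectStep-correct s S)
        λ { _ (_ , S′) → selectLoop-correct n (trans (sym (ℕ.+-suc k n)) eq) _ S′ })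
      where open Selecting S

    record Selected (u : Fin N) (s : Store) : Set (a Level.⊔ ℓ₂) where
      field
        {kb}     : ℕ
        1≤kb     : 1 ≤ kb
        kb≤B     : kb ≤ B
        least    : ∀ j → 1 ≤ j → j ≤ B → columnᴷ s u kb K.≤ columnᴷ s u j
        value    : regᴷ s 2 ≡ columnᴷ s u kb K.+ columnᴷ s u 0
        address  : reg s 24 ≡ cell u B
        recorded : column s u 3 ≡ kb * N

    select-correct : ∀ {u} s → Constants N B s → reg s 21 ≡ toℕ u →
      Runs select s (9 + 8 * B) (λ s′ → Selected u s′ ×
        (∀ w k → ¬ (w ≡ u × k ≡ 3) → column s′ w k ≡ column s w k))
    select-correct {u} s C r21 = within
      (ℕ.≤-trans (ℕ.+-monoʳ-≤ 4 (ℕ.+-monoˡ-≤ 4 (ℕ.+-monoʳ-≤ 1 (ℕ.*-monoʳ-≤ 8 (ℕ.m∸n≤m B 1)))))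
        (ℕ.≤-reflexive (solve 1 (λ b → con 4 :+ ((con 1 :+ con 8 :* b) :+ con 4) := con 9 :+ con 8 :* b) refl B)))
      (run-block {Q = s₁ ≡_} refl then λ { _ refl →
        selectLoop-correct (B ∸ 1) (ℕ.m+[n∸m]≡n 1≤B) s₁ start then λ {s₂} f (kb , S) →
          run-block {is = b₃} (finish f S) })
      where
      b₁ b₃ : List Instr
      b₁ = add 24 21 0 ∷ loadᴷ 1 24 ∷ add 25 0 3 ∷ set 23 1 ∷ []
      b₃ = add 26 21 5 ∷ store 26 25 ∷ loadᴷ 0 21 ∷ addᴷ 2 1 0 ∷ []
      s₁ : Store
      s₁ = effects b₁ s
      r24 : reg s₁ 24 ≡ cell u 1
      r24 = trans (cong₂ _+_ r21 (r0≡N C)) (cell-1 u)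
      start : Selecting u (columnᴷ s u) 1 1 s₁
      start = record
        { constants = constants-kept N B {c = block b₁} (frame block) C
        ; atNode      = r21
        ; table     = λ _ → refl
        ; counter   = refl
        ; address   = r24
        ; offset    = trans (cong₂ _+_ (r0≡N C) (r3≡0 C)) refl
        ; value     = cong (memᴷ s) r24
        ; 1≤kb      = ℕ.≤-refl
        ; kb≤k      = ℕ.≤-refl
        ; least     = λ { j 1≤j j≤1 → K.≤-reflexive (K.reflexive (cong (columnᴷ s u) (ℕ.≤-antisym 1≤j j≤1))) }
        }
      finish : ∀ {s₂ kb} → Frame (until (1 ≤ℕ 23) selectStep) s₁ s₂ → Selecting u (columnᴷ s u) B kb s₂ →
               Selected u (effects b₃ s₂) × (∀ w k → ¬ (w ≡ u × k ≡ 3) → column (effects b₃ s₂) w k ≡ column s w k)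
      finish {s₂} {kb} f S = record
        { kb       = kb
        ; 1≤kb     = 1≤kb
        ; kb≤B     = kb≤k
        ; least    = λ j 1≤j j≤B → subst₂ K._≤_ (sym (table kb)) (sym (table j)) (least j 1≤j j≤B)
        ; value    = cong₂ K._+_ (trans value (sym (table kb)))
                       (cong (memᴷ s₂) (trans atNode (sym (cell-0 u))))
        ; address  = address
        ; recorded = trans (write-same (mem s₂) u 3 r26) offset
        } , λ w k ne → trans (write-other (mem s₂) u 3 w k r26 ne)
              (cong (_$ cell w k) (mem-kept f))
        where
        open Selecting S
        r26 : reg s₂ 21 + reg s₂ 5 ≡ cell u 3
        r26 = cong₂ _+_ atNode (r5≡3N constants)

    module Merge (u p : Fin N) (u≢p : u ≢ p) (α : ℕ → Carrier) (m n : ℕ) (g : Carrier)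
                 (base : ℕ → ℕ) (baseᴷ : ℕ → Carrier) where

      β : ℕ → Carrier
      β k = baseᴷ (cell u k)

      open Merging K N B α β m n g

      -- `base` and `baseᴷ` are the memories before the row loop. It changes only the choices of
      -- `u`, in rows from 4 on, and the costs of `p`, so the table `β` remains readable throughout.
      Others Othersᴷ : Store → Set _
      Others s  = ∀ w k → ¬ (w ≡ u × 4 ≤ k) → column s w k ≡ base (cell w k)
      Othersᴷ s = ∀ w k → w ≢ p → columnᴷ s w k ≡ baseᴷ (cell w k)

      choices : Store → ℕ → ℕ
      choices s k = column s u (3 + k)

      record Relaxing (i j L : ℕ) (s : Store) : Set (a Level.⊔ ℓ₂) where
        field
          constants : Constants N B s
          atNode      : reg s 21 ≡ toℕ u
          limit     : reg s 36 ≡ L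
          counter   : reg s 38 ≡ j
          source    : reg s 39 ≡ cell u j
          target    : reg s 40 ≡ cell p (i + j)
          choice    : reg s 41 ≡ cell u (3 + (i + j))
          kept      : regᴷ s 3 ≡ α i
          partial   : Partial i (RowUpTo i (suc j)) (columnᴷ s p) (choices s)
          others    : Others s
          othersᴷ   : Othersᴷ s

      relax-correct : ∀ {i j L} → 1 ≤ i → ∀ s → Relaxing i j L s → Runs relax s 11 (Relaxing i (suc j) L)
      relax-correct {i} {j} {L} 1≤i s R =
        run-block {Q = s₁ ≡_} refl then λ { f refl → case compareᴷ 6 5 s₁ of λ where
          (pass h le) → skip h record
            { constants = C₁ ; atNode = atNode ; limit = limit ; counter = r38 ; source = r39
            ; target = r40 ; choice = r41 ; kept = kept
            ; partial = partial-hold partial (subst₂ K._≤_ k6 k5 le)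
            ; others = others ; othersᴷ = othersᴷ }
          (fail h le) → enter h (run-block {is = b₂} record
            { constants = constants-kept N B {c = block b₂} (frame block) C₁
            ; atNode = atNode ; limit = limit ; counter = r38 ; source = r39
            ; target = r40 ; choice = r41 ; kept = kept
            ; partial = partial-relax partial 1≤i (s≤s z≤n) (subst₂ K._≤_ k5 k6 le)
                (trans (write-same (memᴷ s) p (i + suc j) r40) k5)
                (λ k k≢ → write-other (memᴷ s) p (i + suc j) p k r40 (k≢ ∘ proj₂))
                (trans (write-same (mem s) u (3 + (i + suc j)) r41)
                       (trans (cong₂ _∸_ r39 atNode) (cell-offset u (suc j))))
                (λ k k≢ → write-other (mem s) u (3 + (i + suc j)) u (3 + k) r41
                            (k≢ ∘ ℕ.+-cancelˡ-≡ 3 k (i + suc j) ∘ proj₂))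
            ; others = λ w k ne → trans (write-other (mem s) u (3 + (i + suc j)) w k r41
                λ { (w≡u , refl) → ne (w≡u , ℕ.+-monoʳ-≤ 3 (ℕ.≤-trans 1≤i (ℕ.m≤m+n i (suc j)))) })
                (others w k ne)
            ; othersᴷ = λ w k ne → trans (write-other (memᴷ s) p (i + suc j) w k r40 (ne ∘ proj₁))
                (othersᴷ w k ne) }) }
        where
        open Relaxing R
        b₁ b₂ : List Instr
        b₁ = add 38 38 2 ∷ add 39 39 0 ∷ add 40 40 0 ∷ add 41 41 0 ∷ loadᴷ 5 39 ∷ addᴷ 5 3 5 ∷ loadᴷ 6 40 ∷ []
        b₂ = storeᴷ 40 5 ∷ sub 42 39 21 ∷ store 41 42 ∷ []
        s₁ : Store
        s₁ = effects b₁ s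
        C₁ : Constants N B s₁
        C₁ = constants-kept N B {c = block b₁} (frame block) constants
        r38 : reg s₁ 38 ≡ suc j
        r38 = trans (cong₂ _+_ counter (r2≡1 constants)) (ℕ.+-comm j 1)
        r39 : reg s₁ 39 ≡ cell u (suc j)
        r39 = trans (cong₂ _+_ source (r0≡N constants)) (cell-suc u j)
        r40 : reg s₁ 40 ≡ cell p (i + suc j)
        r40 = trans (cong₂ _+_ target (r0≡N constants))
                (trans (cell-suc p (i + j)) (cong (cell p) (sym (ℕ.+-suc i j))))
        r41 : reg s₁ 41 ≡ cell u (3 + (i + suc j))
        r41 = trans (cong₂ _+_ choice (r0≡N constants))
                (trans (cell-suc u (3 + (i + j))) (cong (λ k → cell u (3 + k)) (sym (ℕ.+-suc i j))))
        k5 : regᴷ s₁ 5 ≡ α i K.+ β (suc j)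
        k5 = cong₂ K._+_ kept (trans (cong (memᴷ s) r39) (othersᴷ u (suc j) u≢p))
        k6 : regᴷ s₁ 6 ≡ columnᴷ s p (i + suc j)
        k6 = cong (memᴷ s) r40

      relaxLoop-correct : ∀ d {i j L} → 1 ≤ i → j + d ≡ L → ∀ s → Relaxing i j L s →
                          Runs (until (36 ≤ℕ 38) relax) s (1 + 13 * d) (Relaxing i L L)
      relaxLoop-correct zero {j = j} 1≤i eq s R with refl ← trans (sym (ℕ.+-identityʳ j)) eq =
        stop (holds-≤ {s} {36} {38} (ℕ.≤-reflexive (trans limit (sym counter)))) R
        where open Relaxing R
      relaxLoop-correct (suc d) {j = j} 1≤i eq s R = within
        (ℕ.≤-reflexive (solve 1 (λ d → con 13 :+ (con 1 :+ con 13 :* d) := con 1 :+ con 13 :* (con 1 :+ d)) refl d))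
        (iterate (holds-> {s} {36} {38} (subst₂ _<_ (sym counter) (sym limit)
            (ℕ.≤-trans (ℕ.m≤m+n (suc j) d) (ℕ.≤-reflexive (trans (sym (ℕ.+-suc j d)) eq)))))
          (relax-correct 1≤i s R)
          λ _ R′ → relaxLoop-correct d 1≤i (trans (sym (ℕ.+-suc j d)) eq) _ R′)
        where open Relaxing R

      record Rows (i : ℕ) (s : Store) : Set (a Level.⊔ ℓ₂) where
        field
          constants : Constants N B s
          atNode      : reg s 21 ≡ toℕ u
          counter   : reg s 29 ≡ i
          target    : reg s 27 ≡ cell p i
          choice    : reg s 28 ≡ cell u (3 + i)
          source    : reg s 33 ≡ n
          limit     : reg s 34 ≡ suc m
          severing  : regᴷ s 2 ≡ g
          partial   : Partial (suc i) (Rows≥ (suc i)) (columnᴷ s p) (choices s)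
          others    : Others s
          othersᴷ   : Othersᴷ s

      record Scattered (i : ℕ) (s s′ : Store) : Set (a Level.⊔ ℓ₂) where
        field
          partial   : Partial i (Rows≥ i) (columnᴷ s′ p) (choices s′)
          others    : Others s′
          othersᴷ   : Othersᴷ s′

      private
        scatterBlock : List Instr
        scatterBlock = sub 36 1 29 ∷ sub 37 36 33 ∷ sub 36 36 37 ∷
                       set 38 0 ∷ add 39 21 3 ∷ add 40 27 3 ∷ add 41 28 3 ∷ []

      scatter-correct : ∀ {i} → 1 ≤ i → ∀ s → Constants N B s →
        reg s 21 ≡ toℕ u → reg s 29 ≡ i → reg s 27 ≡ cell p i → reg s 28 ≡ cell u (3 + i) →
        reg s 33 ≡ n → regᴷ s 3 ≡ α i → Partial i (Rows≥ (suc i)) (columnᴷ s p) (choices s) →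
        Others s → Othersᴷ s → Runs scatter s (8 + 13 * (n ⊓ B)) (Scattered i s)
      scatter-correct {i} 1≤i s C r21 r29 r27 r28 r33 k3 P O Oᴷ = within
        (ℕ.+-monoʳ-≤ 8 (ℕ.*-monoʳ-≤ 13 (ℕ.⊓-monoʳ-≤ n (ℕ.m∸n≤m B i))))
        (run-block {Q = s₁ ≡_} {is = scatterBlock} refl then λ { _ refl →
          yielding (λ _ R → record
            { partial = redone below (Relaxing.partial R)
            ; others  = Relaxing.others R
            ; othersᴷ = Relaxing.othersᴷ R })
            (relaxLoop-correct L 1≤i refl s₁ record
              { constants = constants-kept N B {c = block scatterBlock} (frame block) C
              ; atNode      = r21
              ; limit     = trans (cong₂ (λ x y → x ∸ (x ∸ y)) (cong₂ _∸_ (r1≡B C) r29) r33) (m∸[m∸n]≡n⊓m (B ∸ i) n)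
              ; counter   = refl
              ; source    = cong₂ _+_ r21 (r3≡0 C)
              ; target    = trans (plus0 r27) (cong (cell p) (sym (ℕ.+-identityʳ i)))
              ; choice    = trans (plus0 r28) (cong (λ k → cell u (3 + k)) (sym (ℕ.+-identityʳ i)))
              ; kept      = k3
              ; partial   = redone (λ { i′ j′ _ 1≤j′ _ _ (inj₁ i<i′) → i<i′
                                      ; i′ j′ _ 1≤j′ _ _ (inj₂ (_ , s≤s j′≤0)) →
                                          contradiction (ℕ.≤-trans 1≤j′ j′≤0) λ () }) P
              ; others    = O
              ; othersᴷ   = Oᴷ
              }) })
        where
        s₁ : Store
        s₁ = effects scatterBlock s
        L : ℕ
        L = n ⊓ (B ∸ i)
        plus0 : ∀ {x y} → x ≡ y → x + reg s 3 ≡ y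
        plus0 {y = y} e = trans (cong₂ _+_ e (r3≡0 C)) (ℕ.+-identityʳ y)
        -- A pair beyond the end `n ⊓ (B ∸ i)` of the inner loop would exceed the size of the child
        -- or overfill the block.
        below : ∀ i′ j′ → i′ ≤ m → 1 ≤ j′ → j′ ≤ n → i′ + j′ ≤ B → i ≤ i′ → RowUpTo i (suc L) i′ j′
        below i′ j′ _ _ j′≤n ≤B i≤i′ with ℕ.m≤n⇒m<n∨m≡n i≤i′
        ... | inj₁ i<i′ = inj₁ i<i′
        ... | inj₂ refl = inj₂ (refl , s≤s (ℕ.⊓-glb j′≤n (ℕ.m+n≤o⇒m≤o∸n j′
                (ℕ.≤-trans (ℕ.≤-reflexive (ℕ.+-comm j′ i)) ≤B))))

      private
        rowBlock rowEnd : List Instr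
        rowBlock = loadᴷ 3 27 ∷ addᴷ 4 3 2 ∷ storeᴷ 27 4 ∷ store 28 3 ∷ []
        rowEnd   = sub 29 29 2 ∷ sub 27 27 0 ∷ sub 28 28 0 ∷ []

        module AfterRowBlock {i s} (R : Rows (suc i) s) where
          open Rows R
          s₁ : Store
          s₁ = effects rowBlock s
          C₁ : Constants N B s₁
          C₁ = constants-kept N B {c = block rowBlock} (frame block) constants
          k3 : regᴷ s₁ 3 ≡ α (suc i)
          k3 = trans (cong (memᴷ s) target) (pristine partial (suc i) ℕ.≤-refl)
          partial₁ : Partial (suc i) (Rows≥ (suc (suc i))) (columnᴷ s₁ p) (choices s₁)
          partial₁ = partial-lower partial (λ _ _ → id)
            (trans (write-same (memᴷ s) p (suc i) target) (cong₂ K._+_ k3 severing))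
            (λ k k≢ → write-other (memᴷ s) p (suc i) p k target (k≢ ∘ proj₂))
            (trans (write-same (mem s) u (4 + i) choice) (r3≡0 constants))
            (λ k k≢ → write-other (mem s) u (4 + i) u (3 + k) choice
                        (k≢ ∘ ℕ.+-cancelˡ-≡ 3 k (suc i) ∘ proj₂))
          others₁ : Others s₁
          others₁ w k ne = trans (write-other (mem s) u (4 + i) w k choice
            λ { (w≡u , refl) → ne (w≡u , ℕ.m≤m+n 4 i) }) (others w k ne)
          othersᴷ₁ : Othersᴷ s₁
          othersᴷ₁ w k ne = trans (write-other (memᴷ s) p (suc i) w k target (ne ∘ proj₁)) (othersᴷ w k ne)

          finish : ∀ {s₂} → Frame (unless (34 ≤ℕ 29) scatter) s₁ s₂ → Scattered (suc i) s₁ s₂ → Rows i (effects rowEnd s₂)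
          finish {s₂} f S = record
            { constants = constants-kept N B {c = block rowEnd} (frame block) C₂
            ; atNode      = trans (reg-kept f 21) atNode
            ; counter   = trans (cong₂ _∸_ (trans (reg-kept f 29) counter) (r2≡1 C₂)) refl
            ; target    = trans (cong₂ _∸_ (trans (reg-kept f 27) target) (r0≡N C₂)) (cell-pred p i)
            ; choice    = trans (cong₂ _∸_ (trans (reg-kept f 28) choice) (r0≡N C₂)) (cell-pred u (3 + i))
            ; source    = trans (reg-kept f 33) source
            ; limit     = trans (reg-kept f 34) limit
            ; severing  = trans (regᴷ-kept f 2) severing
            ; partial   = Scattered.partial S
            ; others    = Scattered.others S
            ; othersᴷ   = Scattered.othersᴷ S
            }
            where
            C₂ : Constants N B s₂
            C₂ = constants-kept N B {c = unless (34 ≤ℕ 29) scatter} f C₁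

      -- At most 18 steps for a row besides its comparisons, and 13 for each comparison. Only rows
      -- up to `m` make comparisons, hence `i ⊓ m`.
      rowCost : ℕ → ℕ
      rowCost i = 1 + (18 * i + 13 * ((i ⊓ m) * (n ⊓ B)))

      rows-correct : ∀ i s → Rows i s → Runs (until (29 ≤ℕ 3) row) s (rowCost i) (Rows 0)
      rows-correct zero s R = stop (holds-≤ {s} {29} {3} (ℕ.≤-trans (ℕ.≤-reflexive counter) z≤n)) R
        where open Rows R
      rows-correct (suc i) s R = decide (compareℕ 34 29 s₁)
        where
        open Rows R
        open AfterRowBlock R
        continue : holds (29 ≤ℕ 3) s ≡ false
        continue = holds-> {s} {29} {3} (subst₂ _<_ (sym (r3≡0 constants)) (sym counter) (s≤s z≤n))

        proceed : ∀ {b} → 10 + b + rowCost i ≤ rowCost (suc i) →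
                  Runs (unless (34 ≤ℕ 29) scatter) s₁ (suc b) (Scattered (suc i) s₁) →
                  Runs (until (29 ≤ℕ 3) row) s (rowCost (suc i)) (Rows 0)
        proceed {b} bound r = within
          (ℕ.≤-trans (ℕ.≤-reflexive (cong (2 +_) (cong (_+ rowCost i) (cong (5 +_) (ℕ.+-comm b 3))))) bound)
          (iterate continue
            (run-block {Q = s₁ ≡_} refl then λ { _ refl → r then λ f S → run-block {is = rowEnd} (finish f S) })
            λ _ → rows-correct i _)

        decide : Outcome (34 ≤ℕ 29) s₁ (reg s 34 ≤ reg s 29) (reg s 29 < reg s 34) →
                 Runs (until (29 ≤ℕ 3) row) s (rowCost (suc i)) (Rows 0)
        -- A row beyond the size of the tree at `p` has no pairs to compare; it offers only the
        -- choice to sever.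
        decide (pass h sm≤si) = proceed {0} bound (skip h record
            { partial = redone (λ i′ _ i′≤m _ _ _ si≤i′ →
                contradiction (ℕ.≤-trans si≤i′ i′≤m) (ℕ.<⇒≱ sm≤si′)) partial₁
            ; others  = others₁
            ; othersᴷ = othersᴷ₁ })
          where
          sm≤si′ : suc m ≤ suc i
          sm≤si′ = subst₂ _≤_ limit counter sm≤si
          m≤i : m ≤ i
          m≤i = ℕ.s≤s⁻¹ sm≤si′
          bound : 10 + 0 + rowCost i ≤ rowCost (suc i)
          bound rewrite ℕ.m≥n⇒m⊓n≡n m≤i | ℕ.m≥n⇒m⊓n≡n (ℕ.m≤n⇒m≤1+n m≤i) = ℕ.≤-trans
            (ℕ.+-monoˡ-≤ (1 + (18 * i + 13 * (m * (n ⊓ B)))) (ℕ.m≤m+n 10 8))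
            (ℕ.≤-reflexive (solve 2 (λ i x → con 18 :+ (con 1 :+ (con 18 :* i :+ x)) :=
                                             con 1 :+ (con 18 :* (con 1 :+ i) :+ x)) refl i (13 * (m * (n ⊓ B)))))
        decide (fail h si<sm) = proceed {8 + 13 * (n ⊓ B)} bound (enter h
            (scatter-correct (s≤s z≤n) s₁ C₁ atNode counter target choice source k3 partial₁ others₁ othersᴷ₁))
          where
          si≤m : suc i ≤ m
          si≤m = ℕ.s≤s⁻¹ (subst₂ _<_ counter limit si<sm)
          bound : 10 + (8 + 13 * (n ⊓ B)) + rowCost i ≤ rowCost (suc i)
          bound rewrite ℕ.m≤n⇒m⊓n≡m si≤m | ℕ.m≤n⇒m⊓n≡m (ℕ.<⇒≤ si≤m) = ℕ.≤-reflexive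
            (solve 2 (λ i x → con 18 :+ con 13 :* x :+ (con 1 :+ (con 18 :* i :+ con 13 :* (i :* x))) :=
                              con 1 :+ (con 18 :* (con 1 :+ i) :+ con 13 :* ((con 1 :+ i) :* x))) refl i (n ⊓ B))

    -- α is the table of p, n the size of the tree at u and g the cost of a new
    -- block at u.
    record MergeDone (u p : Fin N) (m n : ℕ) (g : Carrier) (s s′ : Store) : Set (a Level.⊔ ℓ₂) where
      field
        {α β}   : ℕ → Carrier
        α≡      : ∀ k → 1 ≤ k → α k ≡ columnᴷ s p k
        β≡      : ∀ k → β k ≡ columnᴷ s u k
        merged  : Merging.Merged K N B α β m n g (columnᴷ s′ p) (λ k → column s′ u (3 + k))
        weight  : columnᴷ s′ p 0 ≡ columnᴷ s p 0 K.+ columnᴷ s u 0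
        size    : column s′ p 2 ≡ column s p 2 + suc (column s u 2)
        others  : ∀ w k → ¬ (w ≡ p × k ≡ 2) → ¬ (w ≡ u × 4 ≤ k) → column s′ w k ≡ column s w k
        othersᴷ : ∀ w k → w ≢ p → columnᴷ s′ w k ≡ columnᴷ s w k

    private
      record Prepared (u p : Fin N) (g : Carrier) (s s₁ : Store) : Set (a Level.⊔ ℓ₂) where
        field
          constants : Constants N B s₁
          child     : reg s₁ 21 ≡ toℕ u
          parent    : reg s₁ 26 ≡ toℕ p
          target    : reg s₁ 27 ≡ cell p B
          choice    : reg s₁ 28 ≡ cell u (3 + B)
          severing  : regᴷ s₁ 2 ≡ g
          same      : ∀ w k → column s₁ w k ≡ column s w k
          weight    : columnᴷ s₁ p 0 ≡ columnᴷ s p 0 K.+ columnᴷ s u 0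
          sameᴷ     : ∀ w k → ¬ (w ≡ p × k ≡ 0) → columnᴷ s₁ w k ≡ columnᴷ s w k

      prepare : List Instr
      prepare = sub 26 22 2 ∷ loadᴷ 0 26 ∷ loadᴷ 1 21 ∷ addᴷ 0 0 1 ∷ storeᴷ 26 0 ∷
                add 28 24 5 ∷ sub 27 24 21 ∷ add 27 26 27 ∷ []

      prepare-correct : ∀ {u p g} s → Constants N B s → reg s 21 ≡ toℕ u → reg s 22 ≡ suc (toℕ p) →
        reg s 24 ≡ cell u B → regᴷ s 2 ≡ g → Prepared u p g s (effects prepare s)
      prepare-correct {u} {p} s C r21 r22 r24 k2 = record
        { constants = constants-kept N B {c = block prepare} (frame block) C
        ; child     = r21
        ; parent    = r26
        ; target    = cong₂ _+_ r26 (trans (cong₂ _∸_ r24 r21) (cell-offset u B))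
        ; choice    = trans (cong₂ _+_ r24 (r5≡3N C)) (trans (cell-+ u B 3) (cong (cell u) (ℕ.+-comm B 3)))
        ; severing  = k2
        ; same      = λ _ _ → refl
        ; weight    = trans (write-same (memᴷ s) p 0 r26′)
                        (cong₂ K._+_ (cong (memᴷ s) r26′) (cong (memᴷ s) (trans r21 (sym (cell-0 u)))))
        ; sameᴷ     = λ w k ne → write-other (memᴷ s) p 0 w k r26′ ne
        }
        where
        r26 : reg s 22 ∸ reg s 2 ≡ toℕ p
        r26 = cong₂ _∸_ r22 (r2≡1 C)
        r26′ : reg s 22 ∸ reg s 2 ≡ cell p 0
        r26′ = trans r26 (sym (cell-0 p))

    merge-correct : ∀ {u p m n g} → u ≢ p → ∀ s → Constants N B s → reg s 21 ≡ toℕ u → reg s 22 ≡ suc (toℕ p) →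
      reg s 24 ≡ cell u B → regᴷ s 2 ≡ g → suc (column s p 2) ≡ m → suc (column s u 2) ≡ n →
      Runs merge s (19 + 18 * B + 13 * ((m ⊓ B) * (n ⊓ B))) (MergeDone u p m n g s)
    merge-correct {u} {p} {m} {n} {g} u≢p s C r21 r22 r24 k2 sizeₚ sizeᵤ = within bound
      (run-block {Q = Prepared u p g s} {is = prepare} (prepare-correct s C r21 r22 r24 k2) then λ {s₁} _ P →
        sized s₁ P)
      where
      b : List Instr
      b = add 30 26 4 ∷ load 31 30 ∷ add 32 21 4 ∷ load 33 32 ∷ add 33 33 2 ∷
          add 34 31 2 ∷ add 34 34 2 ∷ add 35 31 33 ∷ store 30 35 ∷ sub 29 1 3 ∷ []
      bound : 8 + (10 + Merge.rowCost u p u≢p (λ _ → g) m n g (λ _ → 0) (λ _ → g) B) ≤ 19 + 18 * B + 13 * ((m ⊓ B) * (n ⊓ B))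
      bound rewrite ℕ.⊓-comm m B = ℕ.≤-reflexive (solve 2 (λ x y → con 18 :+ (con 1 :+ (x :+ y)) := con 19 :+ x :+ y)
        refl (18 * B) (13 * ((B ⊓ m) * (n ⊓ B))))
      sized : ∀ s₁ → Prepared u p g s s₁ → Runs (block b ⨾ until (29 ≤ℕ 3) row) s₁ _ (MergeDone u p m n g s)
      sized s₁ P = run-block {Q = s₂ ≡_} {is = b} refl then λ { _ refl → yielding finish (rows-correct B s₂ start) }
        where
        open Prepared P
        s₂ : Store
        s₂ = effects b s₁
        open Merge u p u≢p (columnᴷ s₂ p) m n g (mem s₂) (memᴷ s₂)
        r30 : reg s₁ 26 + reg s₁ 4 ≡ cell p 2
        r30 = cong₂ _+_ parent (r4≡2N constants)
        r31 : mem s₁ (reg s₁ 26 + reg s₁ 4) ≡ column s p 2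
        r31 = trans (cong (mem s₁) r30) (same p 2)
        r33 : mem s₁ (reg s₁ 21 + reg s₁ 4) + reg s₁ 2 ≡ suc (column s u 2)
        r33 = trans (cong₂ _+_ (trans (cong (mem s₁) (cong₂ _+_ child (r4≡2N constants))) (same u 2)) (r2≡1 constants))
                (ℕ.+-comm _ 1)
        start : Rows B s₂
        start = record
          { constants = constants-kept N B {c = block b} (frame block) constants
          ; atNode      = child
          ; counter   = cong₂ _∸_ (r1≡B constants) (r3≡0 constants)
          ; target    = target
          ; choice    = choice
          ; source    = trans r33 sizeᵤ
          ; limit     = trans (cong₂ (λ x y → x + y + y) r31 (r2≡1 constants))
                          (trans (ℕ.+-comm _ 1) (cong suc (trans (ℕ.+-comm _ 1) sizeₚ)))
          ; severing  = severing
          ; partial   = Merging.partial-start K N B (columnᴷ s₂ p) β m n g λ _ → refl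
          ; others    = λ _ _ _ → refl
          ; othersᴷ   = λ _ _ _ → refl
          }
        finish : ∀ {s′} → Frame (until (29 ≤ℕ 3) row) s₂ s′ → Rows 0 s′ → MergeDone u p m n g s s′
        finish {s′} _ R = record
          { α≡      = λ k 1≤k → sameᴷ p k λ { (_ , refl) → contradiction 1≤k λ () }
          ; β≡      = λ k → sameᴷ u k (u≢p ∘ proj₁)
          ; merged  = Rows.partial R
          ; weight  = trans (Merging.pristine (Rows.partial R) 0 (s≤s z≤n)) weight
          ; size    = trans (Rows.others R p 2 λ { (_ , s≤s (s≤s ())) })
                        (trans (write-same (mem s₁) p 2 r30) (cong₂ _+_ r31 r33))
          ; others  = λ w k ne ne′ → trans (Rows.others R w k ne′)
                        (trans (write-other (mem s₁) p 2 w k r30 ne) (same w k))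
          ; othersᴷ = λ w k w≢p → trans (Rows.othersᴷ R w k w≢p) (sameᴷ w k (w≢p ∘ proj₁))
          }

  -- Merging trees of x and y nodes takes about (x ⊓ B) * (y ⊓ B) steps beyond a
  -- fixed O(B); these are paid for by the growth of the potential Φ.
  module Potential (B : ℕ) where

    Φ : ℕ → ℕ
    Φ zero    = 0
    Φ (suc n) = Φ n + n ⊓ (B + B)

    -- One more node in the second tree raises the product by `x ⊓ B` if `y < B` and not at all
    -- otherwise. In the first case `(x ⊓ B) + y` stays below `B + B`, which is why the cap in `Φ`
    -- is twice `B`; in the second, monotonicity of the minimum suffices.
    Φ-superadditive : ∀ x y → (x ⊓ B) * (y ⊓ B) + (Φ x + Φ y) ≤ Φ (x + y)
    Φ-superadditive x zero    = ℕ.≤-reflexive (trans (cong (_+ (Φ x + 0)) (ℕ.*-zeroʳ (x ⊓ B)))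
                                  (trans (ℕ.+-identityʳ (Φ x)) (cong Φ (sym (ℕ.+-identityʳ x)))))
    Φ-superadditive x (suc y) = begin
      b * (suc y ⊓ B) + (Φ x + (Φ y + y ⊓ (B + B)))
        ≤⟨ grow (y ℕ.<? B) ⟩
      (b * (y ⊓ B) + (Φ x + Φ y)) + (x + y) ⊓ (B + B)
        ≤⟨ ℕ.+-monoˡ-≤ _ (Φ-superadditive x y) ⟩
      Φ (suc (x + y))                      ≡⟨ cong Φ (ℕ.+-suc x y) ⟨
      Φ (x + suc y)                        ∎
      where
      open ℕ.≤-Reasoning
      b : ℕ
      b = x ⊓ B
      grow : Dec (y < B) → b * (suc y ⊓ B) + (Φ x + (Φ y + y ⊓ (B + B))) ≤
                           (b * (y ⊓ B) + (Φ x + Φ y)) + (x + y) ⊓ (B + B)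
      grow (yes y<B) rewrite ℕ.m≤n⇒m⊓n≡m y<B | ℕ.m≤n⇒m⊓n≡m (ℕ.<⇒≤ y<B) = begin
        b * suc y + (Φ x + (Φ y + y ⊓ (B + B)))
          ≡⟨ solve 5 (λ b y f g h → b :* (con 1 :+ y) :+ (f :+ (g :+ h)) := (b :* y :+ (f :+ g)) :+ (b :+ h))
               refl b y (Φ x) (Φ y) (y ⊓ (B + B)) ⟩
        (b * y + (Φ x + Φ y)) + (b + y ⊓ (B + B))
          ≤⟨ ℕ.+-monoʳ-≤ _ (ℕ.⊓-glb (ℕ.+-mono-≤ (ℕ.m⊓n≤m x B) (ℕ.m⊓n≤m y (B + B)))
               (ℕ.+-mono-≤ (ℕ.m⊓n≤n x B) (ℕ.≤-trans (ℕ.m⊓n≤m y (B + B)) (ℕ.<⇒≤ y<B)))) ⟩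
        (b * y + (Φ x + Φ y)) + (x + y) ⊓ (B + B)   ∎
      grow (no y≮B) rewrite ℕ.m≥n⇒m⊓n≡n (ℕ.≮⇒≥ y≮B) | ℕ.m≥n⇒m⊓n≡n (ℕ.m≤n⇒m≤1+n (ℕ.≮⇒≥ y≮B)) = begin
        b * B + (Φ x + (Φ y + y ⊓ (B + B)))
          ≡⟨ solve 4 (λ c f g h → c :+ (f :+ (g :+ h)) := (c :+ (f :+ g)) :+ h) refl (b * B) (Φ x) (Φ y) _ ⟩
        (b * B + (Φ x + Φ y)) + y ⊓ (B + B)
          ≤⟨ ℕ.+-monoʳ-≤ _ (ℕ.⊓-monoˡ-≤ (B + B) (ℕ.m≤n+m y x)) ⟩
        (b * B + (Φ x + Φ y)) + (x + y) ⊓ (B + B)   ∎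

    Φ-linear : ∀ n → Φ n ≤ n * (B + B)
    Φ-linear zero    = z≤n
    Φ-linear (suc n) = ℕ.≤-trans (ℕ.+-mono-≤ (Φ-linear n) (ℕ.m⊓n≤n n (B + B)))
                                 (ℕ.≤-reflexive (ℕ.+-comm (n * (B + B)) (B + B)))

  -- Amortised cost of all merges

  module TabulationCost {N : ℕ} (B : ℕ) (T : RootedTree N) where
    open RootedTree T
    open Order T
    open Potential B
    open ListSum ℕ.+-0-commutativeMonoid
    open Additive ℕ.+-0-commutativeMonoid using (total-stage)

    pending : List (Fin N) → List (Fin N) → ℕ
    pending rs = total (Φ ∘ treeSize ∘ stage rs)

    -- Superadditivity gathers the pending trees into one, and their sizes add up to the number of
    -- listed nodes because merging preserves the total size.
    pending≤ : ∀ rs {x xs} → Topo (rs ʳ++ (x ∷ xs)) → pending rs (x ∷ xs) ≤ Φ (length (rs ʳ++ (x ∷ xs)))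
    pending≤ rs {x} {xs} t = ℕ.≤-trans (sum≤ (x ∷ xs)) (ℕ.≤-reflexive (cong Φ
      (trans (total-stage {F = treeSize} (λ _ _ _ → refl) rs t) (ones (rs ʳ++ (x ∷ xs))))))
      where
      size : Fin N → ℕ
      size = treeSize ∘ stage rs
      sum≤ : ∀ ys → total (Φ ∘ size) ys ≤ Φ (total size ys)
      sum≤ []       = z≤n
      sum≤ (y ∷ ys) = ℕ.≤-trans (ℕ.+-monoʳ-≤ (Φ (size y)) (sum≤ ys))
        (ℕ.≤-trans (ℕ.m≤n+m _ ((size y ⊓ B) * (total size ys ⊓ B))) (Φ-superadditive (size y) (total size ys)))
      ones : ∀ ys → total (λ _ → 1) ys ≡ length {A = Fin N} ys
      ones []       = refl
      ones (y ∷ ys) = cong suc (ones ys)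

    -- The term of `c` disappears while that of `p` grows to `Φ (sp + sc)`; the surplus covers the
    -- product. The growth is written as a difference to fit `total-update`.
    pending-step : ∀ rs {c p xs} → Topo xs → p ∈ xs → parent c ≡ just p →
      (treeSize (stage rs p) ⊓ B) * (treeSize (stage rs c) ⊓ B) + pending rs (c ∷ xs) ≤ pending (c ∷ rs) xs
    pending-step rs {c} {p} {xs} t p∈ e = begin
      m + (Φ sc + total f xs)            ≡⟨ ℕ.+-assoc m (Φ sc) _ ⟨
      (m + Φ sc) + total f xs            ≤⟨ ℕ.+-monoˡ-≤ (total f xs) (ℕ.m+n≤o⇒m≤o∸n (m + Φ sc) (ℕ.≤-trans
                                              (ℕ.≤-reflexive (trans (ℕ.+-assoc m (Φ sc) (Φ sp)) (cong (m +_) (ℕ.+-comm (Φ sc) (Φ sp)))))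
                                              (Φ-superadditive sp sc))) ⟩
      (Φ (sp + sc) ∸ Φ sp) + total f xs  ≡⟨ total-update (Φ (sp + sc) ∸ Φ sp) (topo-unique t) p∈ grown same ⟨
      total h xs                         ∎
      where
      open ℕ.≤-Reasoning
      f h : Fin N → ℕ
      f = Φ ∘ treeSize ∘ stage rs
      h = Φ ∘ treeSize ∘ stage (c ∷ rs)
      sp sc m : ℕ
      sp = treeSize (stage rs p)
      sc = treeSize (stage rs c)
      m  = (sp ⊓ B) * (sc ⊓ B)
      Φ-mono : Φ sp ≤ Φ (sp + sc)
      Φ-mono = ℕ.≤-trans (ℕ.m≤m+n (Φ sp) (Φ sc)) (ℕ.≤-trans (ℕ.m≤n+m _ m) (Φ-superadditive sp sc))
      grown : h p ≡ Φ sp + (Φ (sp + sc) ∸ Φ sp)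
      grown = trans (cong (Φ ∘ treeSize) (stage-parent rs e)) (sym (ℕ.m+[n∸m]≡n Φ-mono))
      same : ∀ z → z ≢ p → h z ≡ f z
      same z z≢p = cong (Φ ∘ treeSize) (stage-other rs λ e′ → z≢p (Maybe.just-injective (trans (sym e′) e)))

    processed-∉ : ∀ rs {xs d} → Topo (rs ʳ++ xs) → d ∈ rs → d ∉ xs
    processed-∉ (e ∷ rs) t (there d∈)  = processed-∉ rs t d∈ ∘ there
    processed-∉ (e ∷ rs) t (here refl) e∈ with topo-unique (topo-suffix rs t)
    ... | e∉ ∷ _ = All.lookup e∉ e∈ refl

  -- Correctness and running time of the table computation

  module Tabulation {a ℓ₁ ℓ₂} (K : OrderedField a ℓ₁ ℓ₂) {N : ℕ} (B : ℕ) (1≤B : 1 ≤ B)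
                    (T : RootedTree N) (D : LeafDistribution K T) where
    open RootedTree T
    open LeafDistribution D using (prob; nonNegative)
    open Structured K
    open Tests K
    open Order T
    open Cells {N}
    open Potential B
    open TabulationCost B T
    open Ordering K B T using (Parents; next)
    open TableSteps K {N} B 1≤B
    open Partitions K B prob nonNegative using (weight)
    open Tables K B prob nonNegative
    private module K = OrderedField K

    -- Membership in `rs` confines the plans to finished nodes, whose recorded choices no later
    -- merge overwrites.
    Choice : List (Fin N) → (ℕ → ℕ) → Fin N → ℕ → ℕ → Set
    Choice rs m c k j = c ∈ rs × 1 ≤ k × m (cell c (3 + k)) ≡ j * N

    Best : List (Fin N) → (ℕ → ℕ) → Fin N → ℕ → Set
    Best rs m c j = c ∈ rs × m (cell c 3) ≡ j * N

    record Pending (rs xs : List (Fin N)) (s : Store) : Set (a Level.⊔ ℓ₂) where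
      field
        constants : Constants N B s
        parents   : Parents s
        {first}   : ℕ
        remaining : Linked (next s) first xs 1
        finished  : Linked (next s) (reg s 20) rs 0
        sizes     : ∀ {v} → v ∈ xs → suc (column s v 2) ≡ treeSize (stage rs v)
        weights   : ∀ {v} → v ∈ xs → columnᴷ s v 0 ≡ weight (stage rs v)
        complete  : ∀ {v} → v ∈ xs → Complete (stage rs v) (columnᴷ s v)
        sound     : ∀ {v} → v ∈ xs → Sound (Choice rs (mem s)) (Best rs (mem s)) (stage rs v) (columnᴷ s v)

    pending-select : ∀ {rs x xs s s′} → Topo (rs ʳ++ (x ∷ xs)) → Frame select s s′ →
      (∀ w k → ¬ (w ≡ x × k ≡ 3) → column s′ w k ≡ column s w k) →
      Pending rs (x ∷ xs) s → Pending rs (x ∷ xs) s′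
    pending-select {rs} {x} {xs} {s} {s′} t f other P = record
      { constants = constants-kept N B {c = select} f constants
      ; parents   = λ v → trans (other v 0 λ ()) (parents v)
      ; remaining = linked-cong (x ∷ xs) (λ {v} _ → sym (other v 1 λ ())) remaining
      ; finished  = subst (λ q → Linked (next s′) q rs 0) (sym (reg-kept f 20))
                      (linked-cong rs (λ {v} _ → sym (other v 1 λ ())) finished)
      ; sizes     = λ {v} v∈ → trans (cong suc (other v 2 λ ())) (sizes v∈)
      ; weights   = λ {v} v∈ → trans (cong (_$ cell v 0) (memᴷ-kept f)) (weights v∈)
      ; complete  = λ {v} v∈ → complete-cong (λ k _ → cong (_$ cell v k) (memᴷ-kept f)) (complete v∈)
      ; sound     = λ {v} v∈ → sound-cong (λ k _ → cong (_$ cell v k) (memᴷ-kept f))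
                      (sound-map (λ { c (suc k) j (c∈ , 1≤k , e) → c∈ , 1≤k , trans (other c (3 + suc k) λ ()) e })
                                 (λ c j (c∈ , e) → c∈ , trans (other c 3 λ { (refl , _) → processed-∉ rs t c∈ (here refl) }) e)
                                 (sound v∈))
      }
      where open Pending P

    pending-merge : ∀ {rs c p x xs s s₁} → Topo (rs ʳ++ (c ∷ x ∷ xs)) → parent c ≡ just p → p ∈ x ∷ xs →
      Pending rs (c ∷ x ∷ xs) s → (S : Selected c s) → reg s 21 ≡ toℕ c → Frame merge s s₁ →
      MergeDone c p (treeSize (stage rs p)) (treeSize (stage rs c))
        (columnᴷ s c (Selected.kb S) K.+ weight (stage rs c)) s s₁ →
      Runs advance s₁ 5 (λ s₂ → reg s₂ 21 ≡ toℕ x × Pending (c ∷ rs) (x ∷ xs) s₂)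
    pending-merge {rs} {c} {p} {x} {xs} {s} {s₁} t e p∈ P S r21 f M =
      run-block {is = b} (r21′ , record
        { constants = constants-kept N B {c = block b} (frame block) C₁
        ; parents   = λ v → trans (other v 0 (λ ()) (λ ()) (λ { (_ , ()) })) (parents v)
        ; remaining = linked-cong (x ∷ xs) (λ {v} v∈ → sym (next-other {v} λ { refl → c∉ v∈ })) (proj₂ remaining)
        ; finished  = trans (cong₂ _+_ r21₁ (r2≡1 C₁)) (ℕ.+-comm (toℕ c) 1) ,
                      subst (λ q → Linked (next s₂) q rs 0) (sym (trans next-c (reg-kept f 20)))
                        (linked-cong rs (λ {v} v∈ → sym (next-other {v} λ { refl → c∉rs v∈ })) finished)
        ; sizes     = sizes′
        ; weights   = weights′
        ; complete  = complete′
        ; sound     = sound′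
        })
      where
      open Pending P
      open Selected S using (kb; 1≤kb; kb≤B; least; recorded)
      b : List Instr
      b = add 42 21 0 ∷ load 43 42 ∷ store 42 20 ∷ add 20 21 2 ∷ sub 21 43 2 ∷ []
      s₂ : Store
      s₂ = effects b s₁
      C₁ : Constants N B s₁
      C₁ = constants-kept N B {c = merge} f constants
      c∉ : c ∉ x ∷ xs
      c∉ = processed-∉ (c ∷ rs) t (here refl)
      c∉rs : c ∉ rs
      c∉rs c∈ = processed-∉ rs t c∈ (here refl)
      r21₁ : reg s₁ 21 ≡ toℕ c
      r21₁ = trans (reg-kept f 21) r21
      r42 : reg s₁ 21 + reg s₁ 0 ≡ cell c 1
      r42 = trans (cong₂ _+_ r21₁ (r0≡N C₁)) (cell-1 c)
      r21′ : mem s₁ (reg s₁ 21 + reg s₁ 0) ∸ reg s₁ 2 ≡ toℕ x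
      r21′ = cong₂ _∸_ (trans (cong (mem s₁) r42)
        (trans (MergeDone.others M c 1 (λ ()) (λ { (_ , s≤s ()) })) (proj₁ (proj₂ remaining)))) (r2≡1 C₁)
      next-c : next s₂ c ≡ reg s₁ 20
      next-c = write-same (mem s₁) c 1 r42
      other : ∀ w k → ¬ (w ≡ c × k ≡ 1) → ¬ (w ≡ p × k ≡ 2) → ¬ (w ≡ c × 4 ≤ k) → column s₂ w k ≡ column s w k
      other w k ne ne′ ne″ = trans (write-other (mem s₁) c 1 w k r42 ne) (MergeDone.others M w k ne′ ne″)
      next-other : ∀ {v} → v ≢ c → next s₂ v ≡ next s v
      next-other {v} v≢c = other v 1 (v≢c ∘ proj₁) (λ ()) (λ { (_ , s≤s ()) })
      unmerged : ∀ {v} → v ≢ p → stage (c ∷ rs) v ≡ stage rs v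
      unmerged v≢p = stage-other rs λ e′ → v≢p (Maybe.just-injective (trans (sym e′) e))

      sizes′ : ∀ {v} → v ∈ x ∷ xs → suc (column s₂ v 2) ≡ treeSize (stage (c ∷ rs) v)
      sizes′ {v} v∈ with v Fin.≟ p
      ... | yes refl = begin
        suc (column s₂ p 2)                          ≡⟨ cong suc (write-other (mem s₁) c 1 p 2 r42 λ ()) ⟩
        suc (column s₁ p 2)                          ≡⟨ cong suc (MergeDone.size M) ⟩
        suc (column s p 2) + suc (column s c 2)      ≡⟨ cong₂ _+_ (sizes (there v∈)) (sizes (here refl)) ⟩
        treeSize (stage rs p ◂ stage rs c)           ≡⟨ cong treeSize (stage-parent rs e) ⟨
        treeSize (stage (c ∷ rs) p)                  ∎
        where open ≡-Reasoning
      ... | no v≢p = trans (cong suc (other v 2 (λ ()) (v≢p ∘ proj₁) (λ { (_ , s≤s (s≤s ())) })))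
                       (trans (sizes (there v∈)) (cong treeSize (sym (unmerged v≢p))))

      weights′ : ∀ {v} → v ∈ x ∷ xs → columnᴷ s₂ v 0 ≡ weight (stage (c ∷ rs) v)
      weights′ {v} v∈ with v Fin.≟ p
      ... | yes refl = trans (MergeDone.weight M) (trans (cong₂ K._+_ (weights (there v∈)) (weights (here refl)))
                         (cong weight (sym (stage-parent rs e))))
      ... | no v≢p   = trans (MergeDone.othersᴷ M v 0 v≢p) (trans (weights (there v∈)) (cong weight (sym (unmerged v≢p))))

      g≡ : columnᴷ s c kb K.+ weight (stage rs c) ≡ MergeDone.β M kb K.+ weight (stage rs c)
      g≡ = cong (K._+ weight (stage rs c)) (sym (MergeDone.β≡ M kb))

      complete′ : ∀ {v} → v ∈ x ∷ xs → Complete (stage (c ∷ rs) v) (columnᴷ s₂ v)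
      complete′ {v} v∈ with v Fin.≟ p
      ... | yes refl = subst (λ t → Complete t (columnᴷ s₁ p)) (sym (stage-parent rs e))
        (complete-merge 1≤kb kb≤B g≡ (complete-cong (MergeDone.α≡ M) (complete (there v∈)))
          (complete-cong (λ k _ → MergeDone.β≡ M k) (complete (here refl)))
          (λ j 1≤j j≤B → subst₂ K._≤_ (sym (MergeDone.β≡ M kb)) (sym (MergeDone.β≡ M j)) (least j 1≤j j≤B)) (MergeDone.merged M))
      ... | no v≢p = subst (λ t → Complete t (columnᴷ s₂ v)) (sym (unmerged v≢p))
        (complete-cong (λ k _ → MergeDone.othersᴷ M v k v≢p) (complete (there v∈)))

      Choice′ : Fin N → ℕ → ℕ → Set
      Choice′ = Choice (c ∷ rs) (mem s₂)
      Best′ : Fin N → ℕ → Set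
      Best′ = Best (c ∷ rs) (mem s₂)
      keep-sound : ∀ {t α} → Sound (Choice rs (mem s)) (Best rs (mem s)) t α → Sound Choice′ Best′ t α
      keep-sound = sound-map
        (λ { d k@(suc _) j (d∈ , 1≤k , e) → there d∈ , 1≤k ,
             trans (other d (3 + k) (λ ()) (λ ()) (λ { (refl , _) → c∉rs d∈ })) e })
        (λ { d j (d∈ , e) → there d∈ , trans (other d 3 (λ ()) (λ ()) (λ { (refl , _) → c∉rs d∈ })) e })

      sound′ : ∀ {v} → v ∈ x ∷ xs → Sound Choice′ Best′ (stage (c ∷ rs) v) (columnᴷ s₂ v)
      sound′ {v} v∈ with v Fin.≟ p
      ... | yes refl = subst (λ t → Sound Choice′ Best′ t (columnᴷ s₁ p)) (sym (stage-parent rs e))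
        (sound-merge 1≤kb kb≤B g≡ (sound-cong (MergeDone.α≡ M) (keep-sound (sound (there v∈))))
          (sound-cong (λ k _ → MergeDone.β≡ M k) (keep-sound (sound (here refl))))
          (subst (λ d → Best′ d kb) (sym (rootOf-stage rs c))
            (here refl , trans (other c 3 (λ ()) (λ ()) (λ { (_ , s≤s (s≤s (s≤s ()))) })) recorded))
          (λ k j 1≤k _ e → subst (λ d → Choice′ d k j) (sym (rootOf-stage rs c))
            (here refl , 1≤k , trans (write-other (mem s₁) c 1 c (3 + k) r42 λ ()) e))
          (MergeDone.merged M))
      ... | no v≢p = subst (λ t → Sound Choice′ Best′ t (columnᴷ s₂ v)) (sym (unmerged v≢p))
        (sound-cong (λ k _ → MergeDone.othersᴷ M v k v≢p) (keep-sound (sound (there v∈))))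

    record Current (rs xs : List (Fin N)) (c : Fin N) (s : Store) : Set (a Level.⊔ ℓ₂) where
      field
        pendingAt : Pending rs (c ∷ xs) s
        selected  : Selected c s
        atNode    : reg s 21 ≡ toℕ c
        above     : reg s 22 ≡ encodeParent (parent c)

    select-current : ∀ {rs x xs} → Topo (rs ʳ++ (x ∷ xs)) → ∀ s → Pending rs (x ∷ xs) s → reg s 21 ≡ toℕ x →
      Runs (select ⨾ block (load 22 21 ∷ [])) s (10 + 8 * B) (Current rs xs x)
    select-current {rs} {x} {xs} t s P r21 = within (ℕ.≤-reflexive (ℕ.+-comm (9 + 8 * B) 1))
      (select-correct s (Pending.constants P) r21 then λ {s₁} f (S , other) →
        let P′ = pending-select t f other P
            r21′ = trans (reg-kept f 21) r21
        in run-block {is = load 22 21 ∷ []} record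
          { pendingAt = record
              { constants = constants-kept N B {c = block (load 22 21 ∷ [])} (frame block) (Pending.constants P′)
              ; parents   = Pending.parents P′
              ; remaining = Pending.remaining P′
              ; finished  = Pending.finished P′
              ; sizes     = Pending.sizes P′
              ; weights   = Pending.weights P′
              ; complete  = Pending.complete P′
              ; sound     = Pending.sound P′ }
          ; selected  = record
              { 1≤kb = Selected.1≤kb S ; kb≤B = Selected.kb≤B S ; least = Selected.least S
              ; value = Selected.value S ; address = Selected.address S ; recorded = Selected.recorded S }
          ; atNode    = r21′
          ; above     = trans (cong (mem s₁) (trans r21′ (sym (cell-0 x)))) (Pending.parents P′ x)
          })

    mergeNext : Cmd
    mergeNext = merge ⨾ advance ⨾ select ⨾ block (load 22 21 ∷ [])

    mergeNext-correct : ∀ {rs c p x xs} → Topo (rs ʳ++ (c ∷ x ∷ xs)) → parent c ≡ just p → p ∈ x ∷ xs → ∀ s →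
      Current rs (x ∷ xs) c s →
      Runs mergeNext s (34 + 26 * B + 13 * ((treeSize (stage rs p) ⊓ B) * (treeSize (stage rs c) ⊓ B)))
           (Current (c ∷ rs) xs x)
    mergeNext-correct {rs} {c} {p} {x} {xs} t e p∈ s C = within
      (ℕ.≤-reflexive (solve 2 (λ b m → ((con 19 :+ con 18 :* b) :+ con 13 :* m) :+ (con 5 :+ (con 10 :+ con 8 :* b)) :=
                                       (con 34 :+ con 26 :* b) :+ con 13 :* m) refl B ((treeSize (stage rs p) ⊓ B) * (treeSize (stage rs c) ⊓ B))))
      (merge-correct c≢p s constants atNode (trans above (cong encodeParent e)) (Selected.address selected)
          (trans (Selected.value selected) (cong (columnᴷ s c (Selected.kb selected) K.+_) (weights (here refl))))
          (sizes (there p∈)) (sizes (here refl)) then λ f M →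
        pending-merge t e p∈ pendingAt selected atNode f M then λ {s₂} _ (r21 , P) →
          select-current t s₂ P r21)
      where
      open Current C
      open Pending pendingAt
      c≢p : c ≢ p
      c≢p refl = processed-∉ (c ∷ rs) t (here refl) p∈

    -- Time for the remaining work: a fixed amount for each node left, and 13 steps for each unit by
    -- which the potential can still grow towards `F`.
    loopCost : List (Fin N) → List (Fin N) → ℕ → ℕ
    loopCost rs xs F = 1 + (36 + 26 * B) * length xs + 13 * (F ∸ pending rs xs)

    tabulationLoop-correct : ∀ {rs c xs order} → rs ʳ++ (c ∷ xs) ≡ order → Topo order → ∀ s → Current rs xs c s →
      Runs (until (22 ≤ℕ 3) mergeNext) s (loopCost rs (c ∷ xs) (Φ (length order)))
           (λ s′ → ∃₂ λ rs′ r → rs′ ʳ++ (r ∷ []) ≡ order × Current rs′ [] r s′)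
    tabulationLoop-correct {rs} {c} {xs} refl t s C = go xs t C (topo-suffix rs t)
      where
      go : ∀ xs → Topo (rs ʳ++ (c ∷ xs)) → Current rs xs c s → Topo (c ∷ xs) →
           Runs (until (22 ≤ℕ 3) mergeNext) s (loopCost rs (c ∷ xs) (Φ (length (rs ʳ++ (c ∷ xs)))))
                (λ s′ → ∃₂ λ rs′ r → rs′ ʳ++ (r ∷ []) ≡ rs ʳ++ (c ∷ xs) × Current rs′ [] r s′)
      go [] t C (single e) = within (s≤s z≤n)
        (stop (holds-≤ {s} {22} {3} (ℕ.≤-trans (ℕ.≤-reflexive (trans above (cong encodeParent e))) z≤n))
              (rs , c , refl , C))
        where open Current C
      go (x ∷ xs) t C (cons {p = p} e p∈ _ t′) = within bound
        (iterate (holds-> {s} {22} {3} (subst₂ _<_ (sym (r3≡0 (Pending.constants pendingAt)))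
            (sym (trans above (cong encodeParent e))) (s≤s z≤n)))
          (mergeNext-correct t e p∈ s C)
          λ {s′} _ C′ → tabulationLoop-correct {c ∷ rs} {x} {xs} refl t s′ C′)
        where
        open Current C
        m F P P′ n : ℕ
        m  = (treeSize (stage rs p) ⊓ B) * (treeSize (stage rs c) ⊓ B)
        F  = Φ (length (rs ʳ++ (c ∷ x ∷ xs)))
        P  = pending rs (c ∷ x ∷ xs)
        P′ = pending (c ∷ rs) (x ∷ xs)
        n  = length (x ∷ xs)
        credit : m + (F ∸ P′) ≤ F ∸ P
        credit = begin
          m + (F ∸ P′)           ≡⟨ ℕ.+-∸-assoc m (pending≤ (c ∷ rs) t) ⟨
          (m + F) ∸ P′           ≤⟨ ℕ.∸-monoʳ-≤ (m + F) (pending-step rs t′ p∈ e) ⟩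
          (m + F) ∸ (m + P)      ≡⟨ ℕ.[m+n]∸[m+o]≡n∸o m F P ⟩
          F ∸ P                  ∎
          where open ℕ.≤-Reasoning
        bound : 2 + ((34 + 26 * B + 13 * m) + loopCost (c ∷ rs) (x ∷ xs) F) ≤ loopCost rs (c ∷ x ∷ xs) F
        bound = begin
          2 + ((34 + 26 * B + 13 * m) + (1 + (36 + 26 * B) * n + 13 * (F ∸ P′)))
            ≡⟨ solve 4 (λ b m n y → con 2 :+ ((con 34 :+ con 26 :* b :+ con 13 :* m) :+
                                      (con 1 :+ (con 36 :+ con 26 :* b) :* n :+ con 13 :* y)) :=
                        con 1 :+ (con 36 :+ con 26 :* b) :* (con 1 :+ n) :+ con 13 :* (m :+ y)) refl B m n (F ∸ P′) ⟩
          1 + (36 + 26 * B) * suc n + 13 * (m + (F ∸ P′))   ≤⟨ ℕ.+-monoʳ-≤ (1 + (36 + 26 * B) * suc n) (ℕ.*-monoʳ-≤ 13 credit) ⟩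
          1 + (36 + 26 * B) * suc n + 13 * (F ∸ P)          ∎
          where open ℕ.≤-Reasoning

    tabulation-correct : ∀ {order} → (∀ v → v ∈ order) → Topo order → ∀ s → Constants N B s → Parents s →
      Linked (next s) (reg s 11) order 1 → reg s 20 ≡ 0 → (∀ v → column s v 2 ≡ 0) →
      (∀ v → columnᴷ s v 0 ≡ prob v) → (∀ v k → 1 ≤ k → columnᴷ s v k ≡ K.0#) →
      Runs tabulation s (12 + 8 * B + (36 + 26 * B) * length order + 13 * Φ (length order))
           (λ s′ → ∃₂ λ rs r → rs ʳ++ (r ∷ []) ≡ order × Current rs [] r s′)
    tabulation-correct {[]} all _ _ _ _ _ _ _ _ _ with () ← all root
    tabulation-correct {c ∷ xs} all t s C parents linked r20 blank probs zeros = within bound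
      (run-block {Q = s₁ ≡_} {is = sub 21 11 2 ∷ []} refl then λ { _ refl → regroup
        (select-current {[]} t s₁ start (cong₂ _∸_ (proj₁ linked) (r2≡1 C)))
        λ {s₂} C′ → tabulationLoop-correct {[]} refl t s₂ C′ })
      where
      regroup : ∀ {b b′ s} → Runs (select ⨾ block (load 22 21 ∷ [])) s b (Current [] xs c) →
                (∀ {s′} → Current [] xs c s′ → Runs (until (22 ≤ℕ 3) mergeNext) s′ b′
                   (λ s′ → ∃₂ λ rs r → rs ʳ++ (r ∷ []) ≡ c ∷ xs × Current rs [] r s′)) →
                Runs (select ⨾ block (load 22 21 ∷ []) ⨾ until (22 ≤ℕ 3) mergeNext) s (b + b′)
                   (λ s′ → ∃₂ λ rs r → rs ʳ++ (r ∷ []) ≡ c ∷ xs × Current rs [] r s′)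
      regroup (_ , s₁ , (_⨾_ {t = t₁} x y) , t≤ , q) k with t₂ , s₂ , z , t₂≤ , q′ ← k q =
        _ , s₂ , (x ⨾ y ⨾ z) , ℕ.≤-trans (ℕ.≤-reflexive (sym (ℕ.+-assoc t₁ _ t₂))) (ℕ.+-mono-≤ t≤ t₂≤) , q′
      s₁ : Store
      s₁ = effects (sub 21 11 2 ∷ []) s
      -- Blank memory already describes single nodes: sizes are stored less one, and all costs are
      -- 0.
      start : Pending [] (c ∷ xs) s₁
      start = record
        { constants = constants-kept N B {c = block (sub 21 11 2 ∷ [])} (frame block) C
        ; parents   = parents
        ; remaining = linked
        ; finished  = r20
        ; sizes     = λ {v} _ → cong suc (blank v)
        ; weights   = λ {v} _ → probs v
        ; complete  = λ {v} _ → complete-node (zeros v)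
        ; sound     = λ {v} _ → sound-node (zeros v)
        }
      bound : 1 + ((10 + 8 * B) + loopCost [] (c ∷ xs) (Φ (length (c ∷ xs)))) ≤
              12 + 8 * B + (36 + 26 * B) * length (c ∷ xs) + 13 * Φ (length (c ∷ xs))
      bound = ℕ.≤-trans
        (ℕ.≤-reflexive (solve 3 (λ b x y → con 1 :+ ((con 10 :+ con 8 :* b) :+ (con 1 :+ x :+ y)) :=
                                           con 12 :+ con 8 :* b :+ x :+ y) refl B ((36 + 26 * B) * length (c ∷ xs))
                             (13 * (Φ (length (c ∷ xs)) ∸ pending [] (c ∷ xs)))))
        (ℕ.+-monoʳ-≤ (12 + 8 * B + (36 + 26 * B) * length (c ∷ xs)) (ℕ.*-monoʳ-≤ 13 (ℕ.m∸n≤m (Φ (length (c ∷ xs))) (pending [] (c ∷ xs)))))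

  -- Reading the labels back from the recorded choices

  module LabelPhase {a ℓ₁ ℓ₂} (K : OrderedField a ℓ₁ ℓ₂) {N : ℕ} (B : ℕ) (1≤B : 1 ≤ B)
                   (T : RootedTree N) (D : LeafDistribution K T)
                   (recorded : List (Fin N)) (m₀ : ℕ → ℕ) where
    open RootedTree T
    open LeafDistribution D using (prob; nonNegative)
    open Structured K
    open Tests K
    open Order T
    open Cells {N}
    open TabulationCost B T using (processed-∉)
    open Ordering K B T using (next)
    open TableSteps K {N} B 1≤B using (column)
    open Partitions K B prob nonNegative
    open Tabulation K B 1≤B T D using (Choice; Best)
    open Recorded (Choice recorded m₀) (Best recorded m₀)

    labels : Store → Fin N → ℕ
    labels s v = column s v 0

    -- Rooms are overwritten as labelling proceeds, choices are not; the plans therefore refer to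
    -- the fixed memory `m₀`.
    record Unlabelled (rs : List (Fin N)) (s : Store) : Set a where
      field
        constants : Constants N B s
        linked    : Linked (next s) (reg s 20) rs 0
        parents   : ∀ {c} → c ∈ rs → column s c 0 ≡ encodeParent (parent c)
        rooms     : ∀ {c} → c ∈ rs → column s c 3 ≡ m₀ (cell c 3)
        choices   : ∀ c k → 1 ≤ k → column s c (3 + k) ≡ m₀ (cell c (3 + k))

    -- Recorded plans are determined by the memory, hence the quantification over π.
    Follows : (rs xs : List (Fin N)) (s s′ : Store) → Set
    Follows rs xs s s′ = ∀ v k → v ∈ xs → column s v 3 ≡ k * N → (π : Plan (stage rs v) k) →
                         Labels (labels s′) π (labels s v)

    private
      labels-subst : ∀ {t t′ k ℓ b} → t ≡ t′ → (∀ (π : Plan t′ k) → Labels ℓ π b) → ∀ (π : Plan t k) → Labels ℓ π b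
      labels-subst refl h = h

      labels-cong : ∀ {t k ℓ b b′} (π : Plan t k) → b ≡ b′ → Labels ℓ π b → Labels ℓ π b′
      labels-cong π refl l = l

      N≢0 : 1 ≤ N
      N≢0 = ℕ.≤-trans (s≤s z≤n) (Fin.toℕ<n root)

    record Assigned (c p : Fin N) (rs : List (Fin N)) (s s′ : Store) : Set a where
      field
        unlabelled : Unlabelled rs s′
        others     : ∀ v k → v ≢ c → ¬ (v ≡ p × k ≡ 3) → column s′ v k ≡ column s v k
        outcome    : (mem s (cell c 3 + column s p 3) ≡ 0 ×
                      column s′ c 0 ≡ toℕ c × column s′ c 3 ≡ column s c 3 × column s′ p 3 ≡ column s p 3) ⊎
                     (1 ≤ mem s (cell c 3 + column s p 3) ×
                      column s′ c 0 ≡ column s p 0 × column s′ c 3 ≡ mem s (cell c 3 + column s p 3) ×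
                      column s′ p 3 ≡ column s p 3 ∸ mem s (cell c 3 + column s p 3))

    assign-correct : ∀ {c p rs} → c ∉ rs → p ∉ rs → parent c ≡ just p → c ≢ p → ∀ s → Unlabelled (c ∷ rs) s →
                     Runs assign s 17 (Assigned c p rs s)
    assign-correct {c} {p} {rs} c∉ p∉ e c≢p s U =
      run-block {Q = Read} {is = b₁} read then λ { {s₁} _ R → run-block {Q = Fetched s₁} {is = b₂} (fetch s₁ R) then λ {s₂} _ →
        branch s₁ s₂ R }
      where
      open Unlabelled U
      b₁ b₂ b₃ : List Instr
      b₁ = sub 50 20 2 ∷ load 51 50 ∷ sub 51 51 2 ∷ add 52 51 5 ∷ load 53 52 ∷ []
      b₂ = add 54 50 5 ∷ add 55 54 53 ∷ load 55 55 ∷ add 56 50 0 ∷ load 20 56 ∷ store 50 50 ∷ []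
      b₃ = load 57 51 ∷ store 50 57 ∷ store 54 55 ∷ sub 53 53 55 ∷ store 52 53 ∷ []

      j : ℕ
      j = mem s (cell c 3 + column s p 3)

      record Read (s₁ : Store) : Set a where
        field
          constants₁ : Constants N B s₁
          child      : reg s₁ 50 ≡ toℕ c
          parent₁    : reg s₁ 51 ≡ toℕ p
          parentRoom : reg s₁ 52 ≡ cell p 3
          room       : reg s₁ 53 ≡ column s p 3
          same       : mem s₁ ≡ mem s
      read : Read (effects b₁ s)
      read = record
        { constants₁ = constants-kept N B {c = block b₁} (frame block) constants
        ; child = r50 ; parent₁ = r51 ; parentRoom = r52 ; room = cong (mem s) r52 ; same = refl }
        where
        r50 : reg s 20 ∸ reg s 2 ≡ toℕ c
        r50 = cong₂ _∸_ (proj₁ linked) (r2≡1 constants)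
        r51 : mem s (reg s 20 ∸ reg s 2) ∸ reg s 2 ≡ toℕ p
        r51 = cong₂ _∸_ (trans (cong (mem s) (trans r50 (sym (cell-0 c))))
                          (trans (parents (here refl)) (cong encodeParent e))) (r2≡1 constants)
        r52 : reg (effects b₁ s) 52 ≡ cell p 3
        r52 = cong₂ _+_ r51 (r5≡3N constants)

      record Fetched (s₁ s₂ : Store) : Set a where
        field
          constants₂ : Constants N B s₂
          child      : reg s₂ 50 ≡ cell c 0
          parent₂    : reg s₂ 51 ≡ cell p 0
          parentRoom : reg s₂ 52 ≡ cell p 3
          room       : reg s₂ 53 ≡ column s p 3
          childRoom  : reg s₂ 54 ≡ cell c 3
          choice     : reg s₂ 55 ≡ j
          rest       : Linked (next s₂) (reg s₂ 20) rs 0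
          own        : column s₂ c 0 ≡ toℕ c
          others     : ∀ v k → ¬ (v ≡ c × k ≡ 0) → column s₂ v k ≡ column s v k
      fetch : ∀ s₁ → Read s₁ → Fetched s₁ (effects b₂ s₁)
      fetch s₁ R = record
        { constants₂ = constants-kept N B {c = block b₂} (frame block) constants₁
        ; child      = r50
        ; parent₂    = trans parent₁ (sym (cell-0 p))
        ; parentRoom = parentRoom
        ; room       = room
        ; childRoom  = r54
        ; choice     = trans (cong (mem s₁) (cong₂ _+_ r54 room)) (cong (_$ (cell c 3 + column s p 3)) same)
        ; rest       = subst (λ q → Linked (next s₂) q rs 0)
                         (sym (trans (cong (mem s₁) (trans (cong₂ _+_ child (r0≡N constants₁)) (cell-1 c))) (cong (_$ cell c 1) same)))
                         (linked-cong rs (λ {v} _ → sym (other v 1 λ ())) (proj₂ linked))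
        ; own        = trans (write-same (mem s₁) c 0 r50) child
        ; others     = other
        }
        where
        open Read R
        s₂ : Store
        s₂ = effects b₂ s₁
        r50 : reg s₁ 50 ≡ cell c 0
        r50 = trans child (sym (cell-0 c))
        r54 : reg s₁ 50 + reg s₁ 5 ≡ cell c 3
        r54 = cong₂ _+_ child (r5≡3N constants₁)
        other : ∀ v k → ¬ (v ≡ c × k ≡ 0) → column s₂ v k ≡ column s v k
        other v k ne = trans (write-other (mem s₁) c 0 v k r50 ne) (cong (_$ cell v k) same)

      branch : ∀ s₁ s₂ → Read s₁ → Fetched s₁ s₂ → Runs (unless (55 ≤ℕ 3) (block b₃)) s₂ 6 (Assigned c p rs s)
      branch s₁ s₂ _ F = case compareℕ 55 3 s₂ of λ where
          (pass h j≤0) → skip h record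
            { unlabelled = record
                { constants = constants₂
                ; linked    = rest
                ; parents   = λ {v} v∈ → trans (others v 0 λ { (refl , _) → c∉ v∈ }) (parents (there v∈))
                ; rooms     = λ {v} v∈ → trans (others v 3 λ ()) (rooms (there v∈))
                ; choices   = λ { v (suc k) 1≤k → trans (others v (4 + k) λ ()) (choices v (suc k) 1≤k) }
                }
            ; others     = λ v k v≢c _ → others v k (v≢c ∘ proj₁)
            ; outcome    = inj₁ (ℕ.n≤0⇒n≡0 (subst₂ _≤_ choice (r3≡0 constants₂) j≤0) , own , others c 3 (λ ()) , others p 3 (λ ()))
            }
          (fail h 0<j) → enter h (run-block {is = b₃} record
            { unlabelled = record
                { constants = constants-kept N B {c = block b₃} (frame block) constants₂
                ; linked    = linked-cong rs (λ {v} _ → sym (untouched v 1 (λ ()) (λ ()) (λ ()))) rest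
                ; parents   = λ {v} v∈ → trans (untouched v 0 (λ { (refl , _) → c∉ v∈ }) (λ ()) (λ ()))
                                (trans (others v 0 λ { (refl , _) → c∉ v∈ }) (parents (there v∈)))
                ; rooms     = λ {v} v∈ → trans (untouched v 3 (λ ()) (λ { (refl , _) → c∉ v∈ }) (λ { (refl , _) → p∉ v∈ }))
                                (trans (others v 3 λ ()) (rooms (there v∈)))
                ; choices   = λ { v (suc k) 1≤k → trans (untouched v (4 + k) (λ ()) (λ ()) (λ ()))
                                (trans (others v (4 + k) λ ()) (choices v (suc k) 1≤k)) }
                }
            ; others     = λ v k v≢c ne → trans (untouched v k (v≢c ∘ proj₁) (v≢c ∘ proj₁) ne) (others v k (v≢c ∘ proj₁))
            ; outcome    = inj₂ (subst₂ _<_ (r3≡0 constants₂) choice 0<j , label , childRoom′ , parentRoom′)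
            })
        where
        open Fetched F
        s₃ : Store
        s₃ = effects b₃ s₂
        m₁ m₂ : ℕ → ℕ
        m₁ = mem s₂ [ reg s₂ 50 ≔ mem s₂ (reg s₂ 51) ]
        m₂ = m₁ [ reg s₂ 54 ≔ reg s₂ 55 ]
        untouched : ∀ v k → ¬ (v ≡ c × k ≡ 0) → ¬ (v ≡ c × k ≡ 3) → ¬ (v ≡ p × k ≡ 3) → column s₃ v k ≡ column s₂ v k
        untouched v k ne ne′ ne″ = trans (write-other m₂ p 3 v k parentRoom ne″)
          (trans (write-other m₁ c 3 v k childRoom ne′)
                 (write-other (mem s₂) c 0 v k child ne))
        label : column s₃ c 0 ≡ column s p 0
        label = trans (write-other m₂ p 3 c 0 parentRoom λ ())
          (trans (write-other m₁ c 3 c 0 childRoom λ ())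
            (trans (write-same (mem s₂) c 0 child)
              (trans (cong (mem s₂) parent₂) (others p 0 (c≢p ∘ sym ∘ proj₁)))))
        childRoom′ : column s₃ c 3 ≡ j
        childRoom′ = trans (write-other m₂ p 3 c 3 parentRoom (c≢p ∘ proj₁))
          (trans (write-same m₁ c 3 childRoom) choice)
        parentRoom′ : column s₃ p 3 ≡ column s p 3 ∸ j
        parentRoom′ = trans (write-same m₂ p 3 parentRoom) (cong₂ _∸_ room choice)

    -- Labelling `c` undoes the last merge. The choice stored for the current room of `p` either
    -- splits this room between `p` and `c`, or leaves it to `p` while `c` opens a block with its
    -- own best room. Earlier merges are left to the rest of the loop.
    follow-assigned : ∀ {c p rs xs s s₁ s′} → Unlabelled (c ∷ rs) s → parent c ≡ just p → p ∈ xs → c ∉ xs →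
      Assigned c p rs s s₁ → Follows rs (c ∷ xs) s₁ s′ → Follows (c ∷ rs) xs s s′
    follow-assigned {c} {p} {rs} {xs} {s} {s₁} {s′} U e p∈ c∉xs A follows v k v∈ room with v Fin.≟ p
    ... | no v≢p = labels-subst (stage-other rs λ e′ → v≢p (Maybe.just-injective (trans (sym e′) e))) λ π →
            labels-cong π (others v 0 v≢c (v≢p ∘ proj₁))
              (follows _ _ (there v∈) (trans (others v 3 v≢c (v≢p ∘ proj₁)) room) π)
      where
      open Assigned A
      v≢c : v ≢ c
      v≢c refl = c∉xs v∈
    ... | yes refl = labels-subst (stage-parent rs e) split
      where
      open Assigned A
      p≢c : p ≢ c
      p≢c refl = c∉xs p∈
      label-p : labels s₁ p ≡ labels s p
      label-p = others p 0 p≢c λ ()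
      -- The room is stored as a multiple of `N`, so adding it to `cell c 3` addresses the choice
      -- for just that room.
      chosen : ∀ j → 1 ≤ k → Choice recorded m₀ (rootOf (stage rs c)) k j → mem s (cell c 3 + column s p 3) ≡ j * N
      chosen j 1≤k (_ , _ , ch) = trans (cong (mem s) (trans (cong (cell c 3 +_) room) (cell-+ c 3 k)))
        (trans (Unlabelled.choices U c k 1≤k) (trans (cong (λ d → m₀ (cell d (3 + k))) (sym (rootOf-stage rs c))) ch))
      split : ∀ (π : Plan (stage rs p ◂ stage rs c) k) → Labels (labels s′) π (labels s p)
      split (keep {i = i} {j} ch 1≤j π π′) with outcome
      -- A kept child has `j ≥ 1` and hence a nonzero entry `j * N`; a stored 0 always means
      -- severing.
      ... | inj₁ (none , _) = contradiction (trans (sym (chosen j (ℕ.≤-trans 1≤j (ℕ.m≤n+m j i)) ch)) none)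
              (λ jN≡0 → ℕ.<⇒≢ (ℕ.*-mono-≤ 1≤j N≢0) (sym jN≡0))
      ... | inj₂ (_ , label , roomᶜ , roomᵖ) =
        labels-cong π label-p (follows _ _ (there v∈) (trans roomᵖ (trans (cong₂ _∸_ room read) left)) π) ,
        labels-cong π′ label (follows _ _ (here refl) (trans roomᶜ read) π′)
        where
        read : mem s (cell c 3 + column s p 3) ≡ j * N
        read = chosen j (ℕ.≤-trans 1≤j (ℕ.m≤n+m j i)) ch
        left : (i + j) * N ∸ j * N ≡ i * N
        left = trans (cong (_∸ j * N) (ℕ.*-distribʳ-+ N i j)) (ℕ.m+n∸n≡m (i * N) (j * N))
      split (sever ch@(_ , 1≤k , _) (_ , best) j≤B π π′) with outcome
      ... | inj₂ (some , _) = contradiction some (ℕ.<⇒≱ (s≤s (ℕ.≤-reflexive (chosen 0 1≤k ch))))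
      ... | inj₁ (_ , label , roomᶜ , roomᵖ) =
        labels-cong π label-p (follows _ _ (there v∈) (trans roomᵖ room) π) ,
        labels-cong π′ (trans label (cong toℕ (sym (rootOf-stage rs c))))
          (follows _ _ (here refl) (trans roomᶜ (trans (Unlabelled.rooms U (here refl))
            (trans (cong (λ d → m₀ (cell d 3)) (sym (rootOf-stage rs c))) best))) π′)

    labelLoop-correct : ∀ rs {x xs} → Topo (rs ʳ++ (x ∷ xs)) → ∀ s → Unlabelled rs s →
      Runs (until (20 ≤ℕ 3) assign) s (1 + 19 * length rs) (Follows rs (x ∷ xs) s)
    -- With no merge left to undo, each tree is a single node and its plan asks for the label it
    -- already has.
    labelLoop-correct [] t s U = stop
      (holds-≤ {s} {20} {3} (ℕ.≤-trans (ℕ.≤-reflexive linked) z≤n)) λ { _ _ _ _ (whole _) → refl }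
      where open Unlabelled U
    labelLoop-correct (c ∷ rs) {x} {xs} t s U with topo-suffix rs t
    ... | cons {p = p} e p∈ c∉ _ = within
        (ℕ.≤-reflexive (solve 1 (λ n → con 19 :+ (con 1 :+ con 19 :* n) := con 1 :+ con 19 :* (con 1 :+ n)) refl (length rs)))
        (iterate (holds-> {s} {20} {3} (subst₂ _<_ (sym (r3≡0 constants)) (sym (proj₁ linked)) (s≤s z≤n)))
          (assign-correct (λ c∈ → processed-∉ rs t c∈ (here refl)) (λ p∈rs → processed-∉ rs t p∈rs (there p∈)) e
            (λ { refl → c∉ p∈ }) s U)
          λ {s₁} _ A → yielding (λ {s′} _ F → follow-assigned {s′ = s′} U e p∈ c∉ A F)
            (labelLoop-correct rs t s₁ (Assigned.unlabelled A)))
      where open Unlabelled U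

  module _ {a} {A : Set a} {N : ℕ} {default : A} {f : Fin N → A} where

    array-inside : ∀ {i v} → i ≡ toℕ v → array default f i ≡ f v
    array-inside {i} {v} e with i ℕ.<? N
    ... | yes i<N = cong f (Fin.toℕ-injective (trans (Fin.toℕ-fromℕ< i<N) e))
    ... | no  i≮N = contradiction (subst (_< N) (sym e) (Fin.toℕ<n v)) i≮N

    array-outside : ∀ {i} → N ≤ i → array default f i ≡ default
    array-outside {i} N≤i with i ℕ.<? N
    ... | yes i<N = contradiction i<N (ℕ.≤⇒≯ N≤i)
    ... | no  _   = refl

  -- The whole program: optimality and total running time

  module Correctness {a ℓ₁ ℓ₂} (K : OrderedField a ℓ₁ ℓ₂) {N : ℕ} (B : ℕ) (1≤B : 1 ≤ B)
                     (T : RootedTree N) (D : LeafDistribution K T) where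
    open RootedTree T
    open LeafDistribution D using (prob; nonNegative)
    open RAM K using (Outputs; _⊢_⇓[_]_; input; State)
    open Structured K
    open Tests K
    open Order T
    open Cells {N}
    open Potential B
    open TabulationCost B T
    open Ordering K B T
    open TableSteps K {N} B 1≤B
    open Partitions K B prob nonNegative
    open Tabulation K B 1≤B T D
    open OrderedFieldProperties K using (+-monoˡ-≤)
    private module K = OrderedField K

    initial : Store
    initial = ⟪ reg₀ , array 0 (λ v → encodeParent (parent v)) , (λ _ → K.0#) , array K.0# prob ⟫
      where
      reg₀ : ℕ → ℕ
      reg₀ = (λ _ → 0) [ 0 ≔ N ] [ 1 ≔ B ]

    private
      setupBlock : List Instr
      setupBlock = set 2 1 ∷ add 4 0 0 ∷ add 5 4 0 ∷ set 11 1 ∷ []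

      prepared : Store
      prepared = effects setupBlock initial

      N≤cell : ∀ v k → N ≤ cell v (suc k)
      N≤cell v k = ℕ.≤-trans (ℕ.m≤m+n N (k * N)) (ℕ.m≤n+m (suc k * N) (toℕ v))

      scanned₀ : Ordering.Scanned K B T 0 [] prepared
      scanned₀ = record
        { constants = record
            { r0≡N = refl ; r1≡B = refl ; r2≡1 = refl ; r3≡0 = refl
            ; r4≡2N = cong (N +_) (sym (ℕ.+-identityʳ N))
            ; r5≡3N = trans (ℕ.+-assoc N N N) (cong (λ n → N + (N + n)) (sym (ℕ.+-identityʳ N))) }
        ; position  = refl
        ; linked    = refl
        ; topo      = []
        ; parents   = λ v → array-inside (cell-0 v)
        ; marked    = λ ()
        ; unmarked  = λ {w} _ → array-outside (N≤cell w 0)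
        ; scanned   = λ ()
        ; blank     = λ w → array-outside (N≤cell w 1)
        }

    record Solved (s : Store) : Set (a Level.⊔ ℓ₂) where
      field
        solution : Layout N B
        outputs  : ∀ v → mem s (toℕ v) ≡ Layout.block solution v
        optimal  : IsOptimal K T D solution

    private
      labelling-correct : ∀ {rs r} → (∀ v → v ∈ rs ʳ++ (r ∷ [])) → Topo (rs ʳ++ (r ∷ [])) → ∀ s →
                          Current rs [] r s → Runs labelling s (2 + 19 * length rs) Solved
      labelling-correct {rs} {r} all t s C =
        run-block {Q = s₁ ≡_} {is = store 21 21 ∷ []} refl then λ { _ refl →
          yielding (λ {s₂} _ → solve′ s₂) (labelLoop-correct rs t s₁ unlabelled) }
        where
        open Current C
        open Pending pendingAt
        open Selected selected using (kb; 1≤kb; kb≤B; least; recorded)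
        open LabelPhase K B 1≤B T D rs (mem s) using (labelLoop-correct; Unlabelled; Follows; labels)
        open Recorded (Choice rs (mem s)) (Best rs (mem s))
        open Optimality K B D
        s₁ : Store
        s₁ = effects (store 21 21 ∷ []) s
        r21 : reg s 21 ≡ cell r 0
        r21 = trans atNode (sym (cell-0 r))
        other : ∀ v k → ¬ (v ≡ r × k ≡ 0) → column s₁ v k ≡ column s v k
        other v k ne = write-other (mem s) r 0 v k r21 ne
        unlabelled : Unlabelled rs s₁
        unlabelled = record
          { constants = constants-kept N B {c = block (store 21 21 ∷ [])} (frame block) constants
          ; linked    = linked-cong rs (λ {v} _ → sym (other v 1 λ ())) finished
          ; parents   = λ {c} c∈ → trans (other c 0 λ { (refl , _) → processed-∉ rs t c∈ (here refl) }) (parents c)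
          ; rooms     = λ {c} _ → other c 3 λ ()
          ; choices   = λ { c (suc k) _ → other c (4 + k) λ () }
          }
        solve′ : ∀ s₂ → Follows rs (r ∷ []) s₁ s₂ → Solved s₂
        solve′ s₂ follows with π , π≤ ← sound (here refl) kb 1≤kb kb≤B = record
          { solution = L
          ; outputs  = λ v → cong (mem s₂) (sym (cell-0 v))
          ; optimal  = optimal
          }
          where
          rootLabels : Labels (labels s₂) π (toℕ r)
          rootLabels = subst (Labels (labels s₂) π)
            (trans (write-same (mem s) r 0 r21) atNode)
            (follows r kb (here refl) (trans (other r 3 λ ()) recorded) π)
          L : Layout N B
          L = layout rs t all π kb≤B (labels s₂) rootLabels
          optimal : IsOptimal K T D L
          -- The chain leads from the plan to the entry at `kb`, to the entry at the root block size
          -- `k` of the cut made from `L′`, to that cut. The weight of the whole tree pays for the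
          -- root block on both sides.
          optimal L′ with k , κ , k≤B , below ← cut-below-layout rs t all L′ =
            K.≤-trans (layout-cost rs t all π kb≤B (labels s₂) rootLabels)
              (K.≤-trans (+-monoˡ-≤ (weight (stage rs r))
                (K.≤-trans π≤ (K.≤-trans (least k (cut≥1 κ) k≤B) (complete (here refl) κ k≤B)))) below)

      totalCost : ℕ → ℕ → ℕ
      totalCost n m = 4 + ((1 + (10 * N + 10 * N)) + ((12 + 8 * B + (36 + 26 * B) * n + 13 * Φ n) + (2 + 19 * m)))

      -- As `N` and `B` are positive, 1, `N` and `B` are each at most `N * B`, so the coefficients
      -- add up: 19 + 75 + 8 + 52 = 154.
      totalCost-linear : ∀ {n m} → n ≤ N → m ≤ N → 1 ≤ N → totalCost n m ≤ 154 * (N * B)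
      totalCost-linear {n} {m} n≤N m≤N 1≤N = begin
        totalCost n m
          ≤⟨ ℕ.+-monoʳ-≤ 4 (ℕ.+-monoʳ-≤ (1 + (10 * N + 10 * N)) (ℕ.+-mono-≤
               (ℕ.+-mono-≤ (ℕ.+-monoʳ-≤ (12 + 8 * B) (ℕ.*-monoʳ-≤ (36 + 26 * B) n≤N))
                           (ℕ.*-monoʳ-≤ 13 (ℕ.≤-trans (Φ-linear n) (ℕ.*-monoˡ-≤ (B + B) n≤N))))
               (ℕ.+-monoʳ-≤ 2 (ℕ.*-monoʳ-≤ 19 m≤N)))) ⟩
        4 + ((1 + (10 * N + 10 * N)) + ((12 + 8 * B + (36 + 26 * B) * N + 13 * (N * (B + B))) + (2 + 19 * N)))
          ≡⟨ solve 2 (λ N B →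
               con 4 :+ ((con 1 :+ (con 10 :* N :+ con 10 :* N)) :+
                 ((con 12 :+ con 8 :* B :+ (con 36 :+ con 26 :* B) :* N :+ con 13 :* (N :* (B :+ B))) :+ (con 2 :+ con 19 :* N))) :=
               con 19 :* con 1 :+ con 75 :* N :+ con 8 :* B :+ con 52 :* (N :* B)) refl N B ⟩
        19 * 1 + 75 * N + 8 * B + 52 * (N * B)
          ≤⟨ ℕ.+-monoˡ-≤ (52 * (N * B)) (ℕ.+-mono-≤ (ℕ.+-mono-≤ (ℕ.*-monoʳ-≤ 19 (ℕ.*-mono-≤ 1≤N 1≤B))
               (ℕ.*-monoʳ-≤ 75 (ℕ.≤-trans (ℕ.≤-reflexive (sym (ℕ.*-identityʳ N))) (ℕ.*-monoʳ-≤ N 1≤B))))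
               (ℕ.*-monoʳ-≤ 8 (ℕ.≤-trans (ℕ.≤-reflexive (sym (ℕ.*-identityˡ B))) (ℕ.*-monoˡ-≤ B 1≤N)))) ⟩
        19 * (N * B) + 75 * (N * B) + 8 * (N * B) + 52 * (N * B)
          ≡⟨ solve 1 (λ x → con 19 :* x :+ con 75 :* x :+ con 8 :* x :+ con 52 :* x := con 154 :* x) refl (N * B) ⟩
        154 * (N * B) ∎
        where open ℕ.≤-Reasoning

      everywhere : ∀ {ys s} → Scanned N ys s → ∀ v → v ∈ ys
      everywhere S v = Scanned.scanned S (Fin.toℕ<n v)

    solve-correct : Runs layoutProgram initial (154 * (N * B)) Solved
    solve-correct = go (order-correct N refl prepared scanned₀)
      where
      go : Runs order prepared _ (λ s → Σ[ ys ∈ List (Fin N) ] Scanned N ys s) → Runs layoutProgram initial (154 * (N * B)) Solved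
      go (t , s , run , t≤ , ys , S)
        with t′ , s′ , run′ , t′≤ , rs , r , refl , C ← tabulation-correct (everywhere S) (Scanned.topo S) s (Scanned.constants S)
               (Scanned.parents S) (Scanned.linked S) (reg-kept (frame run) 20) (Scanned.blank S)
               (λ v → trans (cong (_$ cell v 0) (memᴷ-kept (frame run))) (array-inside (cell-0 v)))
               (λ { v (suc k) _ → trans (cong (_$ cell v (suc k)) (memᴷ-kept (frame run))) (array-outside (N≤cell v k)) })
        with t″ , s″ , run″ , t″≤ , solved ← labelling-correct (everywhere S) (Scanned.topo S) s′ C =
        _ , s″ , (block ⨾ run ⨾ run′ ⨾ run″) ,
        ℕ.≤-trans (ℕ.+-monoʳ-≤ 4 (ℕ.+-mono-≤ t≤ (ℕ.+-mono-≤ t′≤ t″≤)))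
          (totalCost-linear n≤N (ℕ.≤-trans (ℕ.m≤m+n (length rs) 1) (ℕ.≤-trans (ℕ.≤-reflexive (sym (List.length-ʳ++ rs))) n≤N))
            (ℕ.≤-trans (s≤s z≤n) (Fin.toℕ<n root))) ,
        solved
        where
        n≤N : length (rs ʳ++ (r ∷ [])) ≤ N
        n≤N = length≤N (topo-unique (Scanned.topo S))

theorem3 : ∀ {a ℓ₁ ℓ₂} →
  Σ[ P ∈ Program ] Σ[ c ∈ ℕ ]
    ((K : OrderedField a ℓ₁ ℓ₂) →
     let open OrderedField K
         open RAM K
     in
     (N B : ℕ) → .{{_ : NonZero B}} →
     (T : RootedTree N) (D : LeafDistribution K T) →
     Σ[ t ∈ ℕ ] Σ[ s ∈ State ] Σ[ L ∈ Layout N B ] Σ[ Opt ∈ Layout N B ]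
       (P ⊢ input B T D ⇓[ t ] s) ×
       (t ℕ.≤ c ℕ.* (N ℕ.* B)) ×
       Outputs s L ×
       IsOptimal K T D Opt ×
       (expectedBlockCost K T D L ≤ expectedBlockCost K T D Opt + 1#))
theorem3 = compile 0 layoutProgram , 154 , solved
  where
  open Algorithm
  solved : _
  solved K N B T D
    with t , s , run , t≤ , S ← Correctness.solve-correct K B (ℕ.>-nonZero⁻¹ B) T D =
    t , Structured._at_ K s _ , solution , solution , Structured.compile-halts K _ run , t≤ , outputs , optimal ,
    x≤x+y _ 0≤1
    where
    open Correctness.Solved S
    open OrderedFieldProperties K using (x≤x+y; 0≤1)
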